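{- Let $r\ge 1$ and let $G$ be an $r$-outerplanar triangulated disk with $n$ vertices (with its fixed plane embedding and layers $L_1,\dots,L_r$). Then $G$ contains a well-formed separator sequence of length at least $\left\lfloor \sqrt[2r]{\log n}\,/\,6^{r}\right\rfloor$ and width at most $2r$ (here $\log$ is the logarithm to base 2).
   Context: A plane graph $G=(V,E)$ is a planar graph with a fixed embedding. Its layer decomposition is the partition $V=L_1\uplus\dots\uplus L_r$ where $L_1$ is the set of vertices on the outer face of $G$ and $L_i$ is the set of vertices on the outer face of $G-\bigcup_{j<i}L_j$. $G$ is $r$-outerplanar if it has an embedding whose layer decomposition has at most $r$ layers. A plane graph is a triangulated disk if its outer face is bounded by a simple cycle and all its inner faces are triangles. For an $r$-outerplanar triangulated disk one fixes an embedding with at most $r$ layers. Well-formed separator sequence: Let $G=(V,E)$ be a graph with a fixed plane embedding with layers $L_1,\dots,L_r$. A well-formed separator sequence of length $t$ and width $p$ is a sequence $(A_1,S_1,B_1),\dots,(A_t,S_t,B_t)$ of triples of vertex sets such that: (i) $V=A_i\cup B_i$ for each $i$; (ii) there is no edge between $A_i\setminus B_i$ and $B_i\setminus A_i$; (iii) $S_i=A_i\cap B_i$ and $|S_i|=p$; (iv) $A_i\subsetneq A_{i+1}$ and $B_i\supsetneq B_{i+1}$ for $i<t$; (v) one of the following holds: (a) for all $i$, $S_i$ induces a path $(v_{i,1},\dots,v_{i,p'})$ with $v_{i,1},v_{i,p'}\in L_1$ and $p'=p$; or (b) $L_1\subseteq A_1$ and for all $i$, $S_i$ induces a cycle $(v^*,v_{i,1},\dots,v_{i,p'},v^\dagger)$,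 where the vertices $v^*$ and $v^\dagger$ (possibly $v^*=v^\dagger$) lie on the layer of minimum index that intersects $S_i$, and $p'\in\{p-1,p-2\}$; (vi) for all $1\le i,j\le t$ and $1\le k,\ell\le p'$, if $v_{i,k}=v_{j,\ell}$ then $k=\ell$; (vii) each $S_i$ contains at most two vertices from each layer; (viii) for all $i,j$ and $1\le k\le p'$, $v_{i,k}$ and $v_{j,k}$ lie on the same layer. -}

module Defs where

open import Data.Nat using (ℕ; zero; suc; _+_; _≤_; _≤ᵇ_)
open import Data.Fin using (Fin; toℕ)
open import Data.Fin.Subset using (Subset; _∈_; _∉_; _⊂_; _∩_; ∣_∣)
open import Data.Fin.Permutation using (Permutation′; _⟨$⟩ʳ_)
open import Data.Vec using (Vec; lookup; _∷_; _∷ʳ_)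
open import Data.List using (List; upTo; allFin)
open import Data.Bool using (Bool; true; false; if_then_else_)
open import Data.Product using (Σ; ∃; ∃₂; _×_; _,_)
open import Data.Sum using (_⊎_)
open import Data.Empty using (⊥)
open import Relation.Nullary using (¬_)
open import Relation.Binary.PropositionalEquality using (_≡_; _≢_)

iter : {A : Set} → (A → A) → ℕ → A → A
iter f zero    x = x
iter f (suc k) x = f (iter f k x)

allᵇ : {A : Set} → (A → Bool) → List A → Bool
allᵇ p List.[]       = true
allᵇ p (x List.∷ xs) = if p x then allᵇ p xs else false

countᵇ : {A : Set} → (A → Bool) → List A → ℕ
countᵇ p List.[]       = 0
countᵇ p (x List.∷ xs) = if p x then suc (countᵇ p xs) else countᵇ p xs

-- Plane graphs, given combinatorially as a rotation system
-- (Heffter–Edmonds): a connected simple graph on vertex set Fin n,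
-- darts Fin d (each edge = two opposite darts, swapped by α), a rotation
-- σ which cyclically permutes the darts leaving each vertex (the clockwise
-- order around the vertex in the embedding), genus 0 (Euler's formula
-- V - E + F = 2, faces = orbits of φ = σ ∘ α), and a distinguished dart
-- 'outer' whose face is the outer (unbounded) face.

record PlaneGraph (n : ℕ) : Set where
  field
    d      : ℕ
    tail   : Fin d → Fin n
    α      : Permutation′ d
    σ      : Permutation′ d
    outer  : Fin d

  αf : Fin d → Fin d
  αf x = α ⟨$⟩ʳ x

  σf : Fin d → Fin d
  σf x = σ ⟨$⟩ʳ x

  head : Fin d → Fin n
  head x = tail (αf x)

  φ : Fin d → Fin d
  φ x = σf (αf x)

  Adj : Fin n → Fin n → Set
  Adj u v = ∃ λ x → tail x ≡ u × head x ≡ v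

  numEdges : ℕ
  numEdges = countᵇ (λ x → suc (toℕ x) ≤ᵇ toℕ (αf x)) (allFin d)

  -- number of faces = number of darts that are minimal in their φ-orbit
  numFaces : ℕ
  numFaces = countᵇ (λ x → allᵇ (λ k → toℕ x ≤ᵇ toℕ (iter φ k x)) (upTo d)) (allFin d)

  field
    α-invol   : ∀ x → αf (αf x) ≡ x
    α-nofix   : ∀ x → αf x ≢ x
    σ-vertex  : ∀ x → tail (σf x) ≡ tail x
    σ-cyclic  : ∀ x y → tail x ≡ tail y → ∃ λ k → iter σf k x ≡ y
    loopless  : ∀ x → head x ≢ tail x
    simple    : ∀ x y → tail x ≡ tail y → head x ≡ head y → x ≡ y
    connected : ∀ u v → ∃ λ k → ∃ λ (w : Vec (Fin n) (suc k)) →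
                  lookup w Fin.zero ≡ u × lookup w (Data.Fin.fromℕ k) ≡ v ×
                  (∀ (a : Fin k) → Adj (lookup w (Data.Fin.inject₁ a)) (lookup w (Fin.suc a)))
    euler     : n + numFaces ≡ 2 + numEdges

record TriangulatedDisk {n : ℕ} (G : PlaneGraph n) : Set where
  open PlaneGraph G
  field
    outerLen      : ℕ
    outerLen≥3    : 3 ≤ outerLen
    outer-closed  : iter φ outerLen outer ≡ outer
    outer-simple  : ∀ (j k : Fin outerLen) →
                      tail (iter φ (toℕ j) outer) ≡ tail (iter φ (toℕ k) outer) → j ≡ k
    inner-triangle : ∀ x → (∀ k → iter φ k outer ≢ x) → iter φ 3 x ≡ x

module _ {n : ℕ} (G : PlaneGraph n) where
  open PlaneGraph G

  -- Darts (face sides) lying in the outer face of G - X: the faces of G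
  -- that merge with the outer face of G once the vertices of X and their
  -- incident edges are deleted.
  data InOuterRegion (X : Fin n → Set) : Fin d → Set where
    base : InOuterRegion X outer
    face : ∀ {x} → InOuterRegion X x → InOuterRegion X (φ x)
    edge : ∀ {x} → InOuterRegion X x → X (tail x) ⊎ X (head x) →
           InOuterRegion X (αf x)
    vert : ∀ {x y} → InOuterRegion X x → X (tail x) → tail y ≡ tail x →
           InOuterRegion X y

  OnOuterFace : (Fin n → Set) → Fin n → Set
  OnOuterFace X v = ¬ X v × ∃ λ x → InOuterRegion X x × tail x ≡ v

  -- Layer i = L_{i+1} (0-indexed); Removed i = L_1 ∪ ... ∪ L_i
  mutual
    Layer : ℕ → Fin n → Set
    Layer i v = OnOuterFace (Removed i) v

    Removed : ℕ → Fin n → Set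
    Removed zero    v = ⊥
    Removed (suc i) v = Removed i v ⊎ Layer i v

  AtMostLayers : ℕ → Set
  AtMostLayers r = ∀ v → ∃ λ i → suc i ≤ r × Layer i v

  InducesPath : Subset n → (k : ℕ) → Vec (Fin n) k → Set
  InducesPath S k w =
    (∀ a b → lookup w a ≡ lookup w b → a ≡ b) ×
    (∀ u → (u ∈ S → ∃ λ a → lookup w a ≡ u) × (∀ a → lookup w a ≡ u → u ∈ S)) ×
    (∀ a b → (Adj (lookup w a) (lookup w b) → suc (toℕ a) ≡ toℕ b ⊎ suc (toℕ b) ≡ toℕ a)
           × (suc (toℕ a) ≡ toℕ b ⊎ suc (toℕ b) ≡ toℕ a → Adj (lookup w a) (lookup w b)))

  CycSucc : (k : ℕ) → Fin k → Fin k → Set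
  CycSucc k a b = suc (toℕ a) ≡ toℕ b ⊎ (suc (toℕ a) ≡ k × toℕ b ≡ 0)

  InducesCycle : Subset n → (k : ℕ) → Vec (Fin n) k → Set
  InducesCycle S k w =
    3 ≤ k ×
    (∀ a b → lookup w a ≡ lookup w b → a ≡ b) ×
    (∀ u → (u ∈ S → ∃ λ a → lookup w a ≡ u) × (∀ a → lookup w a ≡ u → u ∈ S)) ×
    (∀ a b → (Adj (lookup w a) (lookup w b) → CycSucc k a b ⊎ CycSucc k b a)
           × (CycSucc k a b ⊎ CycSucc k b a → Adj (lookup w a) (lookup w b)))

  -- Well-formed separator sequences of length t and width p.
  -- Indices i : Fin t stand for 1..t, labels k : Fin p' for 1..p'.

  record WellFormedSeparatorSequence (t p : ℕ) : Set where
    field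
      A B S : Fin t → Subset n
      cover   : ∀ i v → v ∈ A i ⊎ v ∈ B i
      noEdge  : ∀ i u v → u ∈ A i → u ∉ B i → v ∈ B i → v ∉ A i → ¬ Adj u v
      sep     : ∀ i → S i ≡ A i ∩ B i
      size    : ∀ i → ∣ S i ∣ ≡ p
      A-strict : ∀ (i j : Fin t) → suc (toℕ i) ≡ toℕ j → A i ⊂ A j
      B-strict : ∀ (i j : Fin t) → suc (toℕ i) ≡ toℕ j → B j ⊂ B i
      p'  : ℕ
      lab : Fin t → Vec (Fin n) p'
      shape :
        (p' ≡ p × 1 ≤ p' ×
          (∀ i → InducesPath (S i) p' (lab i)) ×
          (∀ i (k : Fin p') → toℕ k ≡ 0 ⊎ suc (toℕ k) ≡ p' → Layer 0 (lookup (lab i) k)))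
        ⊎
        ((∀ (i : Fin t) → toℕ i ≡ 0 → ∀ v → Layer 0 v → v ∈ A i) ×
         (p' + 1 ≡ p ⊎ p' + 2 ≡ p) ×
         (∀ i → ∃₂ λ (vs vd : Fin n) →
            (∃ λ ℓ → Layer ℓ vs × Layer ℓ vd ×
                     (∀ u m → u ∈ S i → Layer m u → ℓ ≤ m)) ×
            ((vs ≡ vd × InducesCycle (S i) (suc p') (vs ∷ lab i))
             ⊎ (vs ≢ vd × InducesCycle (S i) (suc (suc p')) ((vs ∷ lab i) ∷ʳ vd)))))
      labels-consistent : ∀ i j (k ℓ : Fin p') → lookup (lab i) k ≡ lookup (lab j) ℓ → k ≡ ℓ
      twoPerLayer : ∀ i a b c → a ∈ S i → b ∈ S i → c ∈ S i →
                    a ≢ b → b ≢ c → a ≢ c →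
                    ∀ ℓ → Layer ℓ a → Layer ℓ b → Layer ℓ c → ⊥
      sameLayer : ∀ i j (k : Fin p') → ∃ λ ℓ → Layer ℓ (lookup (lab i) k) × Layer ℓ (lookup (lab j) k)

{-# OPTIONS --safe #-}
module Submission where

-- Layers are distances from the outer cycle.  Hence parent edges (from layer i + 1 to layer i) together with the
-- outer cycle minus one edge form a spanning tree, and by Euler's formula every other edge e cuts the faces into two
-- regions whose common boundary is the tree cycle of e; far e is the one avoiding the outer face.  Always stepping
-- across the triangle of e into the larger of the two smaller regions gives about log n nested regions, and each is
-- separated from the rest by two tree paths, so by at most two vertices per layer.
-- These paths may be joined by chords.  Take a stretch of the sequence in which the least value of (sum of the layers
-- of the ends of e) is attained often, and keep the indices attaining it.  No edge crossed within the stretch is then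
-- a chord of a separator that is kept, so cutting at the lowest chords leaves chordless cycles around nested regions.
-- Finally the pigeonhole principle makes the layers of the ends and the position and type of the chord constant.

open import Defs
open import Algebra.Bundles using (CommutativeRing)
open import Data.Nat
open import Data.Nat.Properties
open import Data.Nat.Solver using (module +-*-Solver)
open import Data.Bool using (Bool; true; false; if_then_else_; not; _∧_; _∨_; _xor_)
import Data.Bool.Properties as BP
open import Data.Bool.Properties using (T-≡; xor-∧-commutativeRing; xor-identityʳ; xor-comm; xor-same; not-¬)
open import Data.Fin as F using (Fin; toℕ; opposite)
import Data.Fin.Properties as FP
open import Data.Fin.Permutation using (inverseˡ; _⟨$⟩ˡ_)
open import Data.Fin.Subset using (Subset; _∈_; _∉_; _⊂_; _∩_; ∣_∣)
import Data.Fin.Subset.Properties as SubsetP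
open import Data.Vec as Vec using (Vec; lookup; _∷_; []; _∷ʳ_)
import Data.Vec.Properties as VecP
open import Data.List as List using (List; []; _∷_; length; allFin; upTo; filter)
open import Data.List.Properties using (length-map; length-++; length-tabulate)
open import Data.List.Membership.Propositional using () renaming (_∈_ to _∈ˡ_)
open import Data.List.Membership.Propositional.Properties using (∈-allFin; ∈-map⁺; ∈-++⁺ˡ; ∈-++⁺ʳ; ∈-upTo⁺; ∈-lookup)
open import Data.List.Relation.Unary.Any using (here; there; index)
open import Data.List.Relation.Unary.Any.Properties using (lookup-index)
open import Data.List.Relation.Unary.All as All using (All; []; _∷_)
import Data.List.Relation.Unary.All.Properties as AllP
open import Data.List.Relation.Unary.AllPairs using (AllPairs; []; _∷_)
import Data.List.Relation.Unary.AllPairs.Properties as AllPairsP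
open import Data.List.Relation.Unary.Unique.Propositional using (Unique)
open import Data.List.Relation.Unary.Unique.Propositional.Properties using (allFin⁺)
open import Data.Product using (Σ; ∃; _×_; _,_; proj₁; proj₂)
open import Data.Sum using (_⊎_; inj₁; inj₂; [_,_]; [_,_]′; swap)
open import Data.Empty using (⊥; ⊥-elim)
open import Relation.Nullary using (¬_; Dec; yes; no; does; _×-dec_; _⊎-dec_; ¬?)
open import Relation.Nullary.Decidable using (dec-true; dec-false; map′)
open import Relation.Binary.PropositionalEquality hiding ([_])
open import Relation.Binary.Definitions using (tri<; tri≈; tri>)
open import Function using (_∘_; id; Equivalence)

-- No topology is used beyond the rotation system. A set of faces is a `φ`-invariant Boolean
-- function on darts, its boundary is a coboundary mod 2, and the Jordan curve theorem is replaced
-- by `constant` (a face colouring that changes only across tree edges is constant) and a count of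
-- links that produces the region of an edge. Laminarity, the splitting of a region and the shape of
-- its boundary all come from applying `constant`, or the leaf stripping behind it, to a suitable
-- Boolean combination. The main obstacle is that a chord can lie on either side of its tree cycle.
-- If its region is inside that of e, it is subtracted; if it is outside, the region of e is
-- subtracted from it, and the differences grow along the path, so the order must be reversed. The
-- sum of the end layers takes 2r - 1 values, whence a path of length m^(2r - 1) has a stretch with
-- m minima. Fixing one end layer (the other follows from the sum), the two positions of the chord
-- and one of 4 types (none, tree edge, inside, outside) costs a factor 4r^3, which is at most 6^r.

-- Labellings under few identifications

merge-labels : ∀ {A : Set} {K} (c : A → Fin (suc (suc K))) (s : Fin (suc (suc K)) → A) →
  (∀ i → c (s i) ≡ i) → (x y : A) → c x ≢ c y →
  Σ (A → Fin (suc K)) λ c′ → Σ (Fin (suc K) → A) λ s′ →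
    (∀ i → c′ (s′ i) ≡ i) × c′ x ≡ c′ y × (∀ z w → c z ≡ c w → c′ z ≡ c′ w)
merge-labels {A} {K} c s cs x y x≢y = c′ , s′ , cs′ , xy , finer
  where
  -- The class of `x` is sent to that of `y` and its label punched out. The decision is an argument
  -- so that `g-irr` can exchange two decisions about equal labels.
  g : (i : Fin (suc (suc K))) → Dec (c x ≡ i) → Fin (suc K)
  g i (yes _)  = F.punchOut {i = c x} {j = c y} x≢y
  g i (no x≢i) = F.punchOut {i = c x} {j = i} x≢i
  g-irr : ∀ i j (p : Dec (c x ≡ i)) (q : Dec (c x ≡ j)) → i ≡ j → g i p ≡ g j q
  g-irr i .i (yes p) (yes q) refl = refl
  g-irr i .i (yes p) (no q)  refl = ⊥-elim (q p)
  g-irr i .i (no p)  (yes q) refl = ⊥-elim (p q)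
  g-irr i .i (no p)  (no q)  refl = FP.punchOut-cong (c x) refl
  c′ : A → Fin (suc K)
  c′ z = g (c z) (c x FP.≟ c z)
  s′ : Fin (suc K) → A
  s′ i = s (F.punchIn (c x) i)
  cs′ : ∀ i → c′ (s′ i) ≡ i
  cs′ i = trans (g-irr (c (s′ i)) (F.punchIn (c x) i) (c x FP.≟ _) (no (FP.punchInᵢ≢i (c x) i ∘ sym)) (cs _))
                (FP.punchOut-punchIn (c x))
  xy : c′ x ≡ c′ y
  xy = trans (g-irr (c x) (c x) (c x FP.≟ _) (yes refl) refl)
             (g-irr′ (c x FP.≟ c y))
    where
    g-irr′ : ∀ q → g (c x) (yes refl) ≡ g (c y) q
    g-irr′ (yes p) = ⊥-elim (x≢y p)
    g-irr′ (no p)  = FP.punchOut-cong (c x) refl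
  finer : ∀ z w → c z ≡ c w → c′ z ≡ c′ w
  finer z w eq = g-irr (c z) (c w) (c x FP.≟ _) (c x FP.≟ _) eq

-- Union–find: each link merges at most two of the K classes.
nonconstant-labelling : ∀ {A : Set} (K : ℕ) (c : A → Fin K) (s : Fin K → A) → (∀ i → c (s i) ≡ i) →
  (links : List (A × A)) → 2 + length links ≤ K →
  Σ (A → Bool) λ χ → (∀ z w → c z ≡ c w → χ z ≡ χ w) ×
    (∀ {x y} → (x , y) ∈ˡ links → χ x ≡ χ y) × Σ A λ x → Σ A λ y → χ x ≢ χ y
nonconstant-labelling (suc (suc K)) c s cs [] le =
  (λ z → isZero (c z)) , (λ z w eq → cong isZero eq) , (λ ()) ,
  s F.zero , s (F.suc F.zero) , differ
  where
  isZero : ∀ {n} → Fin n → Bool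
  isZero F.zero    = true
  isZero (F.suc _) = false
  differ : isZero (c (s F.zero)) ≢ isZero (c (s (F.suc F.zero)))
  differ rewrite cs F.zero | cs (F.suc F.zero) = λ ()
nonconstant-labelling (suc zero) c s cs (_ ∷ _) (s≤s ())
nonconstant-labelling (suc (suc K)) c s cs ((x , y) ∷ ls) (s≤s le) with c x FP.≟ c y
... | yes eq =
  let χ , inv , resp , diff = nonconstant-labelling (suc (suc K)) c s cs ls (m≤n⇒m≤1+n le)
  in χ , inv , (λ { (here refl) → inv _ _ eq ; (there m) → resp m }) , diff
... | no neq =
  let c′ , s′ , cs′ , xy , refine = merge-labels c s cs x y neq
      χ , inv , resp , diff = nonconstant-labelling (suc K) c′ s′ cs′ ls le
  in χ , (λ z w eq → inv z w (refine z w eq)) ,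
     (λ { (here refl) → inv _ _ xy ; (there m) → resp m }) , diff

-- Counting in lists

select : {A : Set} → (A → Bool) → List A → List A
select p [] = []
select p (x ∷ xs) = if p x then x ∷ select p xs else select p xs

length-select : ∀ {A : Set} (p : A → Bool) xs → length (select p xs) ≡ countᵇ p xs
length-select p [] = refl
length-select p (x ∷ xs) with p x
... | true  = cong suc (length-select p xs)
... | false = length-select p xs

∈-select : ∀ {A : Set} (p : A → Bool) {x xs} → x ∈ˡ xs → p x ≡ true → x ∈ˡ select p xs
∈-select p {x} (here refl) px rewrite px = here refl
∈-select p {xs = y ∷ ys} (there m) px with p y
... | true  = there (∈-select p m px)
... | false = ∈-select p m px

count-split : ∀ {A : Set} (p q : A → Bool) xs →
  countᵇ (λ x → p x ∧ q x) xs + countᵇ (λ x → p x ∧ not (q x)) xs ≡ countᵇ p xs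
count-split p q [] = refl
count-split p q (x ∷ xs) with p x | q x
... | false | _    = count-split p q xs
... | true | true  = cong suc (count-split p q xs)
... | true | false = trans (+-suc _ _) (cong suc (count-split p q xs))

count-not : ∀ {A : Set} (p : A → Bool) xs → countᵇ p xs + countᵇ (λ x → not (p x)) xs ≡ length xs
count-not p [] = refl
count-not p (x ∷ xs) with p x
... | true  = cong suc (count-not p xs)
... | false = trans (+-suc _ _) (cong suc (count-not p xs))

count-∪ : ∀ {A : Set} (f g h : A → Bool) xs → (∀ x → f x ≡ true → g x ≡ true ⊎ h x ≡ true) →
  countᵇ f xs ≤ countᵇ g xs + countᵇ h xs
count-∪ f g h [] cov = z≤n
count-∪ f g h (x ∷ xs) cov with f x in fx | g x in gx | h x in hx
... | false | false | false = count-∪ f g h xs cov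
... | false | true  | false = m≤n⇒m≤1+n (count-∪ f g h xs cov)
... | false | false | true  = ≤-trans (m≤n⇒m≤1+n (count-∪ f g h xs cov)) (≤-reflexive (sym (+-suc _ _)))
... | false | true  | true  = m≤n⇒m≤1+n (≤-trans (count-∪ f g h xs cov) (+-monoʳ-≤ _ (n≤1+n _)))
... | true  | true  | false = s≤s (count-∪ f g h xs cov)
... | true  | false | true  = ≤-trans (s≤s (count-∪ f g h xs cov)) (≤-reflexive (sym (+-suc _ _)))
... | true  | true  | true  = s≤s (≤-trans (count-∪ f g h xs cov) (+-monoʳ-≤ _ (n≤1+n _)))
... | true  | false | false with cov x fx
...   | inj₁ e = ⊥-elim (not-¬ (trans (sym e) gx) refl)
...   | inj₂ e = ⊥-elim (not-¬ (trans (sym e) hx) refl)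

count-≥ : ∀ {m n} (p : Fin n → Bool) (f : Fin m → Fin n) → (∀ {i j} → f i ≡ f j → i ≡ j) →
  (∀ i → p (f i) ≡ true) → m ≤ countᵇ p (allFin n)
count-≥ {m} {n} p f inj pf =
  subst (m ≤_) (length-select p (allFin n)) (FP.injective⇒≤ {f = pos} pos-inj)
  where
  mem : ∀ i → f i ∈ˡ select p (allFin n)
  mem i = ∈-select p (∈-allFin (f i)) (pf i)
  pos : Fin m → Fin (length (select p (allFin n)))
  pos i = index (mem i)
  pos-inj : ∀ {i j} → pos i ≡ pos j → i ≡ j
  pos-inj {i} {j} eq = inj (trans (lookup-index (mem i))
    (trans (cong (List.lookup (select p (allFin n))) eq) (sym (lookup-index (mem j)))))

count-none : ∀ {A : Set} (p : A → Bool) xs → (∀ x → p x ≡ false) → countᵇ p xs ≡ 0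
count-none p [] none = refl
count-none p (x ∷ xs) none rewrite none x = count-none p xs none

count-single : ∀ {n} (a : Fin n) → countᵇ (λ x → does (x FP.≟ a)) (allFin n) ≤ 1
count-single {n} a = go (allFin n) (allFin⁺ n)
  where
  none : ∀ xs → All (a ≢_) xs → countᵇ (λ x → does (x FP.≟ a)) xs ≡ 0
  none [] _ = refl
  none (x ∷ xs) (a≢x All.∷ r) with x FP.≟ a
  ... | yes e = ⊥-elim (a≢x (sym e))
  ... | no _  = none xs r
  go : ∀ xs → Unique xs → countᵇ (λ x → does (x FP.≟ a)) xs ≤ 1
  go [] _ = z≤n
  go (x ∷ xs) (x∉ AllPairs.∷ u) with x FP.≟ a
  ... | yes refl = s≤s (≤-reflexive (none xs x∉))
  ... | no _     = go xs u

-- Sums mod 2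

module Xor = CommutativeRing xor-∧-commutativeRing
open import Algebra.Properties.CommutativeMonoid.Sum Xor.+-commutativeMonoid
  using (sum; sum-cong-≗; ∑-distrib-+; sum-permute)
open import Algebra.Properties.CommutativeSemigroup Xor.+-commutativeSemigroup
  using () renaming (interchange to xor-interchange)

sum-false : ∀ {d} (f : Fin d → Bool) → (∀ x → f x ≡ false) → sum f ≡ false
sum-false {zero}  f z = refl
sum-false {suc d} f z rewrite z F.zero = sum-false (f ∘ F.suc) (z ∘ F.suc)

sum-single : ∀ {d} (f : Fin d → Bool) y → (∀ x → x ≢ y → f x ≡ false) → sum f ≡ f y
sum-single {suc d} f F.zero z
  rewrite sum-false (f ∘ F.suc) (λ x → z (F.suc x) λ ()) = xor-identityʳ _
sum-single {suc d} f (F.suc y) z rewrite z F.zero (λ ()) =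
  sum-single (f ∘ F.suc) y (λ x x≢y → z (F.suc x) (x≢y ∘ FP.suc-injective))

xor-≡ : ∀ {a b} → a xor b ≡ false → a ≡ b
xor-≡ {false} {false} _ = refl
xor-≡ {true}  {true}  _ = refl

≡-xor : ∀ {a b} → a ≡ b → a xor b ≡ false
≡-xor {a} refl = xor-same a

xor-≢ : ∀ {a b} → a xor b ≡ true → a ≢ b
xor-≢ {false} {true} _ ()
xor-≢ {true} {false} _ ()

≢-xor : ∀ {a b} → a ≢ b → a xor b ≡ true
≢-xor {false} {false} n = ⊥-elim (n refl)
≢-xor {false} {true}  n = refl
≢-xor {true}  {false} n = refl
≢-xor {true}  {true}  n = ⊥-elim (n refl)

t≢f : ∀ {A : Set} {b : Bool} → b ≡ true → b ≡ false → A
t≢f {b = true} _ ()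

¬t⇒f : ∀ {b : Bool} → b ≢ true → b ≡ false
¬t⇒f {true} n = ⊥-elim (n refl)
¬t⇒f {false} _ = refl

iter-shift : ∀ {A : Set} (f : A → A) k x → iter f k (f x) ≡ f (iter f k x)
iter-shift f zero    x = refl
iter-shift f (suc k) x = cong f (iter-shift f k x)

iter-+ : ∀ {A : Set} (f : A → A) j k x → iter f (j + k) x ≡ iter f j (iter f k x)
iter-+ f zero    k x = refl
iter-+ f (suc j) k x = cong f (iter-+ f j k x)

-- Outer face, layers and the spanning tree

module Disk {n : ℕ} (G : PlaneGraph n) (T : TriangulatedDisk G) (r : ℕ) (lay : AtMostLayers G r) where
  open PlaneGraph G public
  open TriangulatedDisk T public

  αα : ∀ {x} → αf (αf x) ≡ x
  αα = α-invol _

  α-inj : ∀ {x y} → αf x ≡ αf y → x ≡ y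
  α-inj e = trans (sym αα) (trans (cong αf e) αα)

  φ-inj : ∀ {x y} → φ x ≡ φ y → x ≡ y
  φ-inj {x} {y} e = α-inj (trans (sym (inverseˡ σ)) (trans (cong (σ ⟨$⟩ˡ_) e) (inverseˡ σ)))

  iterφ-inj : ∀ j {x y} → iter φ j x ≡ iter φ j y → x ≡ y
  iterφ-inj zero    e = e
  iterφ-inj (suc j) e = iterφ-inj j (φ-inj e)

  tail-φ : ∀ x → tail (φ x) ≡ head x
  tail-φ x = σ-vertex (αf x)

  head-α : ∀ x → head (αf x) ≡ tail x
  head-α x = cong tail αα

  Outer : Fin d → Set
  Outer x = ∃ λ j → iter φ j outer ≡ x

  outer-Outer : Outer outer
  outer-Outer = 0 , refl

  φ-Outer : ∀ {x} → Outer x → Outer (φ x)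
  φ-Outer (j , e) = suc j , cong φ e

  -- Reduces the exponent modulo `outerLen`, which turns membership in the outer face into a finite
  -- search.
  wrap : ∀ j → Σ (Fin outerLen) λ k → iter φ (toℕ k) outer ≡ iter φ j outer
  wrap zero with outerLen | outerLen≥3
  ... | suc m | _ = F.zero , refl
  wrap (suc j) with wrap j
  ... | k , e with suc (toℕ k) <? outerLen
  ... | yes lt = F.fromℕ< lt , trans (cong (λ i → iter φ i outer) (FP.toℕ-fromℕ< lt)) (cong φ e)
  ... | no nlt with wrap zero
  ...   | z , e₀ = z , trans e₀ (trans (sym outer-closed)
            (trans (cong (λ i → iter φ i outer) (sym (≤-antisym (FP.toℕ<n k) (≮⇒≥ nlt)))) (cong φ e)))

  Outer? : ∀ x → Dec (Outer x)
  Outer? x with FP.any? (λ (k : Fin outerLen) → iter φ (toℕ k) outer FP.≟ x)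
  ... | yes (k , e) = yes (toℕ k , e)
  ... | no ¬k = no λ { (j , e) → let k , e′ = wrap j in ¬k (k , trans e′ e) }

  Outer-unique : ∀ {x y} → Outer x → Outer y → tail x ≡ tail y → x ≡ y
  Outer-unique (i , ex) (j , ey) t with wrap i | wrap j
  ... | k , e | l , e′ = trans (sym (trans e ex)) (trans
        (cong (λ a → iter φ (toℕ a) outer)
          (outer-simple k l (trans (cong tail (trans e ex)) (trans t (sym (cong tail (trans e′ ey)))))))
        (trans e′ ey))

  -- If both darts of an edge were outer, uniqueness of the outer dart at a vertex would give
  -- `φ x ≡ αf x` and `φ (αf x) ≡ x`, so the outer face would have period 2, against `outerLen≥3`.
  Outer-α : ∀ {x} → Outer x → ¬ Outer (αf x)
  Outer-α {x} ox@(j , e) oα = two≢0 (outer-simple two zer t)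
    where
    φx≡αx : φ x ≡ αf x
    φx≡αx = Outer-unique (φ-Outer ox) oα (tail-φ x)
    φαx≡x : φ (αf x) ≡ x
    φαx≡x = Outer-unique (φ-Outer oα) ox (trans (tail-φ _) (head-α x))
    period : φ (φ outer) ≡ outer
    period = iterφ-inj j (trans (iter-shift φ j (φ outer)) (trans (cong φ (iter-shift φ j outer))
      (trans (cong (φ ∘ φ) e) (trans (cong φ φx≡αx) (trans φαx≡x (sym e))))))
    two zer : Fin outerLen
    two = F.fromℕ< outerLen≥3
    zer = F.fromℕ< (≤-trans (s≤s z≤n) outerLen≥3)
    t : tail (iter φ (toℕ two) outer) ≡ tail (iter φ (toℕ zer) outer)
    t rewrite FP.toℕ-fromℕ< outerLen≥3 | FP.toℕ-fromℕ< (≤-trans (s≤s z≤n) outerLen≥3) = cong tail period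
    two≢0 : two ≢ zer
    two≢0 e with trans (sym (FP.toℕ-fromℕ< outerLen≥3)) (trans (cong toℕ e) (FP.toℕ-fromℕ< (≤-trans (s≤s z≤n) outerLen≥3)))
    ... | ()

  inner³ : ∀ {x} → ¬ Outer x → φ (φ (φ x)) ≡ x
  inner³ {x} i = inner-triangle x (λ k e → i (k , e))

  inner-φ : ∀ {x} → ¬ Outer x → ¬ Outer (φ x)
  inner-φ i o = i (subst Outer (inner³ i) (φ-Outer (φ-Outer o)))

  Outer-pred : ∀ {x} → Outer x → ∃ λ y → Outer y × φ y ≡ x
  Outer-pred (suc j , e) = iter φ j outer , (j , refl) , e
  Outer-pred (zero , refl) with outerLen | outerLen≥3 | outer-closed
  ... | suc m | _ | c = iter φ m outer , (m , refl) , c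

  ℓ : Fin n → ℕ
  ℓ v = proj₁ (lay v)

  ℓ<r : ∀ v → ℓ v < r
  ℓ<r v = proj₁ (proj₂ (lay v))

  Layer-ℓ : ∀ v → Layer G (ℓ v) v
  Layer-ℓ v = proj₂ (proj₂ (lay v))

  Removed-mono : ∀ {i j v} → i ≤′ j → Removed G i v → Removed G j v
  Removed-mono ≤′-refl      m = m
  Removed-mono (≤′-step le) m = inj₁ (Removed-mono le m)

  Layer⇒Removed : ∀ {i j v} → i < j → Layer G i v → Removed G j v
  Layer⇒Removed lt l = Removed-mono (≤⇒≤′ lt) (inj₂ l)

  Removed⇒Layer : ∀ i {v} → Removed G i v → ∃ λ j → j < i × Layer G j v
  Removed⇒Layer (suc i) (inj₁ m) = let j , lt , l = Removed⇒Layer i m in j , m≤n⇒m≤1+n lt , l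
  Removed⇒Layer (suc i) (inj₂ l) = i , ≤-refl , l

  Layer-unique : ∀ {i j v} → Layer G i v → Layer G j v → i ≡ j
  Layer-unique {i} {j} li lj with <-cmp i j
  ... | tri< lt _ _ = ⊥-elim (proj₁ lj (Layer⇒Removed lt li))
  ... | tri≈ _ e _  = e
  ... | tri> _ _ gt = ⊥-elim (proj₁ li (Layer⇒Removed gt lj))

  ℓ-unique : ∀ {i v} → Layer G i v → ℓ v ≡ i
  ℓ-unique l = Layer-unique (Layer-ℓ _) l

  region-mono : ∀ {X Y : Fin n → Set} → (∀ {v} → X v → Y v) → ∀ {x} → InOuterRegion G X x → InOuterRegion G Y x
  region-mono s base = base
  region-mono s (face p) = face (region-mono s p)
  region-mono s (edge p (inj₁ a)) = edge (region-mono s p) (inj₁ (s a))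
  region-mono s (edge p (inj₂ a)) = edge (region-mono s p) (inj₂ (s a))
  region-mono s (vert p a t) = vert (region-mono s p) (s a) t

  -- Once the tail of `x` is removed, all faces around it merge with the outer region, so the head
  -- is on the next outer face unless it was removed before.
  ℓ-step : ∀ x → ℓ (head x) ≤ suc (ℓ (tail x))
  ℓ-step x with ℓ (head x) ≤? suc (ℓ (tail x))
  ... | yes le = le
  ... | no nle = ⊥-elim (nle (≤-reflexive (ℓ-unique
          (notR , αf x , edge (vert inR rem′ (sym (proj₂ (proj₂ (proj₂ lu))))) (inj₁ rem) , refl))))
    where
    i = ℓ (tail x)
    lu = Layer-ℓ (tail x)
    rem : Removed G (suc i) (tail x)
    rem = inj₂ lu
    inR : InOuterRegion G (Removed G (suc i)) (proj₁ (proj₂ lu))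
    inR = region-mono inj₁ (proj₁ (proj₂ (proj₂ lu)))
    rem′ : Removed G (suc i) (tail (proj₁ (proj₂ lu)))
    rem′ = subst (Removed G (suc i)) (sym (proj₂ (proj₂ (proj₂ lu)))) rem
    notR : ¬ Removed G (suc i) (head x)
    notR m = let j , lt , l = Removed⇒Layer (suc i) m in
      nle (≤-trans (≤-reflexive (ℓ-unique l)) (≤-trans (n≤1+n j) lt))

  region₀ : ∀ {x} → InOuterRegion G (Removed G 0) x → Outer x
  region₀ base = outer-Outer
  region₀ (face p) = φ-Outer (region₀ p)
  region₀ (edge p (inj₁ ()))
  region₀ (edge p (inj₂ ()))

  Outer⇒region : ∀ {X} j → InOuterRegion G X (iter φ j outer)
  Outer⇒region zero    = base
  Outer⇒region (suc j) = face (Outer⇒region j)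

  Outer-ℓ : ∀ {x} → Outer x → ℓ (tail x) ≡ 0
  Outer-ℓ (j , refl) = ℓ-unique ((λ ()) , _ , Outer⇒region j , refl)

  ℓ0-dart : ∀ {v} → ℓ v ≡ 0 → ∃ λ x → Outer x × tail x ≡ v
  ℓ0-dart {v} e with subst (λ i → Layer G i v) e (Layer-ℓ v)
  ... | _ , x , p , t = x , region₀ p , t

  -- The outer region spreads only at deleted vertices, so every triangle it reaches has a deleted
  -- corner. `interior-parent` takes this corner as the parent.
  region-corner : ∀ {X x} → InOuterRegion G X x → Outer x ⊎ X (tail x) ⊎ X (tail (φ x)) ⊎ X (tail (φ (φ x)))
  region-corner base = inj₁ outer-Outer
  region-corner {X} (face {x} p) with Outer? x | region-corner p
  ... | yes o | _ = inj₁ (φ-Outer o)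
  ... | no i | inj₁ o = ⊥-elim (i o)
  ... | no i | inj₂ (inj₁ a) = inj₂ (inj₂ (inj₂ (subst X (cong tail (sym (inner³ i))) a)))
  ... | no i | inj₂ (inj₂ (inj₁ a)) = inj₂ (inj₁ a)
  ... | no i | inj₂ (inj₂ (inj₂ a)) = inj₂ (inj₂ (inj₁ a))
  region-corner {X} (edge {x} p (inj₁ a)) = inj₂ (inj₂ (inj₁ (subst X (sym (trans (tail-φ _) (head-α x))) a)))
  region-corner {X} (edge {x} p (inj₂ a)) = inj₂ (inj₁ a)
  region-corner {X} (vert p a t) = inj₂ (inj₁ (subst X (sym t) a))

  -- On layer 0 the parent is the next vertex of the outer cycle. One dart per vertex thus covers
  -- the tree together with the edge of `outer`, which `Tr` leaves out.
  record ParentDart (v : Fin n) : Set where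
    field
      dart  : Fin d
      from  : tail dart ≡ v
      up    : ∀ {k} → ℓ v ≡ suc k → ℓ (head dart) ≡ k
      along : ℓ v ≡ 0 → Outer dart

  interior-parent : ∀ v k → ℓ v ≡ suc k → ∃ λ x → tail x ≡ v × ℓ (head x) ≡ k
  interior-parent v k e with subst (λ i → Layer G i v) e (Layer-ℓ v)
  ... | notR , x , p , t with region-corner p
  ... | inj₁ o = ⊥-elim (0≢1+n (trans (sym (trans (cong ℓ (sym t)) (Outer-ℓ o))) e))
  ... | inj₂ (inj₁ a) = ⊥-elim (notR (subst (Removed G (suc k)) t a))
  ... | inj₂ (inj₂ (inj₁ a)) = x , t , low
    where
    low : ℓ (head x) ≡ k
    low with Removed⇒Layer (suc k) a
    ... | j , s≤s lt , l = ≤-antisym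
          (≤-trans (≤-reflexive (trans (cong ℓ (sym (tail-φ x))) (ℓ-unique l))) lt)
          (s≤s⁻¹ (≤-trans (≤-reflexive (trans (sym e) (cong ℓ (trans (sym t) (sym (head-α x)))))) (ℓ-step (αf x))))
  ... | inj₂ (inj₂ (inj₂ a)) = αf y , ty , low
    where
    y = φ (φ x)
    i : ¬ Outer x
    i o = 0≢1+n (trans (sym (trans (cong ℓ (sym t)) (Outer-ℓ o))) e)
    ty : tail (αf y) ≡ v
    ty = trans (sym (tail-φ y)) (trans (cong tail (inner³ i)) t)
    low : ℓ (head (αf y)) ≡ k
    low rewrite αα {y} with Removed⇒Layer (suc k) a
    ... | j , s≤s lt , l = ≤-antisym
          (≤-trans (≤-reflexive (ℓ-unique l)) lt)
          (s≤s⁻¹ (≤-trans (≤-reflexive (trans (sym e) (cong ℓ (sym ty)))) (ℓ-step y)))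

  parentDart : ∀ v → ParentDart v
  parentDart v with ℓ v in eq
  ... | zero = record { dart = proj₁ b ; from = proj₂ (proj₂ b)
                      ; up = λ e → ⊥-elim (0≢1+n (trans (sym eq) e)) ; along = λ _ → proj₁ (proj₂ b) }
    where b = ℓ0-dart eq
  ... | suc k = record { dart = proj₁ b ; from = proj₁ (proj₂ b)
                       ; up = λ e → trans (proj₂ (proj₂ b)) (suc-injective (trans (sym eq) e))
                       ; along = λ e → ⊥-elim (0≢1+n (trans (sym e) eq)) }
    where b = interior-parent v k eq

  abstract
    pd : Fin n → Fin d
    pd v = ParentDart.dart (parentDart v)

    tail-pd : ∀ v → tail (pd v) ≡ v
    tail-pd v = ParentDart.from (parentDart v)

    pd-up : ∀ {v k} → ℓ v ≡ suc k → ℓ (head (pd v)) ≡ k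
    pd-up {v} = ParentDart.up (parentDart v)

    pd-Outer : ∀ {v} → ℓ v ≡ 0 → Outer (pd v)
    pd-Outer {v} = ParentDart.along (parentDart v)

  par : Fin n → Fin n
  par v = head (pd v)

  pd-inner : ∀ {v k} → ℓ v ≡ suc k → ¬ Outer (pd v)
  pd-inner e o = 0≢1+n (trans (sym (trans (cong ℓ (sym (tail-pd _))) (Outer-ℓ o))) e)

  Outer-head : ∀ {x} → Outer x → ℓ (head x) ≡ 0
  Outer-head {x} o = trans (cong ℓ (sym (tail-φ x))) (Outer-ℓ (φ-Outer o))

  αpd-inner : ∀ {v k} → ℓ v ≡ suc k → ¬ Outer (αf (pd v))
  αpd-inner e o = 0≢1+n (trans (sym (trans (cong ℓ (trans (sym (tail-pd _)) (sym (head-α _)))) (Outer-head o))) e)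

  Outer⇒pd : ∀ {x} → Outer x → x ≡ pd (tail x)
  Outer⇒pd o = Outer-unique o (pd-Outer (Outer-ℓ o)) (sym (tail-pd _))

  inner-dart : ∀ v → ∃ λ x → tail x ≡ v × ¬ Outer x
  inner-dart v with ℓ v in eq
  ... | suc k = pd v , tail-pd v , pd-inner eq
  ... | zero  = φ (αf (pd v)) , trans (tail-φ _) (trans (head-α _) (tail-pd v)) ,
                inner-φ (Outer-α (pd-Outer eq))

  pd-inj : ∀ {v w} → pd v ≡ pd w → v ≡ w
  pd-inj e = trans (sym (tail-pd _)) (trans (cong tail e) (tail-pd _))

  -- Layers drop along the parent dart of an interior vertex and stay 0 on the outer cycle, where
  -- `Outer-α` excludes the reversed dart. With `pd-inj`, the `n` parent darts belong to `n`
  -- distinct edges.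
  pd≢αpd : ∀ v w → pd v ≢ αf (pd w)
  pd≢αpd v w e with ℓ v in ev | ℓ w in ew
  ... | zero  | zero  = Outer-α (pd-Outer ew) (subst Outer e (pd-Outer ev))
  ... | zero  | suc k = αpd-inner ew (subst Outer e (pd-Outer ev))
  ... | suc k | zero  = αpd-inner ev (subst Outer (trans (sym αα) (cong αf (sym e))) (pd-Outer ew))
  ... | suc k | suc m = 1+n≰n (≤-trans (n≤1+n _) (≤-reflexive (sym (trans k≡ (cong suc m≡)))))
    where
    m≡ : m ≡ suc k
    m≡ = trans (sym (pd-up ew)) (trans (cong (ℓ ∘ tail) (sym e)) (trans (cong ℓ (tail-pd v)) ev))
    k≡ : k ≡ suc m
    k≡ = trans (sym (pd-up ev)) (trans (cong (ℓ ∘ tail ∘ αf) e) (trans (cong ℓ (head-α _)) (trans (cong ℓ (tail-pd w)) ew)))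

  Tr : Fin d → Set
  Tr x = (x ≡ pd (tail x) × x ≢ outer) ⊎ (αf x ≡ pd (head x) × αf x ≢ outer)

  Tr? : ∀ x → Dec (Tr x)
  Tr? x = ((x FP.≟ pd (tail x)) ×-dec ¬? (x FP.≟ outer)) ⊎-dec ((αf x FP.≟ pd (head x)) ×-dec ¬? (αf x FP.≟ outer))

  Tr-α : ∀ {x} → Tr x → Tr (αf x)
  Tr-α (inj₁ (e , n)) = inj₂ (trans αα (trans e (cong pd (sym (head-α _)))) , (n ∘ trans (sym αα)))
  Tr-α (inj₂ p) = inj₁ p

  Tr-pd : ∀ {v k} → ℓ v ≡ suc k → Tr (pd v)
  Tr-pd e = inj₁ (cong pd (sym (tail-pd _)) , λ o → pd-inner e (subst Outer (sym o) outer-Outer))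

  ¬Tr-outer : ¬ Tr outer
  ¬Tr-outer (inj₁ (_ , n)) = n refl
  ¬Tr-outer (inj₂ (e , _)) = pd≢αpd _ _ (trans (sym e) (cong αf (Outer⇒pd outer-Outer)))

  Outer-nt : ∀ {x} → Outer x → ¬ Tr x → x ≡ outer
  Outer-nt {x} o nt with x FP.≟ outer
  ... | yes e = e
  ... | no ne = ⊥-elim (nt (inj₁ (Outer⇒pd o , ne)))

-- Coboundaries mod 2 and the region cut off by an edge

allᵇ-∈ : ∀ {A : Set} {p : A → Bool} {xs x} → allᵇ p xs ≡ true → x ∈ˡ xs → p x ≡ true
allᵇ-∈ {p = p} {xs = x List.∷ _} e (here refl) with p x
... | true = refl
allᵇ-∈ {p = p} {xs = y List.∷ _} e (there m) with p y
... | true = allᵇ-∈ e m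

does-true : ∀ {P : Set} (p : Dec P) → does p ≡ true → P
does-true (yes p) _ = p

module Homology {n : ℕ} (G : PlaneGraph n) (T : TriangulatedDisk G) (r : ℕ) (lay : AtMostLayers G r) where
  open Disk G T r lay public

  -- For a symmetric `f`, the degree mod 2 of `w` in the edge set `f`, that is, the boundary map of
  -- the cycle space.
  star : Fin n → (Fin d → Bool) → Bool
  star w f = sum (λ x → if does (tail x FP.≟ w) then f x else false)

  star-xor : ∀ w f g → star w (λ x → f x xor g x) ≡ star w f xor star w g
  star-xor w f g = trans (sum-cong-≗ pointwise) (∑-distrib-+ (at f) (at g))
    where
    at : (Fin d → Bool) → Fin d → Bool
    at h x = if does (tail x FP.≟ w) then h x else false
    pointwise : ∀ x → at (λ y → f y xor g y) x ≡ at f x xor at g x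
    pointwise x with does (tail x FP.≟ w)
    ... | true  = refl
    ... | false = refl

  star-cong : ∀ w {f g} → (∀ x → f x ≡ g x) → star w f ≡ star w g
  star-cong w e = sum-cong-≗ (λ x → cong (λ b → if does (tail x FP.≟ w) then b else false) (e x))

  star-single : ∀ w f y → tail y ≡ w → (∀ x → tail x ≡ w → x ≢ y → f x ≡ false) → star w f ≡ f y
  star-single w f y ty z = trans (sum-single _ y others) here-y
    where
    others : ∀ x → x ≢ y → (if does (tail x FP.≟ w) then f x else false) ≡ false
    others x ne with tail x FP.≟ w
    ... | yes t = z x t ne
    ... | no _  = refl
    here-y : (if does (tail y FP.≟ w) then f y else false) ≡ f y
    here-y rewrite dec-true (tail y FP.≟ w) ty = refl

  star-none : ∀ w f → (∀ x → tail x ≡ w → f x ≡ false) → star w f ≡ false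
  star-none w f z = sum-false _ others
    where
    others : ∀ x → (if does (tail x FP.≟ w) then f x else false) ≡ false
    others x with tail x FP.≟ w
    ... | yes t = z x t
    ... | no _  = refl

  Inv : (Fin d → Bool) → Set
  Inv χ = ∀ x → χ (φ x) ≡ χ x

  -- The coboundary: for a set of faces, the edges that have exactly one side in it.
  δ : (Fin d → Bool) → Fin d → Bool
  δ χ x = χ x xor χ (αf x)

  δ-α : ∀ χ x → δ χ (αf x) ≡ δ χ x
  δ-α χ x rewrite αα {x} = xor-comm (χ (αf x)) (χ x)

  Inv-σ : ∀ {χ} → Inv χ → ∀ x → χ (σf x) ≡ χ (αf x)
  Inv-σ {χ} inv x = trans (cong (χ ∘ σf) (sym αα)) (inv (αf x))

  -- Each corner at `w` is counted twice: `χ (αf x)` equals `χ (σf x)`, and `σ` only permutes the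
  -- darts at `w`.
  star-δ : ∀ {χ} → Inv χ → ∀ w → star w (δ χ) ≡ false
  star-δ {χ} inv w = trans (star-xor w χ (χ ∘ αf))
    (≡-xor (trans (sum-permute _ σ) (sum-cong-≗ turn)))
    where
    turn : ∀ x → (if does (tail (σf x) FP.≟ w) then χ (σf x) else false) ≡
                 (if does (tail x FP.≟ w) then χ (αf x) else false)
    turn x rewrite σ-vertex x | Inv-σ inv x = refl

  -- An edge set inside the spanning tree with even degree at w is empty: strip leaves, deepest first.
  module Leaf (f : Fin d → Bool) (fα : ∀ x → f (αf x) ≡ f x) (ft : ∀ x → ¬ Tr x → f x ≡ false) where

    -- A tree edge at `w` other than its parent edge is the parent edge of a vertex one layer
    -- deeper, already known to be absent. `m` bounds the number of deeper layers.
    interior-leaf′ : (∀ w → ℓ w ≢ 0 → star w f ≡ false) → ∀ m w k → r ≤ m + ℓ w → ℓ w ≡ suc k → f (pd w) ≡ false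
    interior-leaf′ ev zero w k le e = ⊥-elim (<⇒≱ (ℓ<r w) le)
    interior-leaf′ ev (suc m) w k le e =
      trans (sym (star-single w f (pd w) (tail-pd w) others)) (ev w (λ z → 0≢1+n (trans (sym z) e)))
      where
      others : ∀ x → tail x ≡ w → x ≢ pd w → f x ≡ false
      others x refl ne with Tr? x
      ... | no nt = ft x nt
      ... | yes (inj₁ (p , _)) = ⊥-elim (ne p)
      ... | yes (inj₂ (p , _)) with ℓ (head x) in eh
      ...   | zero  = ⊥-elim (0≢1+n (trans (sym (Outer-head (subst Outer (sym p) (pd-Outer eh)))) (trans (cong ℓ (head-α x)) e)))
      ...   | suc j = trans (sym (fα x)) (trans (cong f p) (interior-leaf′ ev m (head x) j le′ eh))
        where
        j≡ : j ≡ suc k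
        j≡ = trans (sym (pd-up eh)) (trans (cong (ℓ ∘ head) (sym p)) (trans (cong ℓ (head-α x)) e))
        le′ : r ≤ m + ℓ (head x)
        le′ rewrite eh | j≡ | sym e = ≤-trans le (≤-reflexive (sym (+-suc m _)))

    interior-leaf : (∀ w → ℓ w ≢ 0 → star w f ≡ false) → ∀ {w k} → ℓ w ≡ suc k → f (pd w) ≡ false
    interior-leaf ev {w} {k} e = interior-leaf′ ev r w k (m≤m+n r _) e

    module _ (ev : ∀ w → star w f ≡ false) where
      -- The induction starts at the edge missing from the tree, that of `outer`. At the next vertex
      -- of the outer cycle the preceding edge and the edges to deeper layers are already absent, so
      -- parity excludes the following edge.
      boundary-leaf : ∀ j → f (iter φ j outer) ≡ false
      boundary-leaf zero = ft outer ¬Tr-outer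
      boundary-leaf (suc j) = trans (sym (star-single (tail y) f y refl others)) (ev (tail y))
        where
        y = iter φ (suc j) outer
        oy : Outer y
        oy = suc j , refl
        others : ∀ x → tail x ≡ tail y → x ≢ y → f x ≡ false
        others x t ne with Tr? x
        ... | no nt = ft x nt
        ... | yes (inj₁ (p , _)) = ⊥-elim (ne (trans p (trans (cong pd t) (sym (Outer⇒pd oy)))))
        ... | yes (inj₂ (p , _)) with ℓ (head x) in eh
        ...   | suc _ = trans (sym (fα x)) (trans (cong f p) (interior-leaf (λ w _ → ev w) eh))
        ...   | zero = trans (sym (fα x)) (trans (cong f (φ-inj back)) (boundary-leaf j))
          where
          oα : Outer (αf x)
          oα = subst Outer (sym p) (pd-Outer eh)
          back : φ (αf x) ≡ y
          back = Outer-unique (φ-Outer oα) oy (trans (tail-φ _) (trans (head-α x) t))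

      pd-leaf : ∀ v → f (pd v) ≡ false
      pd-leaf v with ℓ v in e
      ... | suc _ = interior-leaf (λ w _ → ev w) e
      ... | zero = let j , q = pd-Outer e in trans (cong f (sym q)) (boundary-leaf j)

      leaf : ∀ x → f x ≡ false
      leaf x with Tr? x
      ... | no nt = ft x nt
      ... | yes (inj₁ (p , _)) = trans (cong f p) (pd-leaf _)
      ... | yes (inj₂ (p , _)) = trans (sym (fα x)) (trans (cong f p) (pd-leaf _))

  Local : (Fin d → Bool) → Fin d → Set
  Local χ x = χ x ≡ χ (αf x)

  rotate : ∀ {χ} → Inv χ → ∀ {v} → (∀ x → tail x ≡ v → Local χ x) → ∀ {x y} → tail x ≡ v → tail y ≡ v → χ x ≡ χ y
  rotate {χ} inv {v} loc {x} {y} tx ty with σ-cyclic x y (trans tx (sym ty))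
  ... | k , e = trans (go k .proj₂) (cong χ e)
    where
    go : ∀ k → tail (iter σf k x) ≡ v × χ x ≡ χ (iter σf k x)
    go zero = tx , refl
    go (suc k) = let t , c = go k in trans (σ-vertex _) t , trans c (trans (loc _ t) (sym (Inv-σ inv _)))

  -- The coboundary of `χ` lies in the tree and is even at every vertex, so `leaf` makes it empty,
  -- and connectedness spreads the value. Dually: the faces are connected through non-tree edges.
  constant : ∀ {χ} → Inv χ → (∀ x → ¬ Tr x → Local χ x) → ∀ x y → χ x ≡ χ y
  constant {χ} inv loc x y with connected (tail x) (tail y)
  ... | k , w , w₀ , wk , steps = walk k w steps x y (sym w₀) (sym wk)
    where
    local : ∀ x → Local χ x
    local x = xor-≡ (Leaf.leaf (δ χ) (δ-α χ) (λ x nt → ≡-xor (loc x nt)) (star-δ inv) x)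
    same : ∀ {x y} → tail x ≡ tail y → χ x ≡ χ y
    same t = rotate inv (λ z _ → local z) t refl
    walk : ∀ k (w : Vec (Fin n) (suc k)) →
      (∀ (a : Fin k) → Adj (lookup w (F.inject₁ a)) (lookup w (F.suc a))) →
      ∀ x y → tail x ≡ lookup w F.zero → tail y ≡ lookup w (F.fromℕ k) → χ x ≡ χ y
    walk zero w st x y tx ty = same (trans tx (sym ty))
    walk (suc k) (_ Vec.∷ w) st x y tx ty with st F.zero
    ... | z , tz , hz = trans (same (trans tx (sym tz))) (trans (local z)
          (walk k w (λ a → st (F.suc a)) (αf z) y hz ty))

  record Region (e : Fin d) : Set where
    field
      χ   : Fin d → Bool
      inv : Inv χ
      out : χ outer ≡ false
      loc : ∀ x → ¬ Tr x → x ≢ e → x ≢ αf e → Local χ x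
      cut : χ e ≢ χ (αf e)

  outerLen≤d : outerLen ≤ d
  outerLen≤d = FP.injective⇒≤ {f = λ (k : Fin outerLen) → iter φ (toℕ k) outer}
    (λ {j} {k} e → outer-simple j k (cong tail e))

  period : ∀ x → ∃ λ q → 1 ≤ q × q ≤ d × iter φ q x ≡ x
  period x with Outer? x
  ... | no i = 3 , s≤s z≤n , ≤-trans outerLen≥3 outerLen≤d , inner³ i
  ... | yes (j , refl) = outerLen , ≤-trans (s≤s z≤n) outerLen≥3 , outerLen≤d ,
        trans (sym (iter-+ φ outerLen j outer)) (trans (cong (λ k → iter φ k outer) (+-comm outerLen j))
          (trans (iter-+ φ j outerLen outer) (cong (iter φ j) outer-closed)))

  isMin : Fin d → Bool
  isMin x = allᵇ (λ k → toℕ x ≤ᵇ toℕ (iter φ k x)) (upTo d)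

  isMin-≤ : ∀ {x} → isMin x ≡ true → ∀ {k} → k < d → toℕ x ≤ toℕ (iter φ k x)
  isMin-≤ m k<d = ≤ᵇ⇒≤ _ _ (Equivalence.from T-≡ (allᵇ-∈ m (∈-upTo⁺ k<d)))

  -- An orbit of `φ` has one minimal dart, and the links from its other darts to their successors
  -- still form a path through the orbit. Hence `d - numFaces` links make a labelling constant on
  -- all faces.
  Inv-from-nonminimal : ∀ χ → (∀ x → isMin x ≡ false → χ x ≡ χ (φ x)) → Inv χ
  Inv-from-nonminimal χ h x with isMin x in mx | period x
  ... | false | _ = sym (h x mx)
  ... | true | suc q , _ , q≤d , per = trans (sym (go q ≤-refl)) (cong χ per)
    where
    go : ∀ i → i ≤ q → χ (iter φ (suc i) x) ≡ χ (φ x)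
    go zero _ = refl
    go (suc i) i<q with isMin (iter φ (suc i) x) in mi
    ... | false = trans (sym (h _ mi)) (go i (<⇒≤ i<q))
    -- Two minima of the same orbit coincide, so this iterate is `x` again.
    ... | true = cong (χ ∘ φ) (FP.toℕ-injective (≤-antisym
          (≤-trans (isMin-≤ mi {q ∸ i} (≤-trans (s≤s (m∸n≤m q i)) q≤d)) (≤-reflexive (cong toℕ back)))
          (isMin-≤ mx {suc i} (≤-trans (s≤s i<q) q≤d))))
      where
      back : iter φ (q ∸ i) (iter φ (suc i) x) ≡ x
      back = trans (sym (iter-+ φ (q ∸ i) (suc i) x)) (trans (cong (λ k → iter φ k x)
        (trans (+-suc _ i) (cong suc (m∸n+n≡m (<⇒≤ i<q))))) per)

  forward : Fin d → Bool
  forward x = suc (toℕ x) ≤ᵇ toℕ (αf x)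

  forward-< : ∀ {x} → toℕ x < toℕ (αf x) → forward x ≡ true
  forward-< lt = Equivalence.to T-≡ (≤⇒≤ᵇ lt)

  orient : ∀ x → toℕ x < toℕ (αf x) ⊎ toℕ (αf x) < toℕ (αf (αf x))
  orient x with <-cmp (toℕ x) (toℕ (αf x))
  ... | tri< lt _ _ = inj₁ lt
  ... | tri≈ _ e _  = ⊥-elim (α-nofix x (sym (FP.toℕ-injective e)))
  ... | tri> _ _ gt = inj₂ (subst (λ y → toℕ (αf x) < toℕ y) (sym αα) gt)

  abstract
    rep : Fin d → Fin d
    rep x = [ (λ _ → x) , (λ _ → αf x) ]′ (orient x)

    rep-forward : ∀ x → forward (rep x) ≡ true
    rep-forward x with orient x
    ... | inj₁ lt = forward-< lt
    ... | inj₂ lt = forward-< lt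

    rep-≡ : ∀ x → rep x ≡ x ⊎ rep x ≡ αf x
    rep-≡ x with orient x
    ... | inj₁ _ = inj₁ refl
    ... | inj₂ _ = inj₂ refl

    rep-inj : ∀ x y → rep x ≡ rep y → x ≡ y ⊎ x ≡ αf y
    rep-inj x y e with rep-≡ x | rep-≡ y
    ... | inj₁ p | inj₁ q = inj₁ (trans (sym p) (trans e q))
    ... | inj₁ p | inj₂ q = inj₂ (trans (sym p) (trans e q))
    ... | inj₂ p | inj₁ q = inj₂ (trans (sym αα) (cong αf (trans (sym p) (trans e q))))
    ... | inj₂ p | inj₂ q = inj₁ (α-inj (trans (sym p) (trans e q)))

  module MakeRegion (e : Fin d) (nt : ¬ Tr e) where
    Q : Fin d → Set
    Q x = Tr x ⊎ x ≡ e ⊎ x ≡ αf e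
    Q? : ∀ x → Dec (Q x)
    Q? x = Tr? x ⊎-dec ((x FP.≟ e) ⊎-dec (x FP.≟ αf e))
    Q-α : ∀ {x} → Q x → Q (αf x)
    Q-α (inj₁ t) = inj₁ (Tr-α t)
    Q-α (inj₂ (inj₁ p)) = inj₂ (inj₂ (cong αf p))
    Q-α (inj₂ (inj₂ p)) = inj₂ (inj₁ (trans (cong αf p) αα))
    Q-rep : ∀ {x} → Q x → Q (rep x)
    Q-rep {x} q with rep-≡ x
    ... | inj₁ p = subst Q (sym p) q
    ... | inj₂ p = subst Q (sym p) (Q-α q)

    -- Each vertex contributes its parent edge to `Q`, except `tail outer`, whose parent dart
    -- `outer` is not in the tree and is replaced by `e`. These are `n` distinct edges that need no
    -- link.
    choose : ∀ v → Dec (v ≡ tail outer) → Fin d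
    choose v (yes _) = e
    choose v (no _)  = pd v

    pd-Tr : ∀ v → v ≢ tail outer → Tr (pd v)
    pd-Tr v ne = inj₁ (cong pd (sym (tail-pd v)) , λ o → ne (trans (sym (tail-pd v)) (cong tail o)))

    choose-Q : ∀ v p → Q (choose v p)
    choose-Q v (yes _) = inj₂ (inj₁ refl)
    choose-Q v (no ne) = inj₁ (pd-Tr v ne)

    choose-inj : ∀ v w p q → (choose v p ≡ choose w q ⊎ choose v p ≡ αf (choose w q)) → v ≡ w
    choose-inj v w (yes p) (yes q) _ = trans p (sym q)
    choose-inj v w (yes p) (no q) (inj₁ eq) = ⊥-elim (nt (subst Tr (sym eq) (pd-Tr w q)))
    choose-inj v w (yes p) (no q) (inj₂ eq) = ⊥-elim (nt (subst Tr (sym eq) (Tr-α (pd-Tr w q))))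
    choose-inj v w (no p) (yes q) (inj₁ eq) = ⊥-elim (nt (subst Tr eq (pd-Tr v p)))
    choose-inj v w (no p) (yes q) (inj₂ eq) = ⊥-elim (nt (subst Tr αα (Tr-α (subst Tr eq (pd-Tr v p)))))
    choose-inj v w (no p) (no q) (inj₁ eq) = pd-inj eq
    choose-inj v w (no p) (no q) (inj₂ eq) = ⊥-elim (pd≢αpd v w eq)

    q : Fin d → Bool
    q x = does (Q? x)

    edgeOf : Fin n → Fin d
    edgeOf v = choose v (v FP.≟ tail outer)

    n≤ : n ≤ countᵇ (λ x → forward x ∧ q x) (allFin d)
    n≤ = count-≥ (λ x → forward x ∧ q x) (rep ∘ edgeOf)
      (λ {v} {w} eq → choose-inj v w (v FP.≟ tail outer) (w FP.≟ tail outer) (rep-inj (edgeOf v) (edgeOf w) eq))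
      (λ v → trans (cong (_∧ q (rep (edgeOf v))) (rep-forward (edgeOf v)))
               (dec-true (Q? (rep (edgeOf v))) (Q-rep (choose-Q v (v FP.≟ tail outer)))))

    faceLinks edgeLinks : List (Fin d × Fin d)
    faceLinks = List.map (λ x → x , φ x) (select (λ x → not (isMin x)) (allFin d))
    edgeLinks = List.map (λ x → x , αf x) (select (λ x → forward x ∧ not (q x)) (allFin d))

    -- This is where Euler's formula is used.
    few : 2 + length (faceLinks List.++ edgeLinks) ≤ d
    few = +-cancelʳ-≤ (numFaces + c) _ _ (begin
      2 + length (faceLinks List.++ edgeLinks) + (numFaces + c) ≡⟨ cong (λ l → 2 + l + (numFaces + c)) len ⟩
      2 + (a + b) + (numFaces + c)  ≡⟨ cong (2 +_) (rearrange a b numFaces c) ⟩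
      2 + ((numFaces + a) + (c + b)) ≡⟨ cong₂ (λ s t → 2 + (s + t)) (trans (count-not isMin (allFin d)) (length-tabulate id)) (count-split forward q (allFin d)) ⟩
      2 + (d + numEdges)            ≡⟨ cong (_+ numEdges) (+-comm 2 d) ⟩
      d + 2 + numEdges              ≡⟨ +-assoc d 2 numEdges ⟩
      d + (2 + numEdges)            ≡⟨ cong (d +_) (sym euler) ⟩
      d + (n + numFaces)            ≡⟨ cong (d +_) (+-comm n numFaces) ⟩
      d + (numFaces + n)            ≤⟨ +-monoʳ-≤ d (+-monoʳ-≤ numFaces n≤) ⟩
      d + (numFaces + c)            ∎)
      where
      open ≤-Reasoning
      a = countᵇ (λ x → not (isMin x)) (allFin d)
      b = countᵇ (λ x → forward x ∧ not (q x)) (allFin d)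
      c = countᵇ (λ x → forward x ∧ q x) (allFin d)
      len : length (faceLinks List.++ edgeLinks) ≡ a + b
      len = trans (length-++ faceLinks) (cong₂ _+_
        (trans (length-map _ (select (λ x → not (isMin x)) (allFin d))) (length-select _ (allFin d)))
        (trans (length-map _ (select (λ x → forward x ∧ not (q x)) (allFin d))) (length-select _ (allFin d))))
      rearrange : ∀ a b f c → (a + b) + (f + c) ≡ (f + a) + (c + b)
      rearrange a b f c = trans (cong (_+ (f + c)) (+-comm a b)) (trans (+-assoc b a (f + c))
        (trans (+-comm b (a + (f + c))) (trans (cong (_+ b) (trans (sym (+-assoc a f c)) (cong (_+ c) (+-comm a f))))
          (+-assoc (f + a) c b))))

    abstract
      labelling : Σ (Fin d → Bool) λ χ → (∀ z w → z ≡ w → χ z ≡ χ w) ×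
        (∀ {x y} → (x , y) ∈ˡ (faceLinks List.++ edgeLinks) → χ x ≡ χ y) × Σ (Fin d) λ x → Σ (Fin d) λ y → χ x ≢ χ y
      labelling = nonconstant-labelling d id id (λ _ → refl) (faceLinks List.++ edgeLinks) few

    χ₀ : Fin d → Bool
    χ₀ = proj₁ labelling

    faceLink : ∀ x → isMin x ≡ false → (x , φ x) ∈ˡ (faceLinks List.++ edgeLinks)
    faceLink x m = ∈-++⁺ˡ (∈-map⁺ (λ x → x , φ x)
      (∈-select (λ x → not (isMin x)) (∈-allFin x) (cong not m)))

    edgeLink : ∀ x → toℕ x < toℕ (αf x) → ¬ Q x → (x , αf x) ∈ˡ (faceLinks List.++ edgeLinks)
    edgeLink x lt nq = ∈-++⁺ʳ faceLinks (∈-map⁺ (λ x → x , αf x)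
      (∈-select (λ x → forward x ∧ not (q x)) (∈-allFin x)
        (trans (cong (_∧ not (q x)) (forward-< lt)) (cong not (dec-false (Q? x) nq)))))

    inv₀ : Inv χ₀
    inv₀ = Inv-from-nonminimal χ₀ λ x m → proj₁ (proj₂ (proj₂ labelling)) (faceLink x m)

    loc₀ : ∀ x → ¬ Q x → Local χ₀ x
    loc₀ x nq with orient x
    ... | inj₁ lt = proj₁ (proj₂ (proj₂ labelling)) (edgeLink x lt nq)
    ... | inj₂ lt = sym (trans (proj₁ (proj₂ (proj₂ labelling))
        (edgeLink (αf x) lt (λ qa → nq (subst Q αα (Q-α qa))))) (cong χ₀ αα))

    -- If the colours on the two sides of `e` agreed, the labelling would not change across any
    -- non-tree edge and would be constant.
    cut₀ : χ₀ e ≢ χ₀ (αf e)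
    cut₀ eq = let _ , _ , _ , x , y , ne = labelling in ne (constant inv₀ local x y)
      where
      local : ∀ x → ¬ Tr x → Local χ₀ x
      local x ntx with x FP.≟ e | x FP.≟ αf e
      ... | yes refl | _ = eq
      ... | no _ | yes refl = sym (trans (cong χ₀ αα) eq)
      ... | no a | no b = loc₀ x [ ntx , [ a , b ]′ ]′

    region : Region e
    region = record
      { χ   = λ x → χ₀ x xor χ₀ outer
      ; inv = λ x → cong (_xor χ₀ outer) (inv₀ x)
      ; out = xor-same (χ₀ outer)
      ; loc = λ x nt a b → cong (_xor χ₀ outer) (loc₀ x [ nt , [ a , b ]′ ]′)
      ; cut = λ eq → cut₀ (xor-cancelʳ (χ₀ outer) eq)
      }
      where
      xor-cancelʳ : ∀ c {a b} → a xor c ≡ b xor c → a ≡ b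
      xor-cancelʳ false {a} {b} eq = trans (sym (xor-identityʳ a)) (trans eq (xor-identityʳ b))
      xor-cancelʳ true {false} {false} _ = refl
      xor-cancelʳ true {true} {true} _ = refl

  abstract
    region : ∀ e → ¬ Tr e → Region e
    region e nt = MakeRegion.region e nt

-- Laminar regions and the path in the dual tree

bool-other : ∀ {a b : Bool} → a ≢ b → b ≡ false → a ≡ true
bool-other {true}  _ _ = refl
bool-other {false} n e = ⊥-elim (n (sym e))

∧-false : ∀ {a b} → b ≡ false → a ∧ b ≡ false
∧-false {false} _ = refl
∧-false {true}  e = e

bool-cases : ∀ (b : Bool) → b ≡ true ⊎ b ≡ false
bool-cases true  = inj₁ refl
bool-cases false = inj₂ refl

does-⇔ : ∀ {P Q : Set} (p : Dec P) (q : Dec Q) → (P → Q) → (Q → P) → does p ≡ does q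
does-⇔ (yes p) q f g = sym (dec-true q (f p))
does-⇔ (no ¬p) q f g = sym (dec-false q (¬p ∘ g))

module DualTree {n : ℕ} (G : PlaneGraph n) (T : TriangulatedDisk G) (r : ℕ) (lay : AtMostLayers G r) where
  open Homology G T r lay public

  abstract
    -- A tree edge gets the empty region, so that sides of triangles, and later chords, may be tree
    -- edges.
    far′ : ∀ e → Dec (Tr e) → Fin d → Bool
    far′ e (yes _) _ = false
    far′ e (no nt)   = Region.χ (region e nt)

    far : Fin d → Fin d → Bool
    far e = far′ e (Tr? e)

    far-inv : ∀ e → Inv (far e)
    far-inv e with Tr? e
    ... | yes _ = λ _ → refl
    ... | no nt = Region.inv (region e nt)

    far-out : ∀ e → far e outer ≡ false
    far-out e with Tr? e
    ... | yes _ = refl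
    ... | no nt = Region.out (region e nt)

    far-local : ∀ e {x} → ¬ Tr x → x ≢ e → x ≢ αf e → Local (far e) x
    far-local e with Tr? e
    ... | yes _ = λ _ _ _ → refl
    ... | no nt = Region.loc (region e nt) _

    far-cut : ∀ {e} → ¬ Tr e → far e e ≢ far e (αf e)
    far-cut {e} nt with Tr? e
    ... | yes t = ⊥-elim (nt t)
    ... | no nt′ = Region.cut (region e nt′)

    far-tree : ∀ {e} → Tr e → ∀ x → far e x ≡ false
    far-tree {e} t with Tr? e
    ... | yes _ = λ _ → refl
    ... | no nt = ⊥-elim (nt t)

  Inv-Outer : ∀ {χ} → Inv χ → χ outer ≡ false → ∀ {x} → Outer x → χ x ≡ false
  Inv-Outer inv out (zero , refl)  = out
  Inv-Outer inv out (suc j , refl) = trans (inv _) (Inv-Outer inv out (j , refl))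

  far-Outer : ∀ e {x} → Outer x → far e x ≡ false
  far-Outer e = Inv-Outer (far-inv e) (far-out e)

  far-inner : ∀ {e x} → far e x ≡ true → ¬ Outer x
  far-inner f o = t≢f f (far-Outer _ o)

  ¬Tr-α : ∀ {x} → ¬ Tr x → ¬ Tr (αf x)
  ¬Tr-α nt t = nt (subst Tr αα (Tr-α t))

  SameEdge : Fin d → Fin d → Set
  SameEdge e x = x ≡ e ⊎ x ≡ αf e

  SameEdge? : ∀ e x → Dec (SameEdge e x)
  SameEdge? e x = (x FP.≟ e) ⊎-dec (x FP.≟ αf e)

  Same-sym : ∀ {e x} → SameEdge e x → SameEdge x e
  Same-sym (inj₁ p) = inj₁ (sym p)
  Same-sym (inj₂ p) = inj₂ (trans (sym αα) (cong αf (sym p)))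

  Same-α : ∀ {e x} → SameEdge e x → SameEdge e (αf x)
  Same-α (inj₁ p) = inj₂ (cong αf p)
  Same-α (inj₂ p) = inj₁ (trans (cong αf p) αα)

  Same-α⁻ : ∀ {e x} → SameEdge e (αf x) → SameEdge e x
  Same-α⁻ {e} s = subst (SameEdge e) αα (Same-α s)

  Same-Tr : ∀ {e x} → SameEdge e x → Tr x → Tr e
  Same-Tr (inj₁ refl) t = t
  Same-Tr (inj₂ refl) t = subst Tr αα (Tr-α t)

  far-local′ : ∀ e {x} → ¬ Tr x → ¬ SameEdge e x → Local (far e) x
  far-local′ e nt ns = far-local e nt (ns ∘ inj₁) (ns ∘ inj₂)

  -- Each colouring jumps at its own edge, but there the other one vanishes on both sides, so the
  -- intersection jumps at no non-tree edge and `constant` applies. With regions or their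
  -- complements for `p` and `q` this gives all of laminarity.
  meet : ∀ {e g} {p q : Fin d → Bool} → Inv p → Inv q →
    (∀ {x} → ¬ Tr x → ¬ SameEdge e x → Local p x) → (∀ {x} → ¬ Tr x → ¬ SameEdge g x → Local q x) →
    q e ≡ false → q (αf e) ≡ false → p g ≡ false → p (αf g) ≡ false →
    ∀ x → p x ∧ q x ≡ p outer ∧ q outer
  meet {e} {g} {p} {q} ip iq lp lq qe qαe pg pαg x = constant (λ y → cong₂ _∧_ (ip y) (iq y)) local x outer
    where
    local : ∀ x → ¬ Tr x → Local (λ y → p y ∧ q y) x
    local x nt with SameEdge? e x | SameEdge? g x
    ... | no ne | no ng = cong₂ _∧_ (lp nt ne) (lq nt ng)
    ... | yes (inj₁ refl) | _ = trans (∧-false qe) (sym (∧-false qαe))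
    ... | yes (inj₂ refl) | _ = trans (∧-false qαe) (sym (∧-false (trans (cong q αα) qe)))
    ... | no _ | yes (inj₁ refl) = trans (cong (_∧ q x) pg) (cong (_∧ q (αf x)) (sym pαg))
    ... | no _ | yes (inj₂ refl) = trans (cong (_∧ q x) pαg) (cong (_∧ q (αf x)) (sym (trans (cong p αα) pg)))

  infix 4 _⊆ᶠ_
  _⊆ᶠ_ : Fin d → Fin d → Set
  e ⊆ᶠ g = ∀ x → far e x ≡ true → far g x ≡ true

  data Laminar (e g : Fin d) : Set where
    disjoint : (∀ x → far e x ≡ true → far g x ≡ true → ⊥) → far g e ≡ false → Laminar e g
    below    : far g e ≡ true → far e g ≡ false → e ⊆ᶠ g → Laminar e g
    above    : far e g ≡ true → far g e ≡ false → g ⊆ᶠ e → Laminar e g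

  module _ {e g : Fin d} (nte : ¬ Tr e) (ntg : ¬ Tr g) (ns : ¬ SameEdge e g) where
    private
      le : ∀ {x} → ¬ Tr x → ¬ SameEdge e x → Local (far e) x
      le = far-local′ e
      lg : ∀ {x} → ¬ Tr x → ¬ SameEdge g x → Local (far g) x
      lg = far-local′ g
      ge : far g (αf e) ≡ far g e
      ge = sym (lg nte (ns ∘ Same-sym))
      eg : far e (αf g) ≡ far e g
      eg = sym (le ntg ns)

    lam-disjoint : far e g ≡ false → far g e ≡ false → ∀ x → far e x ≡ true → far g x ≡ true → ⊥
    lam-disjoint a b x ex gx = t≢f (cong₂ _∧_ ex gx)
      (trans (meet {e} {g} (far-inv e) (far-inv g) le lg b (trans ge b) a (trans eg a) x)
             (cong (_∧ far g outer) (far-out e)))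

    lam-sub : far g e ≡ true → far e g ≡ false → e ⊆ᶠ g
    lam-sub a b x ex with bool-cases (far g x)
    ... | inj₁ gx = gx
    ... | inj₂ gx = t≢f (cong₂ (λ s t → s ∧ not t) ex gx)
      (trans (meet {e} {g} {far e} {not ∘ far g} (far-inv e) (λ y → cong not (far-inv g y)) le
               (λ nt s → cong not (lg nt s)) (cong not a) (cong not (trans ge a)) b (trans eg b) x)
             (cong (_∧ not (far g outer)) (far-out e)))

    -- Both complements contain the outer face, so by `meet` their intersection would be everything;
    -- but it misses the face of `e`.
    lam-⊥ : far e g ≡ true → far g e ≡ true → ⊥
    lam-⊥ a b = t≢f (cong₂ (λ s t → not s ∧ not t) (far-out e) (far-out g))
      (trans (sym (meet {e} {g} {not ∘ far e} {not ∘ far g} (λ y → cong not (far-inv e y)) (λ y → cong not (far-inv g y))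
               (λ nt s → cong not (le nt s)) (λ nt s → cong not (lg nt s))
               (cong not b) (cong not (trans ge b)) (cong not a) (cong not (trans eg a)) e))
             (∧-false (cong not b)))

  laminar : ∀ {e g} → ¬ Tr e → ¬ Tr g → ¬ SameEdge e g → Laminar e g
  laminar {e} {g} nte ntg ns with bool-cases (far e g) | bool-cases (far g e)
  ... | inj₁ a | inj₁ b = ⊥-elim (lam-⊥ nte ntg ns a b)
  ... | inj₂ a | inj₁ b = below b a (lam-sub nte ntg ns b a)
  ... | inj₁ a | inj₂ b = above a b (lam-sub ntg nte (ns ∘ Same-sym) a b)
  ... | inj₂ a | inj₂ b = disjoint (lam-disjoint nte ntg ns a b) b

  -- Orients a non-tree edge: of its two darts, the one whose face belongs to the region of the
  -- edge.
  record Far (x : Fin d) : Set where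
    constructor mkFar
    field
      nontree : ¬ Tr x
      inside  : far x x ≡ true

  Far-outside : ∀ {x} → Far x → far x (αf x) ≡ false
  Far-outside {x} (mkFar nt i) with bool-cases (far x (αf x))
  ... | inj₁ t = ⊥-elim (far-cut nt (trans i (sym t)))
  ... | inj₂ f = f

  cnt : (Fin d → Bool) → ℕ
  cnt f = countᵇ f (allFin d)

  ¬fix : ∀ {x} → φ x ≢ x
  ¬fix {x} e = loopless x (trans (sym (tail-φ x)) (cong tail e))

  record Child (x y : Fin d) : Set where
    field
      isFar : Far y
      sub   : y ⊆ᶠ x
      out   : far y x ≡ false

  module Triangle {x : Fin d} (F : Far x) where
    open Far F
    i : ¬ Outer x
    i = far-inner inside

    data Side (y : Fin d) : Set where
      second : y ≡ φ x → Side y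
      third  : y ≡ φ (φ x) → Side y

    side-inv : ∀ {χ y} → Inv χ → Side y → χ y ≡ χ x
    side-inv inv (second refl) = inv x
    side-inv inv (third refl)  = trans (inv _) (inv x)

    side-≢ : ∀ {y} → Side y → y ≢ x
    side-≢ (second refl) e = ¬fix e
    side-≢ (third refl)  e = ¬fix (trans (cong φ (sym e)) (inner³ i))

    side-≢α : ∀ {y} → Side y → y ≢ αf x
    side-≢α (second refl) e = loopless (φ (φ x)) (trans (sym (tail-φ _)) (trans (cong tail (inner³ i))
      (trans (sym (head-α x)) (trans (cong head (sym e)) (sym (tail-φ _))))))
    side-≢α (third refl) e = loopless (φ x) (trans (sym (tail-φ _)) (trans (cong tail e) (sym (tail-φ x))))

    -- `far x` does not change across a non-tree side, so both faces at that side are in it. By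
    -- `lam-⊥` the region of the side then excludes the triangle of `x`, and must contain the face
    -- opposite.
    child : ∀ {y} → Side y → ¬ Tr y → Child x (αf y)
    child {y} s nt = record
      { isFar = mkFar nty (bool-other (far-cut nty) (trans (cong (far (αf y)) αα) (trans (side-inv (far-inv _) s) yx)))
      ; sub = lam-sub nty nontree ns xy yx
      ; out = yx }
      where
      nty = ¬Tr-α nt
      ns : ¬ SameEdge (αf y) x
      ns (inj₁ e) = side-≢α s (trans (sym αα) (cong αf (sym e)))
      ns (inj₂ e) = side-≢ s (trans (sym αα) (sym e))
      xy : far x (αf y) ≡ true
      xy = trans (sym (far-local x nt (side-≢ s) (side-≢α s))) (trans (side-inv (far-inv x) s) inside)
      yx : far (αf y) x ≡ false
      yx with bool-cases (far (αf y) x)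
      ... | inj₂ f = f
      ... | inj₁ t = ⊥-elim (lam-⊥ nty nontree ns t xy)

    a b : Fin d
    a = αf (φ x)
    b = αf (φ (φ x))

    InTri : Fin d → Set
    InTri z = z ≡ x ⊎ z ≡ φ x ⊎ z ≡ φ (φ x)

    InTri? : ∀ z → Dec (InTri z)
    InTri? z = (z FP.≟ x) ⊎-dec ((z FP.≟ φ x) ⊎-dec (z FP.≟ φ (φ x)))

    tri : Fin d → Bool
    tri z = does (InTri? z)

    InTri-φ : ∀ {z} → InTri z → InTri (φ z)
    InTri-φ (inj₁ e) = inj₂ (inj₁ (cong φ e))
    InTri-φ (inj₂ (inj₁ e)) = inj₂ (inj₂ (cong φ e))
    InTri-φ (inj₂ (inj₂ e)) = inj₁ (trans (cong φ e) (inner³ i))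

    InTri-φ⁻ : ∀ {z} → InTri (φ z) → InTri z
    InTri-φ⁻ (inj₁ e) = inj₂ (inj₂ (φ-inj (trans e (sym (inner³ i)))))
    InTri-φ⁻ (inj₂ (inj₁ e)) = inj₁ (φ-inj e)
    InTri-φ⁻ (inj₂ (inj₂ e)) = inj₂ (inj₁ (φ-inj e))

    tri-inv : Inv tri
    tri-inv z = does-⇔ (InTri? (φ z)) (InTri? z) InTri-φ⁻ InTri-φ

    -- What remains of `far x` without its triangle and the regions behind the two other sides. It
    -- jumps at no non-tree edge, so it is empty, which is the covering behind `cnt-split`.
    rest : Fin d → Bool
    rest z = not (tri z) ∧ (far x z ∧ (not (far a z) ∧ not (far b z)))

    rest-tri : ∀ {z} → InTri z → rest z ≡ false
    rest-tri {z} t = cong (λ c → not c ∧ (far x z ∧ (not (far a z) ∧ not (far b z)))) (dec-true (InTri? z) t)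

    rest-far : ∀ {z} → far x z ≡ false → rest z ≡ false
    rest-far {z} e = ∧-false {not (tri z)} (cong (_∧ (not (far a z) ∧ not (far b z))) e)

    rest-a : ∀ {z} → far a z ≡ true → rest z ≡ false
    rest-a {z} e = ∧-false {not (tri z)} (∧-false {far x z} (cong (λ c → not c ∧ not (far b z)) e))

    rest-b : ∀ {z} → far b z ≡ true → rest z ≡ false
    rest-b {z} e = ∧-false {not (tri z)} (∧-false {far x z} (∧-false {not (far a z)} (cong not e)))

    rest-α : ∀ {z} → InTri z → ¬ Tr z → rest (αf z) ≡ false
    rest-α (inj₁ refl) nt = rest-far (Far-outside F)
    rest-α (inj₂ (inj₁ refl)) nt = rest-a (Far.inside (Child.isFar (child (second refl) nt)))
    rest-α (inj₂ (inj₂ refl)) nt = rest-b (Far.inside (Child.isFar (child (third refl) nt)))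

    rest-local : ∀ z → ¬ Tr z → Local rest z
    rest-local z nt with InTri? z | InTri? (αf z)
    ... | yes t | _ = trans (rest-tri t) (sym (rest-α t nt))
    ... | no _ | yes t = trans (trans (cong rest (sym αα)) (rest-α t (¬Tr-α nt))) (sym (rest-tri t))
    ... | no t | no tα = cong₂ _∧_ (cong not (trans (dec-false (InTri? z) t) (sym (dec-false (InTri? (αf z)) tα))))
        (cong₂ _∧_ (far-local x nt (t ∘ inj₁) (λ e → tα (inj₁ (trans (cong αf e) αα))))
        (cong₂ _∧_ (cong not (far-local a nt (λ e → tα (inj₂ (inj₁ (trans (cong αf e) αα))))
                                             (λ e → t (inj₂ (inj₁ (trans e αα))))))
                   (cong not (far-local b nt (λ e → tα (inj₂ (inj₂ (trans (cong αf e) αα))))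
                                             (λ e → t (inj₂ (inj₂ (trans e αα))))))))

    rest-none : ∀ z → rest z ≡ false
    rest-none z = trans (constant rest-inv rest-local z outer) (rest-far (far-out x))
      where
      rest-inv : Inv rest
      rest-inv z rewrite tri-inv z | far-inv x z | far-inv a z | far-inv b z = refl

    cnt-split : cnt (far x) ≤ 3 + (cnt (far a) + cnt (far b))
    cnt-split = ≤-trans (count-∪ (far x) tri (λ z → far a z ∨ far b z) (allFin d) cover)
      (+-mono-≤ tri≤3 (count-∪ (λ z → far a z ∨ far b z) (far a) (far b) (allFin d) or))
      where
      or : ∀ z → far a z ∨ far b z ≡ true → far a z ≡ true ⊎ far b z ≡ true
      or z e with far a z
      ... | true  = inj₁ refl
      ... | false = inj₂ e
      cover : ∀ z → far x z ≡ true → tri z ≡ true ⊎ far a z ∨ far b z ≡ true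
      cover z e with tri z | far a z | far b z | rest-none z
      ... | true  | _     | _     | _ = inj₁ refl
      ... | false | true  | _     | _ = inj₂ refl
      ... | false | false | true  | _ = inj₂ refl
      ... | false | false | false | q rewrite e = ⊥-elim (t≢f refl q)
      one : Fin d → Fin d → Bool
      one c z = does (z FP.≟ c)
      tri≤3 : cnt tri ≤ 3
      tri≤3 = ≤-trans (count-∪ tri (one x) (λ z → one (φ x) z ∨ one (φ (φ x)) z) (allFin d) c₁)
        (+-mono-≤ (count-single x) (≤-trans (count-∪ _ (one (φ x)) (one (φ (φ x))) (allFin d) c₂)
          (+-mono-≤ (count-single (φ x)) (count-single (φ (φ x))))))
        where
        c₁ : ∀ z → tri z ≡ true → one x z ≡ true ⊎ one (φ x) z ∨ one (φ (φ x)) z ≡ true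
        c₁ z e with one x z
        ... | true  = inj₁ refl
        ... | false = inj₂ e
        c₂ : ∀ z → one (φ x) z ∨ one (φ (φ x)) z ≡ true → one (φ x) z ≡ true ⊎ one (φ (φ x)) z ≡ true
        c₂ z e with one (φ x) z
        ... | true  = inj₁ refl
        ... | false = inj₂ e

  -- From `c ≤ 3 + (p + q)` and `q ≤ p` follows `c + 3 ≤ 2 * (p + 3)`, so with 3 added the size
  -- loses at most a factor 2 per step. From level 1 on the region is nonempty and its edge is not
  -- in the tree.
  record Heavy (m : ℕ) (x : Fin d) : Set where
    field
      isFar : Far x
      heavy : 3 * 2 ^ m ≤ cnt (far x) + 3

  Step : Fin d → Fin d → Set
  Step x y = y ≡ αf (φ x) ⊎ y ≡ αf (φ (φ x))

  heavy-nontree : ∀ m y → 3 * 2 ^ suc m ≤ cnt (far y) + 3 → ¬ Tr y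
  heavy-nontree m y h t = <⇒≱ (s≤s (≤-refl {3})) (≤-trans (≤-trans four≤ h)
      (≤-reflexive (cong (_+ 3) (count-none (far y) (allFin d) (far-tree t)))))
    where
    four≤ : 4 ≤ 3 * 2 ^ suc m
    four≤ = ≤-trans (s≤s (s≤s (s≤s (s≤s z≤n)))) (*-monoʳ-≤ 3 (*-monoʳ-≤ 2 (m^n>0 2 m)))

  half : ∀ {c p q} m → 3 * 2 ^ suc m ≤ c + 3 → c ≤ 3 + (p + q) → q ≤ p → 3 * 2 ^ m ≤ p + 3
  half {c} {p} {q} m h c≤ q≤p = *-cancelˡ-≤ 2 (begin
    2 * (3 * 2 ^ m)   ≡⟨ trans (sym (*-assoc 2 3 (2 ^ m))) (*-assoc 3 2 (2 ^ m)) ⟩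
    3 * 2 ^ suc m     ≤⟨ h ⟩
    c + 3             ≤⟨ +-monoˡ-≤ 3 (≤-trans c≤ (+-monoʳ-≤ 3 (+-monoʳ-≤ p q≤p))) ⟩
    3 + (p + p) + 3   ≡⟨ +-comm (3 + (p + p)) 3 ⟩
    6 + (p + p)       ≡⟨ cong (6 +_) (cong (p +_) (sym (+-identityʳ p))) ⟩
    6 + 2 * p         ≡⟨ +-comm 6 (2 * p) ⟩
    2 * p + 2 * 3     ≡⟨ sym (*-distribˡ-+ 2 p 3) ⟩
    2 * (p + 3)       ∎)
    where open ≤-Reasoning

  descend : ∀ m {x} → Heavy (suc (suc m)) x → Σ (Fin d) λ y → Step x y × Heavy (suc m) y
  descend m {x} hx with ≤-total (cnt (far (αf (φ (φ x))))) (cnt (far (αf (φ x))))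
  ... | inj₁ b≤a = _ , inj₁ refl , record { isFar = Child.isFar (child (second refl) nt) ; heavy = h }
    where
    open Heavy hx
    open Triangle isFar
    h : 3 * 2 ^ suc m ≤ cnt (far (αf (φ x))) + 3
    h = half (suc m) heavy cnt-split b≤a
    nt : ¬ Tr (φ x)
    nt t = heavy-nontree m _ h (Tr-α t)
  ... | inj₂ a≤b = _ , inj₂ refl , record { isFar = Child.isFar (child (third refl) nt) ; heavy = h }
    where
    open Heavy hx
    open Triangle isFar
    h : 3 * 2 ^ suc m ≤ cnt (far (αf (φ (φ x)))) + 3
    h = half (suc m) heavy (≤-trans cnt-split (≤-reflexive (cong (3 +_) (+-comm (cnt (far a)) _)))) a≤b
    nt : ¬ Tr (φ (φ x))
    nt t = heavy-nontree m _ h (Tr-α t)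

  x₀ : Fin d
  x₀ = αf outer

  ¬Tr-x₀ : ¬ Tr x₀
  ¬Tr-x₀ = ¬Tr-α ¬Tr-outer

  Far-x₀ : Far x₀
  Far-x₀ = mkFar ¬Tr-x₀ (bool-other (far-cut ¬Tr-x₀) (trans (cong (far x₀) αα) (far-out x₀)))

  -- The indicator of the inner faces jumps at the edge of `outer` and at no other non-tree edge,
  -- since the remaining outer darts are in the tree. Its sum with `far x₀` is therefore constant.
  far-x₀ : ∀ {x} → ¬ Outer x → far x₀ x ≡ true
  far-x₀ {x} i = sym (xor-≡ (trans (sym (xor-not (far x₀ x) x i)) (trans (constant inv local x outer) at-outer)))
    where
    io : Fin d → Bool
    io z = does (Outer? z)
    f : Fin d → Bool
    f z = not (io z) xor far x₀ z
    xor-not : ∀ c x → ¬ Outer x → not (io x) xor c ≡ true xor c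
    xor-not c x i = cong (λ b → not b xor c) (dec-false (Outer? x) i)
    io-inv : Inv io
    io-inv z with Outer? z
    ... | yes o = dec-true (Outer? (φ z)) (φ-Outer o)
    ... | no o = dec-false (Outer? (φ z)) (inner-φ o)
    inv : Inv f
    inv z = cong₂ (λ p q → not p xor q) (io-inv z) (far-inv x₀ z)
    at-outer : f outer ≡ false
    at-outer = cong₂ (λ p q → not p xor q) (dec-true (Outer? outer) outer-Outer) (far-out x₀)
    f-out : f x₀ ≡ false
    f-out = cong₂ (λ p q → not p xor q) (dec-false (Outer? x₀) (Outer-α outer-Outer)) (Far.inside Far-x₀)
    local : ∀ z → ¬ Tr z → Local f z
    local z nt with z FP.≟ outer | z FP.≟ x₀
    ... | yes refl | _ = trans at-outer (sym f-out)
    ... | no _ | yes refl = trans f-out (sym (trans (cong f αα) at-outer))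
    ... | no a | no b = cong₂ (λ p q → not p xor q)
        (trans (dec-false (Outer? z) (λ o → a (Outer-nt o nt)))
          (sym (dec-false (Outer? (αf z)) (λ o → b (trans (sym αα) (cong αf (Outer-nt o (¬Tr-α nt))))))))
        (far-local x₀ nt b (λ e → a (trans e αα)))

  -- One inner dart at each vertex gives `n` distinct darts of `far x₀`.
  heavy-x₀ : ∀ m → 3 * 2 ^ m ≤ n + 3 → Heavy m x₀
  heavy-x₀ m le = record { isFar = Far-x₀ ; heavy = ≤-trans le (+-monoˡ-≤ 3
    (count-≥ (far x₀) (λ v → proj₁ (inner-dart v))
      (λ {v} {w} e → trans (sym (proj₁ (proj₂ (inner-dart v)))) (trans (cong tail e) (proj₁ (proj₂ (inner-dart w)))))
      (λ v → far-x₀ (proj₂ (proj₂ (inner-dart v)))))) }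

  record DualPath (D : ℕ) : Set where
    field
      X     : ℕ → Fin d
      start : X 0 ≡ x₀
      isFar : ∀ {k} → k ≤ D → Far (X k)
      step  : ∀ {k} → k < D → Step (X k) (X (suc k))

  heavy-path : ∀ D x → Heavy (suc D) x → Σ (ℕ → Fin d) λ X → X 0 ≡ x ×
    (∀ {k} → k ≤ D → Far (X k)) × (∀ {k} → k < D → Step (X k) (X (suc k)))
  heavy-path zero x h = (λ _ → x) , refl , (λ _ → Heavy.isFar h) , λ ()
  heavy-path (suc D) x h =
    let y , s , hy = descend D h
        Y , y0 , fars , steps = heavy-path D y hy
    in (λ { zero → x ; (suc k) → Y k }) , refl ,
       (λ { {zero} _ → Heavy.isFar h ; {suc k} (s≤s le) → fars le }) ,
       (λ { {zero} _ → subst (Step x) (sym y0) s ; {suc k} (s≤s lt) → steps lt })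

  dualPath : ∀ D → 3 * 2 ^ suc D ≤ n + 3 → DualPath D
  dualPath D le = let X , z , f , s = heavy-path D x₀ (heavy-x₀ (suc D) le)
    in record { X = X ; start = z ; isFar = f ; step = s }

  module AlongPath {D : ℕ} (path : DualPath D) where
    open DualPath path public

    far-nontree : ∀ {k} → k ≤ D → ¬ Tr (X k)
    far-nontree le = Far.nontree (isFar le)

    inside : ∀ {k} → k ≤ D → far (X k) (X k) ≡ true
    inside le = Far.inside (isFar le)

    step-child : ∀ {k} → k < D → Child (X k) (X (suc k))
    step-child {k} lt with step lt | isFar lt
    ... | inj₁ e | f = subst (Child (X k)) (sym e)
          (Triangle.child F (Triangle.second refl) (λ t → Far.nontree f (subst Tr (sym e) (Tr-α t))))
          where F = isFar (<⇒≤ lt)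
    ... | inj₂ e | f = subst (Child (X k)) (sym e)
          (Triangle.child F (Triangle.third refl) (λ t → Far.nontree f (subst Tr (sym e) (Tr-α t))))
          where F = isFar (<⇒≤ lt)

    nested′ : ∀ {i j} → i ≤′ j → j ≤ D → X j ⊆ᶠ X i
    nested′ ≤′-refl      le x f = f
    nested′ (≤′-step ij) le x f = nested′ ij (<⇒≤ le) x (Child.sub (step-child le) x f)

    nested : ∀ {i j} → i ≤ j → j ≤ D → X j ⊆ᶠ X i
    nested ij = nested′ (≤⇒≤′ ij)

    outside : ∀ {i j} → i < j → j ≤ D → far (X j) (X i) ≡ false
    outside {i} {j} ij le with bool-cases (far (X j) (X i))
    ... | inj₂ f = f
    ... | inj₁ t = t≢f (nested ij le (X i) t) (Child.out (step-child (≤-trans ij le)))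

    step-near : ∀ {k} → k < D → ∀ {χ} → Inv χ → χ (αf (X (suc k))) ≡ χ (X k)
    step-near lt {χ} inv with step lt
    ... | inj₁ e = trans (cong (χ ∘ αf) e) (trans (cong χ αα) (inv _))
    ... | inj₂ e = trans (cong (χ ∘ αf) e) (trans (cong χ αα) (trans (inv _) (inv _)))

    -- Compares `g` with `X (suc j)`. Either the region of `g` lies inside that of `X (suc j)` and
    -- the search goes on there, or it contains more and then also the triangle of `X j`; in that
    -- case `lam-⊥` leaves only the edge of `X j`.
    on-path′ : ∀ m {j} → ∀ {g} → ¬ Tr g → m + j ≤ D → g ⊆ᶠ X j → X (m + j) ⊆ᶠ g →
      ∃ λ i → j ≤ i × i ≤ m + j × SameEdge (X i) g
    on-path′ zero {j} {g} nt le gj jg with SameEdge? (X j) g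
    ... | yes s = j , ≤-refl , ≤-refl , s
    ... | no ns = ⊥-elim (far-cut (far-nontree le) (trans (same _) (trans (far-local′ g (far-nontree le) (ns ∘ Same-sym)) (sym (same _)))))
      where
      same : ∀ x → far (X j) x ≡ far g x
      same x with bool-cases (far (X j) x) | bool-cases (far g x)
      ... | inj₁ a | inj₁ b = trans a (sym b)
      ... | inj₂ a | inj₂ b = trans a (sym b)
      ... | inj₁ a | inj₂ b = t≢f (jg x a) b
      ... | inj₂ a | inj₁ b = t≢f (gj x b) a
    on-path′ (suc m) {j} {g} nt le gj jg with SameEdge? (X j) g
    ... | yes s = j , ≤-refl , ≤-trans (n≤1+n j) (s≤s (m≤n+m j m)) , s
    ... | no ns with SameEdge? (X (suc j)) g
    ...   | yes s = suc j , n≤1+n j , s≤s (m≤n+m j m) , s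
    ...   | no ns′ = next (laminar (far-nontree 1+j≤D) nt ns′)
      where
      j<D : j < D
      j<D = ≤-trans (s≤s (m≤n+m j m)) le
      1+j≤D : suc j ≤ D
      1+j≤D = j<D
      shift : suc m + j ≡ m + suc j
      shift = sym (+-suc m j)
      inner : far (X (suc j)) (X (suc m + j)) ≡ true
      inner = nested (s≤s (m≤n+m j m)) le _ (inside le)
      next : Laminar (X (suc j)) g → _
      next (disjoint dis _) = ⊥-elim (dis _ inner (jg _ (inside le)))
      next (above _ _ sub) =
        let i , a , b , s = on-path′ m nt (subst (_≤ D) shift le) sub (subst (λ k → X k ⊆ᶠ g) shift jg)
        in i , ≤-trans (n≤1+n j) a , ≤-trans b (≤-reflexive (sym shift)) , s
      next (below t _ _) = ⊥-elim (lam-⊥ (far-nontree (<⇒≤ j<D)) nt ns xg gx)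
        where
        gx : far g (X j) ≡ true
        gx = trans (sym (step-near j<D (far-inv g)))
               (trans (sym (far-local′ g (far-nontree 1+j≤D) (ns′ ∘ Same-sym))) t)
        loc : far (X j) g ≡ far (X j) (αf g)
        loc = far-local′ (X j) nt ns
        xg : far (X j) g ≡ true
        xg with bool-cases (far g g)
        ... | inj₁ a = gj g a
        ... | inj₂ b = trans loc (gj (αf g) (bool-other (far-cut nt ∘ sym) b))

    on-path : ∀ {j k g} → j ≤ k → k ≤ D → ¬ Tr g → g ⊆ᶠ X j → X k ⊆ᶠ g →
      ∃ λ i → j ≤ i × i ≤ k × SameEdge (X i) g
    on-path {j} {k} {g} jk kD nt gj jg =
      let i , a , b , s = on-path′ (k ∸ j) nt (subst (_≤ D) (sym e) kD) gj (subst (λ l → X l ⊆ᶠ g) (sym e) jg)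
      in i , a , subst (i ≤_) e b , s
      where
      e : k ∸ j + j ≡ k
      e = m∸n+n≡m jk

-- Tree paths, boundaries of regions and sides of the path

xor-cancelˡ : ∀ a b → a xor (a xor b) ≡ b
xor-cancelˡ a b = trans (sym (BP.xor-assoc a a b)) (cong (_xor b) (xor-same a))

xor-path : ∀ a b c → (a xor b) xor (b xor c) ≡ a xor c
xor-path a b c = trans (BP.xor-assoc a b (b xor c)) (cong (a xor_) (xor-cancelˡ b c))

xor-ends : ∀ a b c d → (a xor b) xor ((a xor c) xor (b xor d)) ≡ c xor d
xor-ends a b c d = trans (cong ((a xor b) xor_) (xor-interchange a c b d)) (xor-cancelˡ (a xor b) (c xor d))

xor-true : ∀ a {b} → a xor b ≡ true → a ≡ true ⊎ b ≡ true
xor-true true  _ = inj₁ refl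
xor-true false e = inj₂ e

∸-split : ∀ {a b i} → i ≤ b → b ≤ a → (b ∸ i) + (a ∸ b) ≡ a ∸ i
∸-split {a} {b} {i} ib ba = trans (sym (+-∸-comm (a ∸ b) ib)) (cong (_∸ i) (m+[n∸m]≡n ba))

module Ancestry {n : ℕ} (G : PlaneGraph n) (T : TriangulatedDisk G) (r : ℕ) (lay : AtMostLayers G r) where
  open DualTree G T r lay public

  ℓ-up : ∀ m v → m ≤ ℓ v → ℓ (iter par m v) ≡ ℓ v ∸ m
  ℓ-up zero    v le = refl
  ℓ-up (suc m) v le = pd-up (trans (ℓ-up m v (<⇒≤ le)) (+-∸-assoc 1 le))

  -- The ancestor of `v` in layer `i` when `i ≤ ℓ v`. At most `ℓ v` parent steps are taken, so it
  -- never moves along the outer cycle.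
  at : Fin n → ℕ → Fin n
  at v i = iter par (ℓ v ∸ i) v

  ℓ-at : ∀ {v i} → i ≤ ℓ v → ℓ (at v i) ≡ i
  ℓ-at {v} {i} le = trans (ℓ-up (ℓ v ∸ i) v (m∸n≤m (ℓ v) i)) (m∸[m∸n]≡n le)

  at-top : ∀ v → at v (ℓ v) ≡ v
  at-top v = cong (λ m → iter par m v) (n∸n≡0 (ℓ v))

  at-par : ∀ {v i} → i < ℓ v → at v i ≡ par (at v (suc i))
  at-par {v} {i} lt = cong (λ m → iter par m v) (+-∸-assoc 1 lt)

  infix 4 _≼_
  record _≼_ (v w : Fin n) : Set where
    constructor anc
    field
      ℓ≤ : ℓ v ≤ ℓ w
      eq : at w (ℓ v) ≡ v
  open _≼_ public

  at-≼ : ∀ {v i} → i ≤ ℓ v → at v i ≼ v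
  at-≼ {v} {i} le = anc (≤-trans (≤-reflexive (ℓ-at le)) le) (cong (at v) (ℓ-at le))

  ≼-refl : ∀ {v} → v ≼ v
  ≼-refl {v} = anc ≤-refl (at-top v)

  at-at : ∀ {v w i} → v ≼ w → i ≤ ℓ v → at v i ≡ at w i
  at-at {v} {w} {i} (anc le e) il = trans (cong (iter par (ℓ v ∸ i)) (sym e))
    (trans (sym (iter-+ par (ℓ v ∸ i) (ℓ w ∸ ℓ v) w)) (cong (λ m → iter par m w) (∸-split il le)))

  ≼-trans : ∀ {u v w} → u ≼ v → v ≼ w → u ≼ w
  ≼-trans uv vw = anc (≤-trans (ℓ≤ uv) (ℓ≤ vw)) (trans (sym (at-at vw (ℓ≤ uv))) (eq uv))

  ≼-below : ∀ {u v w} → u ≼ w → v ≼ w → ℓ u ≤ ℓ v → u ≼ v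
  ≼-below uw vw le = anc le (trans (at-at vw le) (eq uw))

  ≼-same : ∀ {u v} → u ≼ v → ℓ u ≡ ℓ v → u ≡ v
  ≼-same {u} {v} uv e = trans (sym (eq uv)) (trans (cong (at v) e) (at-top v))

  par-≼ : ∀ {v k} → ℓ v ≡ suc k → par v ≼ v
  par-≼ {v} {k} e = anc (≤-trans (≤-reflexive (pd-up e)) (≤-trans (n≤1+n k) (≤-reflexive (sym e))))
    (cong (λ m → iter par m v) (trans (cong₂ _∸_ e (pd-up e)) (m+n∸n≡m 1 k)))

  ≼-par : ∀ {v w} → v ≼ w → ℓ v < ℓ w → v ≼ par w
  ≼-par {v} {w} vw lt with ℓ w in e
  ... | suc k = ≼-below vw (par-≼ e) (≤-trans (s≤s⁻¹ lt) (≤-reflexive (sym (pd-up e))))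

  at-ℓ-≡ : ∀ {x y a b i j} → i ≤ ℓ x → j ≤ ℓ y → a ≡ at x i → b ≡ at y j → a ≡ b → i ≡ j
  at-ℓ-≡ ix jy ea eb e = trans (sym (ℓ-at ix)) (trans (cong ℓ (trans (sym ea) (trans e eb))) (ℓ-at jy))

  0<⇒suc : ∀ {m k} → m < k → ∃ λ j → k ≡ suc j
  0<⇒suc (s≤s _) = _ , refl

  ind : Fin d → Fin d → Bool
  ind e x = does (SameEdge? e x)

  ind-α : ∀ e x → ind e (αf x) ≡ ind e x
  ind-α e x = does-⇔ (SameEdge? e (αf x)) (SameEdge? e x) Same-α⁻ Same-α

  ind-true : ∀ {e x} → SameEdge e x → ind e x ≡ true
  ind-true {e} {x} = dec-true (SameEdge? e x)

  ind-false : ∀ {e x} → ¬ SameEdge e x → ind e x ≡ false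
  ind-false {e} {x} = dec-false (SameEdge? e x)

  ind-same : ∀ {e x} → ind e x ≡ true → SameEdge e x
  ind-same {e} {x} = does-true (SameEdge? e x)

  is : Fin n → Fin n → Bool
  is v w = does (v FP.≟ w)

  star-point : ∀ w e → star w (λ x → does (x FP.≟ e)) ≡ is (tail e) w
  star-point w e with tail e FP.≟ w
  ... | yes t = trans (star-single w _ e t (λ x _ ne → dec-false (x FP.≟ e) ne)) (dec-true (e FP.≟ e) refl)
  ... | no nt = star-none w _ (λ x tx → dec-false (x FP.≟ e) (λ x≡e → nt (trans (cong tail (sym x≡e)) tx)))

  star-ind : ∀ w e → star w (ind e) ≡ is (tail e) w xor is (head e) w
  star-ind w e = trans (star-cong w pointwise) (trans (star-xor w (λ x → does (x FP.≟ e)) (λ x → does (x FP.≟ αf e)))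
      (cong₂ _xor_ (star-point w e) (star-point w (αf e))))
    where
    pointwise : ∀ x → ind e x ≡ does (x FP.≟ e) xor does (x FP.≟ αf e)
    pointwise x with x FP.≟ e
    ... | yes refl rewrite dec-false (x FP.≟ αf x) (λ q → α-nofix x (sym q)) = refl
    ... | no _ with x FP.≟ αf e
    ...   | yes _ = refl
    ...   | no _  = refl

  -- The first `m` parent edges from `v` as a chain mod 2; `star-ch` computes its boundary.
  ch : ℕ → Fin n → Fin d → Bool
  ch zero    v x = false
  ch (suc m) v x = ind (pd v) x xor ch m (par v) x

  ch-α : ∀ m v x → ch m v (αf x) ≡ ch m v x
  ch-α zero    v x = refl
  ch-α (suc m) v x = cong₂ _xor_ (ind-α (pd v) x) (ch-α m (par v) x)

  star-ch : ∀ w m v → star w (ch m v) ≡ is v w xor is (iter par m v) w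
  star-ch w zero v = trans (star-none w _ (λ _ _ → refl)) (sym (xor-same (is v w)))
  star-ch w (suc m) v = trans (star-xor w (ind (pd v)) (ch m (par v)))
    (trans (cong₂ _xor_ (trans (star-ind w (pd v)) (cong (λ u → is u w xor is (par v) w) (tail-pd v)))
                        (trans (star-ch w m (par v)) (cong (λ u → is (par v) w xor is u w) (iter-shift par m v))))
           (xor-path (is v w) (is (par v) w) (is (iter par (suc m) v) w)))

  pd-same : ∀ {v w} → SameEdge (pd v) (pd w) → w ≡ v
  pd-same (inj₁ e) = pd-inj e
  pd-same (inj₂ e) = ⊥-elim (pd≢αpd _ _ e)

  ch-true : ∀ m {v x} → m ≤ ℓ v → ch m v x ≡ true → ∃ λ w → SameEdge (pd w) x × w ≼ v × ℓ v < ℓ w + m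
  ch-true (suc m) {v} {x} le e with 0<⇒suc le | xor-true (ind (pd v) x) e
  ... | k , vk | inj₁ t = v , ind-same t , ≼-refl , m<m+n (ℓ v) (s≤s z≤n)
  ... | k , vk | inj₂ t with ch-true m (s≤s⁻¹ (≤-trans le (≤-reflexive (trans vk (cong suc (sym (pd-up vk))))))) t
  ...   | w , s , wv , lt = w , s , ≼-trans wv (par-≼ vk) ,
          subst₂ _<_ (trans (cong suc (pd-up vk)) (sym vk)) (sym (+-suc (ℓ w) m)) (s≤s lt)

  ch-pd : ∀ m {v w} → m ≤ ℓ v → w ≼ v → ℓ v < ℓ w + m → ch m v (pd w) ≡ true
  ch-pd zero {v} {w} le wv lt = ⊥-elim (<⇒≱ lt (≤-trans (≤-reflexive (+-identityʳ (ℓ w))) (ℓ≤ wv)))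
  ch-pd (suc m) {v} {w} le wv lt with 0<⇒suc le | w FP.≟ v
  ... | k , vk | yes refl = cong₂ _xor_ (ind-true {pd v} (inj₁ refl)) rest
    where
    rest : ch m (par v) (pd v) ≡ false
    rest with bool-cases (ch m (par v) (pd v))
    ... | inj₂ f = f
    ... | inj₁ t with ch-true m (s≤s⁻¹ (≤-trans le (≤-reflexive (trans vk (cong suc (sym (pd-up vk))))))) t
    ...   | w , s , wv , _ = ⊥-elim (1+n≰n {k} (subst₂ _≤_ (trans (cong ℓ (sym (pd-same s))) vk) (pd-up vk) (ℓ≤ wv)))
  ... | k , vk | no ne = cong₂ _xor_ (ind-false {pd v} (ne ∘ pd-same))
      (ch-pd m (s≤s⁻¹ (≤-trans le (≤-reflexive (trans vk (cong suc (sym (pd-up vk)))))))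
        (≼-par wv (≤∧≢⇒< (ℓ≤ wv) (ne ∘ ≼-same wv)))
        (s≤s⁻¹ (subst₂ _<_ (trans vk (cong suc (sym (pd-up vk)))) (+-suc (ℓ w) m) lt)))

  ch-pos : ∀ {v w m} → m ≤ ℓ v → ℓ v < ℓ w + m → ∃ λ k → ℓ w ≡ suc k
  ch-pos {v} {w} le lt with ℓ w
  ... | suc k = k , refl
  ... | zero = ⊥-elim (<⇒≱ lt le)

  ch-nontree : ∀ m {v x} → m ≤ ℓ v → ¬ Tr x → ch m v x ≡ false
  ch-nontree m {v} {x} le nt with bool-cases (ch m v x)
  ... | inj₂ f = f
  ... | inj₁ t with ch-true m le t
  ...   | w , s , wv , lt = ⊥-elim (nt (Same-Tr (Same-sym s) (Tr-pd (proj₂ (ch-pos {w = w} le lt)))))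

  -- The difference of `C` and the coboundary of `U` lies in the tree and has the same degree
  -- parities as `C`, so leaf stripping removes it where `C` is even.
  module Boundary {U C : Fin d → Bool} (inv : Inv U) (Cα : ∀ x → C (αf x) ≡ C x)
                  (agree : ∀ x → ¬ Tr x → δ U x ≡ C x) where
    private
      f : Fin d → Bool
      f x = δ U x xor C x
      star-f : ∀ w → star w f ≡ star w C
      star-f w = trans (star-xor w (δ U) C) (cong (_xor star w C) (star-δ inv w))
      module L = Leaf f (λ x → cong₂ _xor_ (δ-α U x) (Cα x)) (λ x nt → ≡-xor (agree x nt))

    δ-interior : (∀ w → ℓ w ≢ 0 → star w C ≡ false) → ∀ {w k} → ℓ w ≡ suc k → δ U (pd w) ≡ C (pd w)
    δ-interior even e = xor-≡ (L.interior-leaf (λ w nz → trans (star-f w) (even w nz)) e)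

    δ-closed : (∀ w → star w C ≡ false) → ∀ x → δ U x ≡ C x
    δ-closed even x = xor-≡ (L.leaf (λ w → trans (star-f w) (even w)) x)

  far-δ : ∀ {e x} → ¬ Tr e → ¬ Tr x → δ (far e) x ≡ ind e x
  far-δ {e} {x} nte ntx with SameEdge? e x
  ... | yes (inj₁ refl) = trans (≢-xor (far-cut nte)) (sym (ind-true {e} {e} (inj₁ refl)))
  ... | yes (inj₂ refl) = trans (trans (δ-α (far e) e) (≢-xor (far-cut nte))) (sym (ind-true {e} {αf e} (inj₂ refl)))
  ... | no ns = trans (≡-xor (far-local′ e ntx ns)) (sym (ind-false ns))

  module _ {e : Fin d} (nte : ¬ Tr e) where
    -- The two tree paths from the ends of e, cut off after the given numbers of steps, closed up by e.
    fund : ℕ → ℕ → Fin d → Bool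
    fund a b x = ind e x xor (ch a (tail e) x xor ch b (head e) x)

    fund-α : ∀ a b x → fund a b (αf x) ≡ fund a b x
    fund-α a b x = cong₂ _xor_ (ind-α e x) (cong₂ _xor_ (ch-α a _ x) (ch-α b _ x))

    fund-agree : ∀ a b → a ≤ ℓ (tail e) → b ≤ ℓ (head e) → ∀ x → ¬ Tr x → δ (far e) x ≡ fund a b x
    fund-agree a b la lb x ntx = trans (far-δ nte ntx) (sym (trans
      (cong (ind e x xor_) (cong₂ _xor_ (ch-nontree a la ntx) (ch-nontree b lb ntx))) (xor-identityʳ _)))

    star-fund : ∀ a b w → star w (fund a b) ≡
      (is (tail e) w xor is (head e) w) xor
      ((is (tail e) w xor is (iter par a (tail e)) w) xor (is (head e) w xor is (iter par b (head e)) w))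
    star-fund a b w = trans (star-xor w (ind e) _) (cong₂ _xor_ (star-ind w e)
      (trans (star-xor w (ch a (tail e)) (ch b (head e))) (cong₂ _xor_ (star-ch w a (tail e)) (star-ch w b (head e)))))

    fund-full : Fin d → Bool
    fund-full = fund (ℓ (tail e)) (ℓ (head e))

    -- Both full paths end in layer 0, so the chain is even at every interior vertex. This
    -- determines the boundary off the outer cycle, whichever part of that cycle closes it.
    full-interior : ∀ {w k} → ℓ w ≡ suc k → δ (far e) (pd w) ≡ fund-full (pd w)
    full-interior = Boundary.δ-interior (far-inv e) (fund-α (ℓ (tail e)) (ℓ (head e))) (fund-agree (ℓ (tail e)) (ℓ (head e)) ≤-refl ≤-refl) even
      where
      root : ∀ v {w} → ℓ w ≢ 0 → is (iter par (ℓ v) v) w ≡ false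
      root v {w} nz = dec-false (iter par (ℓ v) v FP.≟ w) (λ q → nz (trans (cong ℓ (sym q))
        (trans (ℓ-up (ℓ v) v ≤-refl) (n∸n≡0 (ℓ v)))))
      even : ∀ w → ℓ w ≢ 0 → star w fund-full ≡ false
      even w nz = trans (star-fund (ℓ (tail e)) (ℓ (head e)) w) (trans (cong₂ (λ s t → (is (tail e) w xor is (head e) w) xor
        ((is (tail e) w xor s) xor (is (head e) w xor t))) (root (tail e) nz) (root (head e) nz))
        (xor-ends (is (tail e) w) (is (head e) w) false false))

    full : ∀ {x} → ¬ Outer x → ¬ Outer (αf x) → δ (far e) x ≡ fund-full x
    full {x} i iα with Tr? x
    ... | no nt = fund-agree (ℓ (tail e)) (ℓ (head e)) ≤-refl ≤-refl x nt
    ... | yes (inj₁ (p , _)) with ℓ (tail x) in ew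
    ...   | zero = ⊥-elim (i (subst Outer (sym p) (pd-Outer ew)))
    ...   | suc k = trans (cong (δ (far e)) p) (trans (full-interior ew) (cong fund-full (sym p)))
    full {x} i iα | yes (inj₂ (p , _)) with ℓ (head x) in ew
    ...   | zero = ⊥-elim (iα (subst Outer (sym p) (pd-Outer ew)))
    ...   | suc k = trans (sym (δ-α (far e) x)) (trans (cong (δ (far e)) p) (trans (full-interior ew)
          (trans (cong fund-full (sym p)) (fund-α (ℓ (tail e)) (ℓ (head e)) x))))

    fund-ends : ∀ a b → a ≤ ℓ (tail e) → b ≤ ℓ (head e) → ∀ {x} → fund a b x ≡ true →
      SameEdge e x ⊎ (∃ λ w → SameEdge (pd w) x × w ≼ tail e × ℓ (tail e) < ℓ w + a)
                   ⊎ (∃ λ w → SameEdge (pd w) x × w ≼ head e × ℓ (head e) < ℓ w + b)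
    fund-ends a b la lb {x} t with xor-true (ind e x) t
    ... | inj₁ s = inj₁ (ind-same s)
    ... | inj₂ s with xor-true (ch a (tail e) x) s
    ...   | inj₁ q = inj₂ (inj₁ (ch-true a la q))
    ...   | inj₂ q = inj₂ (inj₂ (ch-true b lb q))

    pd-ends : ∀ {w x k} → SameEdge (pd w) x → ℓ w ≡ suc k → tail x ≼ w
    pd-ends (inj₁ refl) e = subst (_≼ _) (sym (tail-pd _)) ≼-refl
    pd-ends (inj₂ refl) e = par-≼ e

    full-ends : ∀ {x} → fund-full x ≡ true → tail x ≼ tail e ⊎ tail x ≼ head e
    full-ends {x} t with fund-ends (ℓ (tail e)) (ℓ (head e)) ≤-refl ≤-refl {x} t
    ... | inj₁ (inj₁ refl) = inj₁ ≼-refl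
    ... | inj₁ (inj₂ refl) = inj₂ ≼-refl
    ... | inj₂ (inj₁ (w , s , wv , lt)) = inj₁ (≼-trans (pd-ends s (proj₂ (ch-pos {w = w} ≤-refl lt))) wv)
    ... | inj₂ (inj₂ (w , s , wv , lt)) = inj₂ (≼-trans (pd-ends s (proj₂ (ch-pos {w = w} ≤-refl lt))) wv)

    -- Cutting both paths at `v` leaves a closed chain of descendants of `v` that bounds the region.
    -- Around a vertex off this chain every face is in the region, so the climb to the parent stays
    -- in it and must meet the chain before the outer face.
    far-descends : ∀ {v} → v ≼ tail e → v ≼ head e → ∀ {x} → far e x ≡ true → v ≼ tail x
    far-descends {v} vt vh {x} = go (ℓ (tail x)) x refl
      where
      a b : ℕ
      a = ℓ (tail e) ∸ ℓ v
      b = ℓ (head e) ∸ ℓ v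
      C : Fin d → Bool
      C = fund a b
      even : ∀ w → star w C ≡ false
      even w = trans (star-fund a b w) (trans (cong₂ (λ s t → (is (tail e) w xor is (head e) w) xor
        ((is (tail e) w xor is s w) xor (is (head e) w xor is t w))) (eq vt) (eq vh))
        (trans (xor-ends (is (tail e) w) (is (head e) w) (is v w) (is v w)) (xor-same (is v w))))
      δC : ∀ x → δ (far e) x ≡ C x
      δC = Boundary.δ-closed (far-inv e) (fund-α a b) (fund-agree a b (m∸n≤m _ (ℓ v)) (m∸n≤m _ (ℓ v))) even
      below-v : ∀ {w u} → v ≼ u → w ≼ u → ℓ u < ℓ w + (ℓ u ∸ ℓ v) → ℓ v < ℓ w
      below-v {w} {u} vu wu lt = +-cancelʳ-< (ℓ u ∸ ℓ v) (ℓ v) (ℓ w) (subst (_< ℓ w + (ℓ u ∸ ℓ v)) (sym (m+[n∸m]≡n (ℓ≤ vu))) lt)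
      in-tree : ∀ {w u x} → v ≼ u → w ≼ u → ℓ v < ℓ w → SameEdge (pd w) x → v ≼ tail x
      in-tree vu wu lt (inj₁ refl) = subst (v ≼_) (sym (tail-pd _)) (≼-below vu wu (<⇒≤ lt))
      in-tree vu wu lt (inj₂ refl) = ≼-par (≼-below vu wu (<⇒≤ lt)) lt
      on-C : ∀ {z} → C z ≡ true → v ≼ tail z
      on-C {z} t with fund-ends a b (m∸n≤m _ (ℓ v)) (m∸n≤m _ (ℓ v)) {z} t
      ... | inj₁ (inj₁ refl) = vt
      ... | inj₁ (inj₂ refl) = vh
      ... | inj₂ (inj₁ (w , s , wv , lt)) = in-tree vt wv (below-v vt wv lt) s
      ... | inj₂ (inj₂ (w , s , wv , lt)) = in-tree vh wv (below-v vh wv lt) s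
      go : ∀ k x → ℓ (tail x) ≡ k → far e x ≡ true → v ≼ tail x
      go k x ek fx with FP.any? (λ z → (tail z FP.≟ tail x) ×-dec (C z BP.≟ true))
      ... | yes (z , tz , cz) = subst (v ≼_) tz (on-C cz)
      ... | no none = down k ek
        where
        loc : ∀ z → tail z ≡ tail x → Local (far e) z
        loc z tz = xor-≡ (trans (δC z) (¬t⇒f (λ cz → none (z , tz , cz))))
        at-pd : far e (pd (tail x)) ≡ true
        at-pd = trans (rotate (far-inv e) loc (tail-pd _) refl) fx
        down : ∀ k → ℓ (tail x) ≡ k → v ≼ tail x
        down zero ek = t≢f at-pd (far-Outer e (pd-Outer ek))
        down (suc k) ek = ≼-trans (go k (αf (pd (tail x))) (pd-up ek) (trans (sym (loc _ (tail-pd _))) at-pd)) (par-≼ ek)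

  -- Around a boundary vertex the inner corners form an interval, so only non-boundary edges matter.
  rotate-inner : ∀ {χ} → Inv χ → ∀ {v} → (∀ z → tail z ≡ v → ¬ Outer z → ¬ Outer (αf z) → Local χ z) →
    ∀ {x y} → tail x ≡ v → tail y ≡ v → ¬ Outer x → ¬ Outer y → χ x ≡ χ y
  rotate-inner {χ} inv {v} loc {x} {y} tx ty ix iy with ℓ v in ev
  ... | suc k = rotate inv (λ z tz → loc z tz (λ o → 0≢1+n (trans (sym (Outer-ℓ o)) (trans (cong ℓ tz) ev)))
          (λ o → 0≢1+n (trans (sym (Outer-head o)) (trans (cong ℓ (trans (head-α z) tz)) ev)))) tx ty
  ... | zero = trans (value tx ix) (sym (value ty iy))
    where
    o = pd v
    oo : Outer o
    oo = pd-Outer ev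
    go : ∀ k → tail (iter σf k o) ≡ v × (Outer (iter σf k o) ⊎ χ (iter σf k o) ≡ χ (σf o))
    go zero = tail-pd v , inj₁ oo
    go (suc k) with go k
    ... | t , s with Outer? (σf (iter σf k o))
    ...   | yes oz = trans (σ-vertex _) t , inj₁ oz
    ...   | no iz with s
    ...     | inj₁ oz = trans (σ-vertex _) t , inj₂ (cong (χ ∘ σf) (Outer-unique oz oo (trans t (sym (tail-pd v)))))
    ...     | inj₂ c with Outer? (iter σf k o)
    ...       | yes oz = trans (σ-vertex _) t , inj₂ (cong (χ ∘ σf) (Outer-unique oz oo (trans t (sym (tail-pd v)))))
    ...       | no i = trans (σ-vertex _) t , inj₂ (trans (Inv-σ inv _) (trans (sym (loc _ t i iα)) c))
      where
      iα : ¬ Outer (αf (iter σf k o))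
      iα oα = iz (subst Outer (cong σf αα) (φ-Outer oα))
    value : ∀ {z} → tail z ≡ v → ¬ Outer z → χ z ≡ χ (σf o)
    value {z} tz iz with σ-cyclic o z (trans (tail-pd v) (sym tz))
    ... | k , e with proj₂ (go k)
    ...   | inj₁ oz = ⊥-elim (iz (subst Outer e oz))
    ...   | inj₂ c = trans (cong χ (sym e)) c

  -- Outer darts are disregarded; otherwise every vertex of the outer cycle would be near to any
  -- region that avoids the outer face.
  Near : (Fin d → Bool) → Fin n → Set
  Near U v = ∃ λ x → tail x ≡ v × ¬ Outer x × U x ≡ false

  Beyond : (Fin d → Bool) → Fin n → Set
  Beyond U v = ∃ λ x → tail x ≡ v × ¬ Outer x × U x ≡ true

  crossing : ∀ {U} → Inv U → ∀ {v} → Near U v → Beyond U v →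
    ∃ λ z → tail z ≡ v × ¬ Outer z × ¬ Outer (αf z) × δ U z ≡ true
  crossing {U} inv {v} (x , tx , ix , fx) (y , ty , iy , fy)
    with FP.any? (λ z → (tail z FP.≟ v) ×-dec (¬? (Outer? z) ×-dec (¬? (Outer? (αf z)) ×-dec (δ U z BP.≟ true))))
  ... | yes c = c
  ... | no none = t≢f (trans (rotate-inner inv loc tx ty ix iy) fy) fx
    where
    loc : ∀ z → tail z ≡ v → ¬ Outer z → ¬ Outer (αf z) → Local U z
    loc z tz i iα = xor-≡ (¬t⇒f (λ t → none (z , tz , i , iα , t)))

  Both : (Fin d → Bool) → Fin n → Set
  Both U v = Near U v × Beyond U v

  δ-Both : ∀ {U} → Inv U → ∀ {x} → ¬ Outer x → ¬ Outer (αf x) → δ U x ≡ true → Both U (tail x)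
  δ-Both {U} inv {x} i iα t with bool-cases (U x) | bool-cases (U (αf x))
  ... | inj₁ a | inj₁ b = ⊥-elim (xor-≢ t (trans a (sym b)))
  ... | inj₂ a | inj₂ b = ⊥-elim (xor-≢ t (trans a (sym b)))
  ... | inj₁ a | inj₂ b = (σf x , σ-vertex x , inner , trans (Inv-σ inv x) b) , (x , refl , i , a)
    where inner = subst (¬_ ∘ Outer) (cong σf αα) (inner-φ iα)
  ... | inj₂ a | inj₁ b = (x , refl , i , a) , (σf x , σ-vertex x , inner , trans (Inv-σ inv x) b)
    where inner = subst (¬_ ∘ Outer) (cong σf αα) (inner-φ iα)

  Both-ends : ∀ {e} → ¬ Tr e → ∀ {v} → Both (far e) v → v ≼ tail e ⊎ v ≼ head e
  Both-ends {e} nt {v} (a , b) with crossing (far-inv e) a b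
  ... | z , refl , i , iα , t = full-ends nt (trans (sym (full nt i iα)) t)

  end : Bool → Fin d → Fin n
  end true  x = tail x
  end false x = head x

  module Tracking {D : ℕ} (path : DualPath D) where
    open AlongPath path public

    Near-mono : ∀ {i j v} → i ≤ j → j ≤ D → Near (far (X i)) v → Near (far (X j)) v
    Near-mono ij le (x , t , i , f) = x , t , i , ¬t⇒f (λ g → t≢f (nested ij le x g) f)

    Beyond-anti : ∀ {i j v} → i ≤ j → j ≤ D → Beyond (far (X j)) v → Beyond (far (X i)) v
    Beyond-anti ij le (x , t , i , f) = x , t , i , nested ij le x f

    step-end : ∀ b {k} → k < D → end b (X (suc k)) ≡ end b (X k) ⊎ end (not b) (X (suc k)) ≡ end (not b) (X k)
    step-end b {k} lt with step lt
    ... | inj₁ e = same b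
      where
      h : head (X (suc k)) ≡ head (X k)
      h = trans (cong head e) (trans (head-α _) (tail-φ _))
      same : ∀ b → end b (X (suc k)) ≡ end b (X k) ⊎ end (not b) (X (suc k)) ≡ end (not b) (X k)
      same true  = inj₂ h
      same false = inj₁ h
    ... | inj₂ e = same b
      where
      t : tail (X (suc k)) ≡ tail (X k)
      t = trans (cong tail e) (trans (sym (tail-φ _)) (cong tail (inner³ (far-inner (inside (<⇒≤ lt))))))
      same : ∀ b → end b (X (suc k)) ≡ end b (X k) ⊎ end (not b) (X (suc k)) ≡ end (not b) (X k)
      same true  = inj₁ t
      same false = inj₂ t

    end-Beyond : ∀ b {k} → k ≤ D → ∃ λ x → tail x ≡ end b (X k) × far (X k) x ≡ true
    end-Beyond true  le = X _ , refl , inside le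
    end-Beyond false le = φ (X _) , tail-φ _ , trans (far-inv _ _) (inside le)

    swap-ends : ∀ b {v x} → v ≼ tail x ⊎ v ≼ head x → v ≼ end b x ⊎ v ≼ end (not b) x
    swap-ends true  s = s
    swap-ends false (inj₁ a) = inj₂ a
    swap-ends false (inj₂ a) = inj₁ a

    both-ends : ∀ b {v x} → v ≼ end b x → v ≼ end (not b) x → v ≼ tail x × v ≼ head x
    both-ends true  p q = p , q
    both-ends false p q = q , p

    -- Only one end moves at each step, so a vertex changing sides is at some step an ancestor of both ends,
    -- and from then on of everything beyond.
    sides′ : ∀ b m {i v} → m + i ≤ D → v ≼ end b (X i) → v ≼ end (not b) (X (m + i)) →
      Near (far (X i)) v → Beyond (far (X (m + i))) v → v ≼ end b (X (m + i))
    sides′ b zero le p q _ _ = p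
    sides′ b (suc m) {i} {v} le p q near bey = [ keep , switch ]′ (swap-ends b
        (Both-ends (far-nontree i<D) (Near-mono (n≤1+n i) i<D near , Beyond-anti (s≤s (m≤n+m i m)) le bey)))
      where
      i<D : i < D
      i<D = ≤-trans (s≤s (m≤n+m i m)) le
      shift : m + suc i ≡ suc m + i
      shift = +-suc m i
      keep : v ≼ end b (X (suc i)) → v ≼ end b (X (suc m + i))
      keep p′ = subst (λ k → v ≼ end b (X k)) shift (sides′ b m (subst (_≤ D) (sym shift) le) p′
        (subst (λ k → v ≼ end (not b) (X k)) (sym shift) q) (Near-mono (n≤1+n i) i<D near)
        (subst (λ k → Beyond (far (X k)) v) (sym shift) bey))
      switch : v ≼ end (not b) (X (suc i)) → v ≼ end b (X (suc m + i))
      switch p′ with step-end b i<D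
      ... | inj₁ e = keep (subst (v ≼_) (sym e) p)
      ... | inj₂ e =
        let x , tx , fx = end-Beyond b le
            pt , ph = both-ends b p (subst (v ≼_) e p′)
        in subst (v ≼_) tx (far-descends (far-nontree (<⇒≤ i<D)) pt ph
             (nested (≤-trans (n≤1+n i) (s≤s (m≤n+m i m))) le x fx))

    sides : ∀ b {i j v} → i ≤ j → j ≤ D → v ≼ end b (X i) → v ≼ end (not b) (X j) →
      Near (far (X i)) v → Beyond (far (X j)) v → v ≼ end b (X j)
    sides b {i} {j} {v} ij le p q near bey = subst (λ k → v ≼ end b (X k)) e
      (sides′ b (j ∸ i) (subst (_≤ D) (sym e) le) p (subst (λ k → v ≼ end (not b) (X k)) (sym e) q) near
        (subst (λ k → Beyond (far (X k)) v) (sym e) bey))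
      where
      e : j ∸ i + i ≡ j
      e = m∸n+n≡m ij

-- Chords between the two tree paths of an edge

maximum : ∀ {P : ℕ → Set} (P? : ∀ s → Dec (P s)) N →
  (∃ λ s → P s × ∀ t → t ≤ N → P t → t ≤ s) ⊎ (∀ t → t ≤ N → ¬ P t)
maximum P? zero with P? 0
... | yes p = inj₁ (0 , p , λ t t≤ _ → t≤)
... | no ¬p = inj₂ λ { zero _ → ¬p }
maximum {P} P? (suc N) with P? (suc N)
... | yes p = inj₁ (suc N , p , λ t t≤ _ → t≤)
... | no ¬p with maximum P? N
...   | inj₁ (s , ps , max) = inj₁ (s , ps , λ t t≤ pt → max t (s≤s⁻¹ (≤∧≢⇒< t≤ (λ { refl → ¬p pt }))) pt)
...   | inj₂ none = inj₂ λ t t≤ pt → none t (s≤s⁻¹ (≤∧≢⇒< t≤ (λ { refl → ¬p pt }))) pt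

module Closings {n : ℕ} (G : PlaneGraph n) (T : TriangulatedDisk G) (r : ℕ) (lay : AtMostLayers G r) where
  open Ancestry G T r lay public

  -- Both regions jump at the edge of `e` and at no other non-tree edge, so their sum never jumps
  -- there, and both avoid the outer face.
  far-α : ∀ {e} → ¬ Tr e → ∀ x → far (αf e) x ≡ far e x
  far-α {e} nt x = xor-≡ (trans (constant (λ y → cong₂ _xor_ (far-inv (αf e) y) (far-inv e y)) local x outer)
      (cong₂ _xor_ (far-out (αf e)) (far-out e)))
    where
    f : Fin d → Bool
    f y = far (αf e) y xor far e y
    flip : ∀ {a b c d : Bool} → a ≢ b → c ≢ d → a xor c ≡ b xor d
    flip {false} {false} p q = ⊥-elim (p refl)
    flip {true} {true} p q = ⊥-elim (p refl)
    flip {a} {b} {false} {false} p q = ⊥-elim (q refl)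
    flip {a} {b} {true} {true} p q = ⊥-elim (q refl)
    flip {false} {true} {false} {true} p q = refl
    flip {false} {true} {true} {false} p q = refl
    flip {true} {false} {false} {true} p q = refl
    flip {true} {false} {true} {false} p q = refl
    at-e : Local f e
    at-e = flip (λ q → far-cut (¬Tr-α nt) (trans (sym q) (cong (far (αf e)) (sym αα)))) (far-cut nt)
    local : ∀ y → ¬ Tr y → Local f y
    local y nty with SameEdge? e y
    ... | yes (inj₁ refl) = at-e
    ... | yes (inj₂ refl) = trans (sym at-e) (cong f (sym αα))
    ... | no ns = cong₂ _xor_ (far-local′ (αf e) nty (ns ∘ same)) (far-local′ e nty ns)
      where
      same : SameEdge (αf e) y → SameEdge e y
      same (inj₁ p) = inj₂ p
      same (inj₂ p) = inj₁ (trans p αα)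

  far-same : ∀ {e g} → ¬ Tr e → SameEdge e g → ∀ x → far g x ≡ far e x
  far-same nt (inj₁ refl) x = refl
  far-same nt (inj₂ refl) x = far-α nt x

  Adj? : ∀ u v → Dec (Adj u v)
  Adj? u v = FP.any? λ x → (tail x FP.≟ u) ×-dec (head x FP.≟ v)

  Adj-sym : ∀ {u v} → Adj u v → Adj v u
  Adj-sym (x , t , h) = αf x , h , trans (head-α x) t

  Adj-ℓ : ∀ {u v} → Adj u v → ℓ v ≤ suc (ℓ u)
  Adj-ℓ (x , refl , refl) = ℓ-step x

  data OnPaths (u v : Fin n) (p q : ℕ) (y : Fin n) : Set where
    onᵃ : ∀ i → p ≤ i → i ≤ ℓ u → y ≡ at u i → OnPaths u v p q y
    onᵇ : ∀ j → q ≤ j → j ≤ ℓ v → y ≡ at v j → OnPaths u v p q y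

  OnPaths-swap : ∀ {u v p q y} → OnPaths u v p q y → OnPaths v u q p y
  OnPaths-swap (onᵃ i a b e) = onᵇ i a b e
  OnPaths-swap (onᵇ i a b e) = onᵃ i a b e

  ≼-OnPathsᵃ : ∀ {u v p q w} → w ≼ u → p ≤ ℓ w → OnPaths u v p q w
  ≼-OnPathsᵃ {w = w} wu le = onᵃ (ℓ w) le (ℓ≤ wu) (sym (eq wu))

  ≼-OnPathsᵇ : ∀ {u v p q w} → w ≼ v → q ≤ ℓ w → OnPaths u v p q w
  ≼-OnPathsᵇ {w = w} wu le = onᵇ (ℓ w) le (ℓ≤ wu) (sym (eq wu))

  tree-dart : ∀ {h v i} → tail h ≡ at v (suc i) → head h ≡ at v i → suc i ≤ ℓ v → Tr h
  tree-dart {h} {v} {i} th hh le = subst Tr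
    (sym (simple h (pd (at v (suc i))) (trans th (sym (tail-pd _))) (trans hh (at-par le))))
    (Tr-pd (ℓ-at le))

  tree-dart′ : ∀ {h v i} → tail h ≡ at v i → head h ≡ at v (suc i) → suc i ≤ ℓ v → Tr h
  tree-dart′ {h} th hh le = subst Tr αα (Tr-α (tree-dart hh (trans (head-α h) th) le))

  -- If the two regions were disjoint, their union would contain the tree path from h up to the outer cycle.
  module Disjoint {u v : Fin n} {p₀ q : ℕ} {h : Fin d} {fe fh : Fin d → Bool}
      (pu : suc p₀ ≤ ℓ u) (qv : q ≤ ℓ v) (pq : suc p₀ ≤ suc q)
      (nt : ¬ Tr h) (th : tail h ≡ at u (suc p₀)) (hh : head h ≡ at v q)
      (inv : Inv (λ x → fe x xor fh x)) (out : fe outer xor fh outer ≡ false)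
      (onC : ∀ z → δ (λ x → fe x xor fh x) z ≡ true → OnPaths u v (suc p₀) q (tail z))
      (cut : δ fe (pd (at u (suc p₀))) ≡ true)
      (disj : ∀ x → fe x ≡ true → fh x ≡ true → ⊥) where
    private
      U : Fin d → Bool
      U x = fe x xor fh x

      off : ∀ {i} → i < suc p₀ → ¬ OnPaths u v (suc p₀) q (at u i)
      off {i} lt (onᵃ j pj ju e) = <⇒≢ (≤-trans lt pj)
        (trans (sym (ℓ-at (≤-trans (<⇒≤ lt) pu))) (trans (cong ℓ e) (ℓ-at ju)))
      off {i} lt (onᵇ j qj jv e) = nt (tree-dart th hh′ pu)
        where
        ij : i ≡ j
        ij = trans (sym (ℓ-at (≤-trans (<⇒≤ lt) pu))) (trans (cong ℓ e) (ℓ-at jv))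
        iq : i ≡ q
        iq = ≤-antisym (≤-trans (s≤s⁻¹ lt) (s≤s⁻¹ pq)) (≤-trans qj (≤-reflexive (sym ij)))
        ip : i ≡ p₀
        ip = ≤-antisym (s≤s⁻¹ lt) (≤-trans (s≤s⁻¹ pq) (≤-reflexive (sym iq)))
        hh′ : head h ≡ at u p₀
        hh′ = trans hh (trans (cong (at v) (trans (sym iq) ij)) (trans (sym e) (cong (at u) ip)))

      loc : ∀ {i} → i < suc p₀ → ∀ z → tail z ≡ at u i → Local U z
      loc {i} lt z tz = xor-≡ (¬t⇒f λ t → off lt (subst (OnPaths u v (suc p₀) q) tz (onC z t)))

      zeros : ∀ i → i < suc p₀ → ∀ z → tail z ≡ at u i → U z ≡ false
      zeros zero lt z tz = trans (rotate inv (loc lt) tz (tail-pd _))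
        (Inv-Outer inv out (pd-Outer (ℓ-at z≤n)))
      zeros (suc i) lt z tz = trans (rotate inv (loc lt) tz (tail-pd _)) (trans (loc lt _ (tail-pd _))
        (zeros i (<⇒≤ lt) (αf (pd (at u (suc i)))) (sym (at-par (≤-trans (<⇒≤ lt) pu)))))

      y : Fin d
      y = pd (at u (suc p₀))

      αy0 : U (αf y) ≡ false
      αy0 = zeros p₀ ≤-refl (αf y) (sym (at-par pu))

      y0 : U y ≡ false
      y0 = trans (cong U (sym αα)) (trans (sym (loc ≤-refl (αf y) (sym (at-par pu)))) αy0)

      both0 : ∀ x → U x ≡ false → fe x ≡ false
      both0 x e with bool-cases (fe x)
      ... | inj₂ f = f
      ... | inj₁ t = ⊥-elim (disj x t (trans (sym (xor-≡ e)) t))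

    impossible : ⊥
    impossible = t≢f cut (≡-xor (trans (both0 y y0) (sym (both0 (αf y) αy0))))

  module Edge {e : Fin d} (nte : ¬ Tr e) (ie : ¬ Outer e) (iαe : ¬ Outer (αf e)) where
    u v : Fin n
    u = tail e
    v = head e

    -- Tree edges count as well as chords: where the two paths join, the next tree edge down either
    -- path is a closing (`meeting-closes`). `proper` excludes `e` itself.
    record Closing (p q : ℕ) : Set where
      constructor closing
      field
        p≤     : p ≤ ℓ u
        q≤     : q ≤ ℓ v
        proper : ¬ (p ≡ ℓ u × q ≡ ℓ v)
        adj    : Adj (at u p) (at v q)

      g : Fin d
      g = proj₁ adj

      tail-g : tail g ≡ at u p
      tail-g = proj₁ (proj₂ adj)

      head-g : head g ≡ at v q
      head-g = proj₂ (proj₂ adj)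

      q≤1+p : q ≤ suc p
      q≤1+p = subst₂ (λ i j → i ≤ suc j) (ℓ-at q≤) (ℓ-at p≤) (Adj-ℓ adj)

      p≤1+q : p ≤ suc q
      p≤1+q = subst₂ (λ i j → i ≤ suc j) (ℓ-at p≤) (ℓ-at q≤) (Adj-ℓ (Adj-sym adj))

      g≢e : ¬ SameEdge e g
      g≢e (inj₁ s) = proper (trans (sym (ℓ-at p≤)) (cong ℓ (trans (sym tail-g) (cong tail s))) ,
                            trans (sym (ℓ-at q≤)) (cong ℓ (trans (sym head-g) (cong head s))))
      g≢e (inj₂ s) = proper (≤-antisym p≤ (≤-trans (≤-reflexive (sym lu)) (≤-trans q≤ (≤-reflexive (sym lv)))) ,
                            ≤-antisym q≤ (≤-trans (≤-reflexive (sym lv)) (≤-trans p≤ (≤-reflexive (sym lu)))))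
        where
        lv : p ≡ ℓ v
        lv = trans (sym (ℓ-at p≤)) (cong ℓ (trans (sym tail-g) (cong tail s)))
        lu : q ≡ ℓ u
        lu = trans (sym (ℓ-at q≤)) (cong ℓ (trans (sym head-g) (trans (cong head s) (head-α e))))

    closing? : ∀ p q → Dec (Closing p q)
    closing? p q = map′ (λ { (a , b , c , f) → closing a b c f }) (λ { (closing a b c f) → a , b , c , f })
      ((p ≤? ℓ u) ×-dec ((q ≤? ℓ v) ×-dec (¬? ((p ≟ ℓ u) ×-dec (q ≟ ℓ v)) ×-dec Adj? (at u p) (at v q))))

    Maximal : ℕ → ℕ → Set
    Maximal p q = ∀ p′ q′ → Closing p′ q′ → p′ + q′ ≤ p + q

    data Status : Set where
      open′  : (∀ p q → ¬ Closing p q) → Status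
      closed : ∀ p q → Closing p q → Maximal p q → Status

    ClosingSum : ℕ → Set
    ClosingSum s = ∃ λ (p : Fin (suc (ℓ u))) → ∃ λ (q : Fin (suc (ℓ v))) → toℕ p + toℕ q ≡ s × Closing (toℕ p) (toℕ q)

    closingSum : ∀ {p q} → Closing p q → ClosingSum (p + q)
    closingSum {p} {q} c = F.fromℕ< p< , F.fromℕ< q< , cong₂ _+_ (FP.toℕ-fromℕ< p<) (FP.toℕ-fromℕ< q<) ,
        subst₂ Closing (sym (FP.toℕ-fromℕ< p<)) (sym (FP.toℕ-fromℕ< q<)) c
      where
      p< : p < suc (ℓ u)
      p< = s≤s (Closing.p≤ c)
      q< : q < suc (ℓ v)
      q< = s≤s (Closing.q≤ c)

    status : Status
    status with maximum {ClosingSum}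
                 (λ s → FP.any? λ p → FP.any? λ q → (toℕ p + toℕ q ≟ s) ×-dec closing? (toℕ p) (toℕ q)) (ℓ u + ℓ v)
    ... | inj₂ none = open′ λ p q c → none (p + q) (+-mono-≤ (Closing.p≤ c) (Closing.q≤ c)) (closingSum c)
    ... | inj₁ (_ , (p , q , refl , c) , max) = closed (toℕ p) (toℕ q) c λ p′ q′ c′ →
          max (p′ + q′) (+-mono-≤ (Closing.p≤ c′) (Closing.q≤ c′)) (closingSum c′)

    -- The next tree edge on either path joins the two paths and differs from `e`, which is not in
    -- the tree; if both paths end here, `e` is a loop. The sum `suc (i + i)` exceeds `p + q` for
    -- all `p` and `q` up to `i`, which gives `max-NoMeet`.
    meeting-closes : ∀ {i} → i ≤ ℓ u → i ≤ ℓ v → at u i ≡ at v i → ∃ λ p → ∃ λ q → Closing p q × p + q ≡ suc (i + i)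
    meeting-closes {i} iu iv m with m≤n⇒m<n∨m≡n iv | m≤n⇒m<n∨m≡n iu
    ... | inj₁ lt | _ = i , suc i , closing iu lt
          (λ { (refl , s) → nte (tree-dart′ (trans (sym (at-top u)) m) (trans (sym (at-top v)) (cong (at v) (sym s))) lt) })
          (αf (pd (at v (suc i))) , trans (sym (at-par lt)) (sym m) , trans (head-α _) (tail-pd _)) , +-suc i i
    ... | inj₂ e′ | inj₁ lt = suc i , i , closing lt iv
          (λ { (s , refl) → nte (tree-dart (trans (sym (at-top u)) (cong (at u) (sym s))) (trans (sym (at-top v)) (sym m)) lt) })
          (pd (at u (suc i)) , tail-pd _ , trans (sym (at-par lt)) m) , refl
    ... | inj₂ a | inj₂ b = ⊥-elim (loopless e (trans (sym (at-top v)) (trans (cong (at v) (sym a))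
          (trans (sym m) (trans (cong (at u) b) (at-top u))))))

    ch-off : ∀ m {x w} → m ≤ ℓ x → ¬ w ≼ x → ch m x (pd w) ≡ false
    ch-off m le nw = ¬t⇒f λ t → let w′ , s , wx , _ = ch-true m le t in nw (subst (_≼ _) (sym (pd-same s)) wx)

    ind-pd : ∀ {w k} → k < ℓ w → ind e (pd w) ≡ false
    ind-pd lt = ind-false λ s → nte (Same-Tr s (Tr-pd (proj₂ (0<⇒suc lt))))

    -- An edge on just one of the two paths does not cancel in the chain mod 2.
    only-a : ∀ {w k} → w ≼ u → ¬ w ≼ v → k < ℓ w → δ (far e) (pd w) ≡ true
    only-a wu nv lt = trans (full-interior nte (proj₂ (0<⇒suc lt))) (cong₂ _xor_ (ind-pd lt) (cong₂ _xor_
      (ch-pd (ℓ u) ≤-refl wu (m<n+m (ℓ u) (≤-trans (s≤s z≤n) lt))) (ch-off (ℓ v) ≤-refl nv)))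

    only-b : ∀ {w k} → w ≼ v → ¬ w ≼ u → k < ℓ w → δ (far e) (pd w) ≡ true
    only-b wv nu lt = trans (full-interior nte (proj₂ (0<⇒suc lt))) (cong₂ _xor_ (ind-pd lt) (cong₂ _xor_
      (ch-off (ℓ u) ≤-refl nu) (ch-pd (ℓ v) ≤-refl wv (m<n+m (ℓ v) (≤-trans (s≤s z≤n) lt)))))

    NoMeet : ℕ → ℕ → Set
    NoMeet p q = ∀ {i} → p ≤ i → q ≤ i → i ≤ ℓ u → i ≤ ℓ v → at u i ≢ at v i

    max-NoMeet : ∀ {p q} → Maximal p q → NoMeet p q
    max-NoMeet {p} {q} max {i} pi qi iu iv m with meeting-closes iu iv m
    ... | p′ , q′ , c , s = 1+n≰n (≤-trans (≤-reflexive (sym s)) (≤-trans (max p′ q′ c) (+-mono-≤ pi qi)))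

    open-NoMeet : (∀ p q → ¬ Closing p q) → NoMeet 0 0
    open-NoMeet none pi qi iu iv m with meeting-closes iu iv m
    ... | p′ , q′ , c , s = none p′ q′ c

    module OnSide {p q : ℕ} (nm : NoMeet p q) (q≤1+p : q ≤ suc p) (p≤1+q : p ≤ suc q) where
      off-b : ∀ {w} → w ≼ u → p < ℓ w → ¬ w ≼ v
      off-b wu lt wv = nm (<⇒≤ lt) (≤-trans q≤1+p lt) (ℓ≤ wu) (ℓ≤ wv) (trans (eq wu) (sym (eq wv)))

      off-a : ∀ {w} → w ≼ v → q < ℓ w → ¬ w ≼ u
      off-a wv lt wu = nm (≤-trans p≤1+q lt) (<⇒≤ lt) (ℓ≤ wu) (ℓ≤ wv) (trans (eq wu) (sym (eq wv)))

      module _ {U : Fin d → Bool} (inv : Inv U)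
               (δe : δ U e ≡ true)
               (δa : ∀ {w} → w ≼ u → p < ℓ w → δ U (pd w) ≡ true)
               (δb : ∀ {w} → w ≼ v → q < ℓ w → δ U (pd w) ≡ true) where
        paths-Both : ∀ {y} → OnPaths u v p q y → Both U y
        paths-Both (onᵃ i pi iu refl) with m≤n⇒m<n∨m≡n iu
        ... | inj₂ refl = subst (Both U) (sym (at-top u)) (δ-Both inv ie iαe δe)
        ... | inj₁ lt = subst (Both U) (sym (at-par lt)) (δ-Both inv (αpd-inner (ℓ-at lt))
              (λ o → pd-inner (ℓ-at lt) (subst Outer αα o))
              (trans (δ-α U _) (δa (at-≼ lt) (≤-trans (s≤s pi) (≤-reflexive (sym (ℓ-at lt)))))))
        paths-Both (onᵇ i pi iu refl) with m≤n⇒m<n∨m≡n iu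
        ... | inj₂ refl = subst (Both U) (sym (at-top v)) (δ-Both inv iαe
              (λ o → ie (subst Outer αα o)) (trans (δ-α U e) δe))
        ... | inj₁ lt = subst (Both U) (sym (at-par lt)) (δ-Both inv (αpd-inner (ℓ-at lt))
              (λ o → pd-inner (ℓ-at lt) (subst Outer αα o))
              (trans (δ-α U _) (δb (at-≼ lt) (≤-trans (s≤s pi) (≤-reflexive (sym (ℓ-at lt)))))))

      fund-a : ∀ {w} s t → s ≤ ℓ u → t ≤ ℓ v → w ≼ u → p < ℓ w → ℓ u < ℓ w + s → fund nte s t (pd w) ≡ true
      fund-a {w} s t su tv wu lt bound = cong₂ _xor_ (ind-pd lt) (cong₂ _xor_ (ch-pd s su wu bound) (ch-off t tv (off-b wu lt)))

      fund-b : ∀ {w} s t → s ≤ ℓ u → t ≤ ℓ v → w ≼ v → q < ℓ w → ℓ v < ℓ w + t → fund nte s t (pd w) ≡ true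
      fund-b {w} s t su tv wv lt bound = cong₂ _xor_ (ind-pd lt) (cong₂ _xor_ (ch-off s su (off-a wv lt)) (ch-pd t tv wv bound))

      far-a : ∀ {w} → w ≼ u → p < ℓ w → δ (far e) (pd w) ≡ true
      far-a wu lt = only-a wu (off-b wu lt) lt

      far-b : ∀ {w} → w ≼ v → q < ℓ w → δ (far e) (pd w) ≡ true
      far-b wv lt = only-b wv (off-a wv lt) lt

      far-Both : ∀ {y} → OnPaths u v p q y → Both (far e) y
      far-Both = paths-Both (far-inv e) (trans (far-δ nte nte) (ind-true {e} {e} (inj₁ refl))) far-a far-b

    open-members : ∀ {y} → Both (far e) y → OnPaths u v 0 0 y
    open-members b with Both-ends nte b
    ... | inj₁ yu = ≼-OnPathsᵃ yu z≤n
    ... | inj₂ yv = ≼-OnPathsᵇ yv z≤n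

    module Closed {p q : ℕ} (c : Closing p q) (max : Maximal p q) where
      open Closing c public
      open OnSide (max-NoMeet max) q≤1+p p≤1+q public

      -- The part between `e` and its chord: for a non-tree chord the regions are nested by
      -- `not-disjoint`, so this is the larger minus the smaller; for a tree edge it is `far e`. Its
      -- boundary `C` consists of `e`, `g` and the path segments between them.
      U : Fin d → Bool
      U x = far e x xor far g x

      U-inv : Inv U
      U-inv x = cong₂ _xor_ (far-inv e x) (far-inv g x)

      U-out : U outer ≡ false
      U-out = cong₂ _xor_ (far-out e) (far-out g)

      s t : ℕ
      s = ℓ u ∸ p
      t = ℓ v ∸ q

      C : Fin d → Bool
      C x = fund nte s t x xor ind g x

      δ-far-g : ∀ {x} → ¬ Tr x → δ (far g) x ≡ ind g x
      δ-far-g {x} ntx with Tr? g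
      ... | no ntg = far-δ ntg ntx
      ... | yes tg = trans (cong₂ _xor_ (far-tree tg x) (far-tree tg (αf x)))
                       (sym (ind-false (λ s → ntx (Same-Tr (Same-sym s) tg))))

      agree : ∀ x → ¬ Tr x → δ U x ≡ C x
      agree x ntx = trans (xor-interchange (far e x) (far g x) (far e (αf x)) (far g (αf x)))
        (cong₂ _xor_ (fund-agree nte s t (m∸n≤m _ p) (m∸n≤m _ q) x ntx) (δ-far-g ntx))

      δU : ∀ x → δ U x ≡ C x
      δU = Boundary.δ-closed U-inv (λ x → cong₂ _xor_ (fund-α nte s t x) (ind-α g x)) agree λ w →
        trans (star-xor w (fund nte s t) (ind g)) (trans (cong₂ _xor_ (star-fund nte s t w)
          (trans (star-ind w g) (cong₂ (λ y z → is y w xor is z w) tail-g head-g)))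
          (≡-xor (xor-ends (is u w) (is v w) (is (at u p) w) (is (at v q) w))))

      data OnC (x : Fin d) : Set where
        on-e : SameEdge e x → OnC x
        on-g : SameEdge g x → OnC x
        on-a : ∀ w → SameEdge (pd w) x → w ≼ u → p < ℓ w → OnC x
        on-b : ∀ w → SameEdge (pd w) x → w ≼ v → q < ℓ w → OnC x

      cut-below : ∀ {w x p} → p ≤ ℓ x → ℓ x < ℓ w + (ℓ x ∸ p) → p < ℓ w
      cut-below {w} {x} {p} px lt = +-cancelʳ-< (ℓ x ∸ p) p (ℓ w) (subst (_< ℓ w + (ℓ x ∸ p)) (sym (m+[n∸m]≡n px)) lt)

      C-on : ∀ {x} → C x ≡ true → OnC x
      C-on {x} cx with xor-true (fund nte s t x) cx
      ... | inj₂ i = on-g (ind-same i)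
      ... | inj₁ f with fund-ends nte s t (m∸n≤m _ p) (m∸n≤m _ q) {x} f
      ...   | inj₁ y = on-e y
      ...   | inj₂ (inj₁ (w , y , wu , lt)) = on-a w y wu (cut-below {w} {u} p≤ lt)
      ...   | inj₂ (inj₂ (w , y , wv , lt)) = on-b w y wv (cut-below {w} {v} q≤ lt)

      OnC-tail : ∀ {x} → OnC x → OnPaths u v p q (tail x)
      OnC-tail (on-e (inj₁ refl)) = ≼-OnPathsᵃ ≼-refl p≤
      OnC-tail (on-e (inj₂ refl)) = ≼-OnPathsᵇ ≼-refl q≤
      OnC-tail (on-g (inj₁ refl)) = onᵃ p ≤-refl p≤ tail-g
      OnC-tail (on-g (inj₂ refl)) = onᵇ q ≤-refl q≤ head-g
      OnC-tail (on-a w (inj₁ refl) wu lt) = subst (OnPaths u v p q) (sym (tail-pd w)) (≼-OnPathsᵃ wu (<⇒≤ lt))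
      OnC-tail (on-a w (inj₂ refl) wu lt) with 0<⇒suc lt
      ... | k , e′ = ≼-OnPathsᵃ (≼-trans (par-≼ e′) wu) (≤-trans (s≤s⁻¹ (≤-trans lt (≤-reflexive e′))) (≤-reflexive (sym (pd-up e′))))
      OnC-tail (on-b w (inj₁ refl) wu lt) = subst (OnPaths u v p q) (sym (tail-pd w)) (≼-OnPathsᵇ wu (<⇒≤ lt))
      OnC-tail (on-b w (inj₂ refl) wu lt) with 0<⇒suc lt
      ... | k , e′ = ≼-OnPathsᵇ (≼-trans (par-≼ e′) wu) (≤-trans (s≤s⁻¹ (≤-trans lt (≤-reflexive e′))) (≤-reflexive (sym (pd-up e′))))

      members : ∀ {y} → Both U y → OnPaths u v p q y
      members (a , b) with crossing U-inv a b
      ... | z , refl , _ , _ , δz = OnC-tail (C-on (trans (sym (δU z)) δz))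

      ind-g-a : ∀ {w} → w ≼ u → p < ℓ w → ind g (pd w) ≡ false
      ind-g-a {w} wu lt = ind-false no-same
        where
        no-same : ¬ SameEdge g (pd w)
        no-same (inj₁ s) = <⇒≢ lt (trans (sym (ℓ-at p≤)) (cong ℓ (trans (sym tail-g) (trans (cong tail (sym s)) (tail-pd w)))))
        no-same (inj₂ s) = off-b wu lt (subst (_≼ v) (trans (sym head-g) (trans (cong tail (sym s)) (tail-pd w))) (at-≼ q≤))

      ind-g-b : ∀ {w} → w ≼ v → q < ℓ w → ind g (pd w) ≡ false
      ind-g-b {w} wv lt = ind-false no-same
        where
        no-same : ¬ SameEdge g (pd w)
        no-same (inj₁ s) = off-a wv lt (subst (_≼ u) (trans (sym tail-g) (trans (cong tail (sym s)) (tail-pd w))) (at-≼ p≤))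
        no-same (inj₂ s) = <⇒≢ lt (trans (sym (ℓ-at q≤)) (cong ℓ (trans (sym head-g) (trans (cong tail (sym s)) (tail-pd w)))))

      U-Both : ∀ {y} → OnPaths u v p q y → Both U y
      U-Both = paths-Both U-inv
        (trans (agree e nte) (cong₂ _xor_ (trans (sym (fund-agree nte s t (m∸n≤m _ p) (m∸n≤m _ q) e nte))
          (trans (far-δ nte nte) (ind-true {e} {e} (inj₁ refl)))) (ind-false (g≢e ∘ Same-sym))))
        (λ {w} wu lt → trans (δU (pd w)) (cong₂ _xor_
          (fund-a s t (m∸n≤m _ p) (m∸n≤m _ q) wu lt (subst (_< ℓ w + s) (m+[n∸m]≡n p≤) (+-monoˡ-< s lt)))
          (ind-g-a wu lt)))
        (λ {w} wv lt → trans (δU (pd w)) (cong₂ _xor_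
          (fund-b s t (m∸n≤m _ p) (m∸n≤m _ q) wv lt (subst (_< ℓ w + t) (m+[n∸m]≡n q≤) (+-monoˡ-< t lt)))
          (ind-g-b wv lt)))

      OnC-Outer : ∀ {o} → Outer o → OnC o → SameEdge g o
      OnC-Outer oo (on-e (inj₁ refl)) = ⊥-elim (ie oo)
      OnC-Outer oo (on-e (inj₂ refl)) = ⊥-elim (iαe oo)
      OnC-Outer oo (on-g s) = s
      OnC-Outer oo (on-a w (inj₁ refl) _ lt) = ⊥-elim (pd-inner (proj₂ (0<⇒suc lt)) oo)
      OnC-Outer oo (on-a w (inj₂ refl) _ lt) = ⊥-elim (αpd-inner (proj₂ (0<⇒suc lt)) oo)
      OnC-Outer oo (on-b w (inj₁ refl) _ lt) = ⊥-elim (pd-inner (proj₂ (0<⇒suc lt)) oo)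
      OnC-Outer oo (on-b w (inj₂ refl) _ lt) = ⊥-elim (αpd-inner (proj₂ (0<⇒suc lt)) oo)

      U-αOuter : ∀ {o} → Outer o → ¬ SameEdge g o → U (αf o) ≡ false
      U-αOuter {o} oo ns = trans (sym (xor-≡ (trans (δU o) (¬t⇒f (λ t → ns (OnC-Outer oo (C-on t)))))))
        (Inv-Outer U-inv U-out oo)

      -- Of the two outer edges at `y` at most one is in the boundary of `U`, since only the edge of
      -- `g` can be. The triangle at the other is on the side of the outer face. This yields the
      -- condition that the first set contains the first layer.
      boundary-Near : ∀ {y} → ℓ y ≡ 0 → Near U y
      boundary-Near {y} ey with SameEdge? g (pd y) | Outer-pred (pd-Outer ey)
      ... | no ns | _ = φ (αf (pd y)) , trans (tail-φ _) (trans (head-α _) (tail-pd y)) , inner-φ (Outer-α (pd-Outer ey)) ,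
            trans (U-inv _) (U-αOuter (pd-Outer ey) ns)
      ... | yes s | o , oo , φo = αf o , trans (sym (tail-φ o)) (trans (cong tail φo) (tail-pd y)) , Outer-α oo , U-αOuter oo ns
        where
        ns : ¬ SameEdge g o
        ns s′ with both s s′
          where
          both : ∀ {x y} → SameEdge g x → SameEdge g y → SameEdge x y
          both (inj₁ refl) b = b
          both (inj₂ refl) (inj₁ refl) = inj₂ (sym αα)
          both (inj₂ refl) (inj₂ refl) = inj₁ refl
        ... | inj₁ e′ = ¬fix (trans φo (sym e′))
        ... | inj₂ e′ = Outer-α (pd-Outer ey) (subst Outer e′ oo)

      tail-Both : Both (far e) (tail g)
      tail-Both = far-Both (onᵃ p ≤-refl p≤ tail-g)

      head-Both : Both (far e) (head g)
      head-Both = far-Both (onᵇ q ≤-refl q≤ head-g)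

      no-chord : ∀ {i j} → p ≤ i → q ≤ j → i ≤ ℓ u → j ≤ ℓ v → Adj (at u i) (at v j) →
        (i ≡ ℓ u × j ≡ ℓ v) ⊎ (i ≡ p × j ≡ q)
      no-chord {i} {j} pi qj iu jv ad with (i ≟ ℓ u) ×-dec (j ≟ ℓ v)
      ... | yes y = inj₁ y
      ... | no ny = inj₂ (≤-antisym (+-cancelʳ-≤ q i p (≤-trans (+-monoʳ-≤ i qj) m)) pi ,
                          ≤-antisym (+-cancelˡ-≤ p j q (≤-trans (+-monoˡ-≤ j pi) m)) qj)
        where
        m : i + j ≤ p + q
        m = max i j (closing iu jv ny ad)

      -- Either layer `i` is within both cut paths and `max-NoMeet` applies, or the other end of `g`
      -- is one layer deeper and a meeting would make `g` a tree edge.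
      nontree-ends : ¬ Tr g → ∀ {i} → i ≡ p ⊎ i ≡ q → i ≤ ℓ u → i ≤ ℓ v → at u i ≢ at v i
      nontree-ends ntg {i} (inj₁ refl) iu iv m with m≤n⇒m<n∨m≡n q≤1+p
      ... | inj₁ lt = max-NoMeet max ≤-refl (s≤s⁻¹ lt) iu iv m
      ... | inj₂ refl = ntg (tree-dart′ (trans tail-g m) head-g q≤)
      nontree-ends ntg {i} (inj₂ refl) iu iv m with m≤n⇒m<n∨m≡n p≤1+q
      ... | inj₁ lt = max-NoMeet max (s≤s⁻¹ lt) ≤-refl iu iv m
      ... | inj₂ refl = ntg (tree-dart tail-g (trans head-g (sym m)) p≤)

      -- An end of `g` outside layer 0 has a tree path to the outer cycle, on which `Disjoint` is
      -- based. If both ends are in layer 0, a parity count takes over.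
      not-disjoint : ¬ Tr g → ¬ (∀ x → far e x ≡ true → far g x ≡ true → ⊥)
      not-disjoint ntg disj = by-cases p q refl refl
        where
        onP : ∀ z → δ U z ≡ true → OnPaths u v p q (tail z)
        onP z t = OnC-tail (C-on (trans (sym (δU z)) t))
        by-cases : ∀ p′ q′ → p ≡ p′ → q ≡ q′ → ⊥
        by-cases (suc p₀) _ refl refl = Disjoint.impossible {fe = far e} {fh = far g} p≤ q≤ p≤1+q ntg tail-g head-g U-inv U-out
          onP (only-a (at-≼ p≤) off (≤-reflexive (sym (ℓ-at p≤)))) disj
          where
          off : ¬ at u (suc p₀) ≼ v
          off pv = nontree-ends ntg (inj₁ refl) p≤ (subst (_≤ ℓ v) (ℓ-at p≤) (ℓ≤ pv))
            (sym (trans (cong (at v) (sym (ℓ-at p≤))) (eq pv)))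
        by-cases zero (suc q₀) refl refl = Disjoint.impossible {fe = far e} {fh = far g} q≤ p≤ q≤1+p (¬Tr-α ntg) head-g
          (trans (head-α g) tail-g) U-inv U-out
          (λ z t → OnPaths-swap (onP z t)) (only-b (at-≼ q≤) off (≤-reflexive (sym (ℓ-at q≤)))) disj
          where
          off : ¬ at v (suc q₀) ≼ u
          off pv = nontree-ends ntg (inj₂ refl) (subst (_≤ ℓ u) (ℓ-at q≤) (ℓ≤ pv)) q≤
            (trans (cong (at u) (sym (ℓ-at q≤))) (eq pv))
        -- Disjointness keeps the outer cycle off the boundary of `far g`, which is then the single
        -- edge `g` and has odd degree at `a₀`.
        by-cases zero zero refl refl = t≢f odd (trans (sym (star-cong a₀ δg)) (star-δ (far-inv g) a₀))
          where
          a₀ = at u 0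
          g-inner : ∀ {o} → Outer o → ¬ SameEdge g o
          g-inner {o} oo s = disj e e-far (trans (sym (far-same ntg so e)) (far-x₀ ie))
            where
            nto : ¬ Tr o
            nto t = ntg (Same-Tr s t)
            so : SameEdge g x₀
            so = Same-α (subst (SameEdge g) (Outer-nt oo nto) s)
            e-far : far e e ≡ true
            e-far with bool-cases (far e e)
            ... | inj₁ t = t
            ... | inj₂ f = ⊥-elim (disj (αf e) (bool-other (far-cut nte ∘ sym) f) (trans (sym (far-same ntg so (αf e))) (far-x₀ iαe)))
          δg-Outer : ∀ {o} → Outer o → δ (far g) o ≡ false
          δg-Outer {o} oo = ≡-xor (trans (far-Outer g oo) (sym none))
            where
            eqs : far e (αf o) ≡ far g (αf o)
            eqs = xor-≡ (U-αOuter oo (g-inner oo))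
            none : far g (αf o) ≡ false
            none = ¬t⇒f λ t → disj (αf o) (trans eqs t) t
          δg-int : ∀ {w k} → ℓ w ≡ suc k → δ (far g) (pd w) ≡ ind g (pd w)
          δg-int = Boundary.δ-interior (far-inv g) (ind-α g) (λ x nt → far-δ ntg nt) λ w nz →
            trans (star-ind w g) (cong₂ _xor_
              (dec-false (tail g FP.≟ w) (λ q → nz (trans (cong ℓ (trans (sym q) tail-g)) (ℓ-at p≤))))
              (dec-false (head g FP.≟ w) (λ q → nz (trans (cong ℓ (trans (sym q) head-g)) (ℓ-at q≤)))))
          δg-pd : ∀ w → δ (far g) (pd w) ≡ ind g (pd w)
          δg-pd w with ℓ w in ew
          ... | suc k = δg-int ew
          ... | zero = trans (δg-Outer (pd-Outer ew)) (sym (ind-false (g-inner (pd-Outer ew))))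
          δg : ∀ x → δ (far g) x ≡ ind g x
          δg x with Tr? x
          ... | no nt = far-δ ntg nt
          ... | yes (inj₁ (p , _)) = trans (cong (δ (far g)) p) (trans (δg-pd _) (cong (ind g) (sym p)))
          ... | yes (inj₂ (p , _)) = trans (sym (δ-α (far g) x)) (trans (trans (cong (δ (far g)) p) (trans (δg-pd _) (cong (ind g) (sym p)))) (ind-α g x))
          odd : star a₀ (ind g) ≡ true
          odd = trans (star-ind a₀ g) (cong₂ _xor_ (dec-true (tail g FP.≟ a₀) tail-g)
            (dec-false (head g FP.≟ a₀) (λ q → loopless g (trans q (sym tail-g)))))

-- Windows with a repeated minimum, pigeonholes and the constant 6

module Window (h : ℕ → ℕ) (m : ℕ) where
  record MinWindow (l hi : ℕ) : Set where
    field
      lo up low : ℕ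
      l≤lo   : l ≤ lo
      up≤hi  : up ≤ hi
      minimal : ∀ {i} → lo ≤ i → i < up → low ≤ h i
      xs     : List ℕ
      length-xs : length xs ≡ m
      sorted : AllPairs _<_ xs
      good   : All (λ i → lo ≤ i × i < up × h i ≡ low) xs

  scan : ∀ s B l → (∃ λ i → l ≤ i × i < B + l × h i ≡ s) ⊎ (∀ {i} → l ≤ i → i < B + l → h i ≢ s)
  scan s zero    l = inj₂ λ li il _ → <⇒≱ il li
  scan s (suc B) l with h l ≟ s
  ... | yes e = inj₁ (l , ≤-refl , s≤s (m≤n+m l B) , e)
  ... | no ne with scan s B (suc l)
  ...   | inj₁ (i , a , b , e) = inj₁ (i , ≤-trans (n≤1+n l) a , ≤-trans b (≤-reflexive (+-suc B l)) , e)
  ...   | inj₂ none = inj₂ λ {i} li il → [ (λ lt → none lt (≤-trans il (≤-reflexive (sym (+-suc B l))))) ,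
            (λ { refl → ne }) ]′ (m≤n⇒m<n∨m≡n li)

  next-block : ∀ B c l → c * B + (B + l) ≡ B + c * B + l
  next-block B c l = trans (sym (+-assoc (c * B) B l)) (cong (_+ l) (+-comm (c * B) B))

  blocks : ∀ s B c l → (∃ λ b → l ≤ b × B + b ≤ c * B + l × (∀ {i} → b ≤ i → i < B + b → h i ≢ s)) ⊎
    (Σ (List ℕ) λ xs → length xs ≡ c × AllPairs _<_ xs × All (λ i → l ≤ i × i < c * B + l × h i ≡ s) xs)
  blocks s B zero l = inj₂ ([] , refl , [] , [])
  blocks s B (suc c) l with scan s B l
  ... | inj₂ none = inj₁ (l , ≤-refl , +-monoˡ-≤ l (m≤m+n B (c * B)) , none)
  ... | inj₁ (i , li , iB , e) with blocks s B c (B + l)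
  ...   | inj₁ (b , lb , bB , none) = inj₁ (b , ≤-trans (m≤n+m l B) lb , ≤-trans bB (≤-reflexive (next-block B c l)) , none)
  ...   | inj₂ (xs , len , srt , all) = inj₂ (i ∷ xs , cong suc len , All.map (λ p → ≤-trans iB (proj₁ p)) all ∷ srt ,
            (li , ≤-trans iB (+-monoˡ-≤ l (m≤m+n B (c * B))) , e) ∷
            All.map (λ (a , b , e) → ≤-trans (m≤n+m l B) a , ≤-trans b (≤-reflexive (next-block B c l)) , e) all)

  -- Either the least value s occurs in each of m blocks, or some block avoids it and the next value is tried there.
  window : ∀ V s l → (∀ {i} → l ≤ i → i < m ^ V + l → s ≤ h i × h i < s + V) → MinWindow l (m ^ V + l)
  window zero s l rng = ⊥-elim (<⇒≱ (proj₂ (rng ≤-refl ≤-refl)) (≤-trans (≤-reflexive (+-identityʳ s)) (proj₁ (rng ≤-refl ≤-refl))))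
  window (suc V) s l rng with blocks s (m ^ V) m l
  ... | inj₂ (xs , len , srt , all) = record { lo = l ; up = m ^ suc V + l ; low = s ; l≤lo = ≤-refl ; up≤hi = ≤-refl
        ; minimal = λ a b → proj₁ (rng a b) ; xs = xs ; length-xs = len ; sorted = srt ; good = all }
  ... | inj₁ (b , lb , bB , none) = record { lo = lo ; up = up ; low = low ; l≤lo = ≤-trans lb l≤lo ; up≤hi = ≤-trans up≤hi bB
        ; minimal = minimal ; xs = xs ; length-xs = length-xs ; sorted = sorted ; good = good }
    where
    raised : ∀ {i} → b ≤ i → i < m ^ V + b → suc s ≤ h i × h i < suc s + V
    raised bi iB = let a , c = rng (≤-trans lb bi) (≤-trans iB bB)
      in ≤∧≢⇒< a (none bi iB ∘ sym) , ≤-trans c (≤-reflexive (+-suc s V))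
    open MinWindow (window V (suc s) b raised)

length-filter-∁ : ∀ {A : Set} {P : A → Set} (P? : ∀ x → Dec (P x)) xs →
  length (filter P? xs) + length (filter (λ x → ¬? (P? x)) xs) ≡ length xs
length-filter-∁ P? [] = refl
length-filter-∁ P? (x ∷ xs) with P? x
... | yes _ = cong suc (length-filter-∁ P? xs)
... | no _  = trans (+-suc _ _) (cong suc (length-filter-∁ P? xs))

pigeonhole-list : ∀ (col : ℕ → ℕ) {Q : ℕ → Set} K t xs → AllPairs _<_ xs → All Q xs → All (λ x → col x < suc K) xs →
  suc K * t ≤ length xs → ∃ λ c → Σ (List ℕ) λ ys → t ≤ length ys × AllPairs _<_ ys × All Q ys × All (λ x → col x ≡ c) ys
pigeonhole-list col zero t xs srt q all le = 0 , xs , ≤-trans (≤-reflexive (sym (+-identityʳ t))) le , srt , q ,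
  All.map (λ lt → n≤0⇒n≡0 (s≤s⁻¹ lt)) all
pigeonhole-list col (suc K) t xs srt q all le with t ≤? length (filter (λ x → col x ≟ suc K) xs)
... | yes t≤ = suc K , filter (λ x → col x ≟ suc K) xs , t≤ , AllPairsP.filter⁺ _ srt , AllP.filter⁺ _ q , AllP.all-filter _ xs
... | no t≰ = pigeonhole-list col K t (filter (λ x → ¬? (col x ≟ suc K)) xs) (AllPairsP.filter⁺ _ srt) (AllP.filter⁺ _ q)
    (All.zipWith (λ (ne , lt) → ≤∧≢⇒< (s≤s⁻¹ lt) ne) (AllP.all-filter (λ x → ¬? (col x ≟ suc K)) xs , AllP.filter⁺ _ all))
    (+-cancelˡ-≤ (length (filter (λ x → col x ≟ suc K) xs)) _ _ (≤-trans (+-monoˡ-≤ (suc K * t) (<⇒≤ (≰⇒> t≰)))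
      (≤-trans le (≤-reflexive (sym (length-filter-∁ (λ x → col x ≟ suc K) xs))))))

-- The left side counts the classes used later: three choices among r values and 4 kinds. From 1 to
-- 2 the cube grows by the factor 8, so 2 is a base case (32 ≤ 36); later factors are below 6.
cubic≤6^ : ∀ r → suc r * (suc r * (suc r * 4)) ≤ 6 ^ suc r
cubic≤6^ zero = m≤m+n 4 2
cubic≤6^ (suc zero) = m≤m+n 32 4
cubic≤6^ (suc (suc r)) = ≤-trans (≤-trans (m≤m+n _ _) (≤-reflexive (sym (identity r))))
    (*-monoʳ-≤ 6 (cubic≤6^ (suc r)))
  where
  open +-*-Solver
  identity : ∀ k → 6 * ((2 + k) * ((2 + k) * ((2 + k) * 4))) ≡
    (3 + k) * ((3 + k) * ((3 + k) * 4)) + (84 + 180 * k + 108 * (k * k) + 20 * (k * k * k))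
  identity = solve 1 (λ k → con 6 :* ((con 2 :+ k) :* ((con 2 :+ k) :* ((con 2 :+ k) :* con 4))) :=
    (con 3 :+ k) :* ((con 3 :+ k) :* ((con 3 :+ k) :* con 4)) :+
      (con 84 :+ con 180 :* k :+ con 108 :* (k :* k) :+ con 20 :* (k :* k :* k))) refl

-- From regions to separators and sequences of separators

module _ {n : ℕ} {P : Fin n → Set} (P? : ∀ v → Dec (P v)) where
  subset : Subset n
  subset = Vec.tabulate (λ v → does (P? v))

  ∈-subset⁺ : ∀ {v} → P v → v ∈ subset
  ∈-subset⁺ {v} p = VecP.lookup⇒[]= v subset (trans (VecP.lookup∘tabulate _ v) (dec-true (P? v) p))

  ∈-subset⁻ : ∀ {v} → v ∈ subset → P v
  ∈-subset⁻ {v} m = does-true (P? v) (trans (sym (VecP.lookup∘tabulate _ v)) (VecP.[]=⇒lookup m))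

card-remove : ∀ {n} (S : Subset n) x → x ∈ S → ∣ S ∣ ≡ suc ∣ S Vec.[ x ]≔ false ∣
card-remove (true ∷ S) F.zero Vec.here = refl
card-remove (true ∷ S) (F.suc x) (Vec.there m) = cong suc (card-remove S x m)
card-remove (false ∷ S) (F.suc x) (Vec.there m) = card-remove S x m

card-enumerate : ∀ {n} k (w : Vec (Fin n) k) (S : Subset n) → (∀ a b → lookup w a ≡ lookup w b → a ≡ b) →
  (∀ v → v ∈ S → ∃ λ a → lookup w a ≡ v) → (∀ a → lookup w a ∈ S) → ∣ S ∣ ≡ k
card-enumerate {n} zero [] S inj cov mem = trans (cong ∣_∣ (SubsetP.Empty-unique (λ (v , m) → none (proj₁ (cov v m))))) (SubsetP.∣⊥∣≡0 n)
  where
  none : Fin 0 → ⊥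
  none ()
card-enumerate (suc k) (x ∷ w) S inj cov mem = trans (card-remove S x (mem F.zero)) (cong suc
  (card-enumerate k w (S Vec.[ x ]≔ false) (λ a b e → FP.suc-injective (inj (F.suc a) (F.suc b) e)) cov′ mem′))
  where
  cov′ : ∀ v → v ∈ (S Vec.[ x ]≔ false) → ∃ λ a → lookup w a ≡ v
  cov′ v m with v FP.≟ x
  ... | yes refl = t≢f (trans (sym (VecP.lookup∘update x S false)) (VecP.[]=⇒lookup m)) refl
  ... | no ne with cov v (VecP.lookup⇒[]= v S (trans (sym (VecP.lookup∘update′ ne S false)) (VecP.[]=⇒lookup m)))
  ...   | F.zero , e = ⊥-elim (ne (sym e))
  ...   | F.suc a , e = a , e
  mem′ : ∀ a → lookup w a ∈ (S Vec.[ x ]≔ false)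
  mem′ a = VecP.lookup⇒[]= _ _ (trans (VecP.lookup∘update′ ne S false) (VecP.[]=⇒lookup (mem (F.suc a))))
    where
    ne : lookup w a ≢ x
    ne e with inj (F.suc a) F.zero e
    ... | ()

lookup-∷ʳ-inject₁ : ∀ {A : Set} {k} (w : Vec A k) x a → lookup (w ∷ʳ x) (F.inject₁ a) ≡ lookup w a
lookup-∷ʳ-inject₁ (y ∷ w) x F.zero = refl
lookup-∷ʳ-inject₁ (y ∷ w) x (F.suc a) = lookup-∷ʳ-inject₁ w x a

lookup-∷ʳ-last : ∀ {A : Set} {k} (w : Vec A k) x → lookup (w ∷ʳ x) (F.fromℕ k) ≡ x
lookup-∷ʳ-last [] x = refl
lookup-∷ʳ-last (y ∷ w) x = lookup-∷ʳ-last w x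

last-or-inject₁ : ∀ {k} (a : Fin (suc k)) → a ≡ F.fromℕ k ⊎ ∃ λ b → a ≡ F.inject₁ b
last-or-inject₁ {zero} F.zero = inj₁ refl
last-or-inject₁ {suc k} F.zero = inj₂ (F.zero , refl)
last-or-inject₁ {suc k} (F.suc a) with last-or-inject₁ a
... | inj₁ e = inj₁ (cong F.suc e)
... | inj₂ (b , e) = inj₂ (F.suc b , cong F.suc e)

module Assembly {n : ℕ} (G : PlaneGraph n) (T : TriangulatedDisk G) (r : ℕ) (lay : AtMostLayers G r) where
  open Closings G T r lay public

  Near? : ∀ U v → Dec (Near U v)
  Near? U v = FP.any? λ x → (tail x FP.≟ v) ×-dec (¬? (Outer? x) ×-dec (U x BP.≟ false))

  Beyond? : ∀ U v → Dec (Beyond U v)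
  Beyond? U v = FP.any? λ x → (tail x FP.≟ v) ×-dec (¬? (Outer? x) ×-dec (U x BP.≟ true))

  -- Layers ascend from `p` on the first path and descend from `ℓ v` after its `α` entries. The rank
  -- equations let side and layer be read off from the position alone, the same way in all
  -- separators whose paths have the same parameters.
  data Slot (u v : Fin n) (p q α : ℕ) {k : ℕ} (w : Vec (Fin n) k) (a : Fin k) : Set where
    slotᵃ : ∀ i → p ≤ i → i ≤ ℓ u → lookup w a ≡ at u i → toℕ a + p ≡ i → Slot u v p q α w a
    slotᵇ : ∀ j → q ≤ j → j ≤ ℓ v → lookup w a ≡ at v j → toℕ a + j ≡ α + ℓ v → Slot u v p q α w a

  -- The vector w lists at u p , … , at u (ℓ u) , at v (ℓ v) , … , at v q.
  record Listing (u v : Fin n) (p q α β k : ℕ) (w : Vec (Fin n) k) : Set where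
    field
      length-w : k ≡ β + α
      lengthᵃ  : α + p ≡ suc (ℓ u)
      lengthᵇ  : β + q ≡ suc (ℓ v)
      slot  : ∀ a → Slot u v p q α w a
      findᵃ : ∀ {i} → p ≤ i → i ≤ ℓ u → ∃ λ a → lookup w a ≡ at u i
      findᵇ : ∀ {j} → q ≤ j → j ≤ ℓ v → ∃ λ a → lookup w a ≡ at v j

  listing-[] : ∀ u v → Listing u v (suc (ℓ u)) (suc (ℓ v)) 0 0 0 []
  listing-[] u v = record { length-w = refl ; lengthᵃ = refl ; lengthᵇ = refl ; slot = λ ()
    ; findᵃ = λ a b → ⊥-elim (<⇒≱ a b) ; findᵇ = λ a b → ⊥-elim (<⇒≱ a b) }

  listing-cons : ∀ {u v p q α β k w} → Listing u v (suc p) q α β k w → Listing u v p q (suc α) β (suc k) (at u p ∷ w)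
  listing-cons {u} {v} {p} {q} {α} {β} {k} {w} L = record
    { length-w = trans (cong suc length-w) (sym (+-suc β α))
    ; lengthᵃ = trans (sym (+-suc α p)) lengthᵃ ; lengthᵇ = lengthᵇ
    ; slot = slot′
    ; findᵃ = λ pi iu → [ (λ lt → let a , e = findᵃ lt iu in F.suc a , e) , (λ { refl → F.zero , refl }) ]′ (m≤n⇒m<n∨m≡n pi)
    ; findᵇ = λ qj jv → let a , e = findᵇ qj jv in F.suc a , e }
    where
    open Listing L
    p≤ : p ≤ ℓ u
    p≤ = s≤s⁻¹ (≤-trans (m≤n+m (suc p) α) (≤-reflexive lengthᵃ))
    slot′ : ∀ a → _
    slot′ F.zero = slotᵃ p ≤-refl p≤ refl refl
    slot′ (F.suc a) with slot a
    ... | slotᵃ i pi iu e s = slotᵃ i (<⇒≤ pi) iu e (trans (sym (+-suc (toℕ a) p)) s)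
    ... | slotᵇ j qj jv e s = slotᵇ j qj jv e (cong suc s)

  listing-snoc : ∀ {u v p q α β k w} → Listing u v p (suc q) α β k w → Listing u v p q α (suc β) (suc k) (w ∷ʳ at v q)
  listing-snoc {u} {v} {p} {q} {α} {β} {k} {w} L = record
    { length-w = cong suc length-w
    ; lengthᵃ = lengthᵃ ; lengthᵇ = trans (sym (+-suc β q)) lengthᵇ
    ; slot = slot′
    ; findᵃ = λ pi iu → let a , e = findᵃ pi iu in F.inject₁ a , trans (lookup-∷ʳ-inject₁ w _ a) e
    ; findᵇ = λ qj jv → [ (λ lt → let a , e = findᵇ lt jv in F.inject₁ a , trans (lookup-∷ʳ-inject₁ w _ a) e)
                        , (λ { refl → F.fromℕ k , lookup-∷ʳ-last w _ }) ]′ (m≤n⇒m<n∨m≡n qj) }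
    where
    open Listing L
    q≤ : q ≤ ℓ v
    q≤ = s≤s⁻¹ (≤-trans (m≤n+m (suc q) β) (≤-reflexive lengthᵇ))
    last-rank : k + q ≡ α + ℓ v
    last-rank = suc-injective (trans (cong (λ m → suc (m + q)) length-w) (trans (cong (λ m → suc (m + q)) (+-comm β α))
      (trans (cong suc (+-assoc α β q)) (trans (sym (+-suc α (β + q))) (trans (cong (α +_) (trans (sym (+-suc β q)) lengthᵇ)) (+-suc α (ℓ v)))))))
    slot′ : ∀ a → _
    slot′ a with last-or-inject₁ a
    ... | inj₁ refl = slotᵇ q ≤-refl q≤ (lookup-∷ʳ-last w _) (trans (cong (_+ q) (FP.toℕ-fromℕ k)) last-rank)
    ... | inj₂ (b , refl) with slot b
    ...   | slotᵃ i pi iu e s = slotᵃ i pi iu (trans (lookup-∷ʳ-inject₁ w _ b) e) (trans (cong (_+ p) (FP.toℕ-inject₁ b)) s)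
    ...   | slotᵇ j qj jv e s = slotᵇ j (<⇒≤ qj) jv (trans (lookup-∷ʳ-inject₁ w _ b) e) (trans (cong (_+ j) (FP.toℕ-inject₁ b)) s)

  listingᵃ : ∀ u v α p → α + p ≡ suc (ℓ u) → Σ (Vec (Fin n) α) (Listing u v p (suc (ℓ v)) α 0 α)
  listingᵃ u v zero p refl = [] , listing-[] u v
  listingᵃ u v (suc α) p e = let w , L = listingᵃ u v α (suc p) (trans (+-suc α p) e) in _ , listing-cons L

  listing : ∀ u v α β p q → α + p ≡ suc (ℓ u) → β + q ≡ suc (ℓ v) → Σ (Vec (Fin n) (β + α)) (Listing u v p q α β (β + α))
  listing u v α zero p q ea refl = listingᵃ u v α p ea
  listing u v α (suc β) p q ea eb = let w , L = listing u v α β p (suc q) ea (trans (+-suc β q) eb) in _ , listing-snoc L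

  rankᵃ< : ∀ {c p α Lu i} → α + p ≡ suc Lu → i ≤ Lu → c + p ≡ i → c < α
  rankᵃ< {c} {p} {α} ea iu s = +-cancelʳ-≤ p (suc c) α (≤-trans (s≤s (≤-trans (≤-reflexive s) iu)) (≤-reflexive (sym ea)))

  rankᵇ≥ : ∀ {c j α Lv} → j ≤ Lv → c + j ≡ α + Lv → α ≤ c
  rankᵇ≥ {c} {j} {α} {Lv} jv s = +-cancelʳ-≤ j α c (≤-trans (+-monoʳ-≤ α jv) (≤-reflexive (sym s)))

  -- What separators with and without chord have in common; `p` and `q` are the layers where the two
  -- paths are cut.
  record Piece (p q Lu Lv : ℕ) : Set where
    field
      u v : Fin n
      ℓu  : ℓ u ≡ Lu
      ℓv  : ℓ v ≡ Lv
      uv  : Adj u v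
      U   : Fin d → Bool
      inv : Inv U
      members : ∀ {y} → Both U y → OnPaths u v p q y
      onBoth  : ∀ {y} → OnPaths u v p q y → Both U y
      chord   : ∀ {i j} → p ≤ i → q ≤ j → i ≤ ℓ u → j ≤ ℓ v → Adj (at u i) (at v j) →
                (i ≡ ℓ u × j ≡ ℓ v) ⊎ (i ≡ p × j ≡ q)

  piece-swap : ∀ {p q Lu Lv} → Piece p q Lu Lv → Piece q p Lv Lu
  piece-swap P = record { u = v ; v = u ; ℓu = ℓv ; ℓv = ℓu ; uv = Adj-sym uv ; U = U ; inv = inv
    ; members = OnPaths-swap ∘ members ; onBoth = onBoth ∘ OnPaths-swap
    ; chord = λ a b c d ad → [ (λ (x , y) → inj₁ (y , x)) , (λ (x , y) → inj₂ (y , x)) ]′ (chord b a d c (Adj-sym ad)) }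
    where open Piece P

  module Single {p q Lu Lv : ℕ} (P : Piece p q Lu Lv)
                (noMeet : ∀ {i} → p ≤ i → q ≤ i → i ≤ ℓ (Piece.u P) → i ≤ ℓ (Piece.v P) → at (Piece.u P) i ≢ at (Piece.v P) i) where
    open Piece P

    A B S : Subset n
    A = subset (Near? U)
    B = subset (Beyond? U)
    S = A ∩ B

    S⁻ : ∀ {y} → y ∈ S → OnPaths u v p q y
    S⁻ m = let a , b = SubsetP.x∈p∩q⁻ A B m in members (∈-subset⁻ (Near? U) a , ∈-subset⁻ (Beyond? U) b)

    S⁺ : ∀ {y} → OnPaths u v p q y → y ∈ S
    S⁺ o = let a , b = onBoth o in SubsetP.x∈p∩q⁺ (∈-subset⁺ (Near? U) a , ∈-subset⁺ (Beyond? U) b)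

    cover : ∀ y → y ∈ A ⊎ y ∈ B
    cover y with inner-dart y
    ... | x , tx , ix with bool-cases (U x)
    ...   | inj₁ t = inj₂ (∈-subset⁺ (Beyond? U) (x , tx , ix , t))
    ...   | inj₂ f = inj₁ (∈-subset⁺ (Near? U) (x , tx , ix , f))

    triangle-side : ∀ {x} → ¬ Outer x → (tail x ∈ A × head x ∈ A) ⊎ (tail x ∈ B × head x ∈ B)
    triangle-side {x} ix with bool-cases (U x)
    ... | inj₁ t = inj₂ (∈-subset⁺ (Beyond? U) (x , refl , ix , t) , ∈-subset⁺ (Beyond? U) (φ x , tail-φ x , inner-φ ix , trans (inv x) t))
    ... | inj₂ f = inj₁ (∈-subset⁺ (Near? U) (x , refl , ix , f) , ∈-subset⁺ (Near? U) (φ x , tail-φ x , inner-φ ix , trans (inv x) f))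

    -- Every edge is a side of an inner triangle, and the corners of a triangle are all in `A` or
    -- all in `B`.
    noEdge : ∀ y z → y ∈ A → y ∉ B → z ∈ B → z ∉ A → ¬ Adj y z
    noEdge y z _ y∉B _ z∉A (x , refl , refl) with Outer? x
    ... | no ix = [ z∉A ∘ proj₂ , y∉B ∘ proj₁ ]′ (triangle-side ix)
    ... | yes ox = [ z∉A ∘ proj₁ , y∉B ∘ subst (_∈ B) (head-α x) ∘ proj₂ ]′ (triangle-side (Outer-α ox))

    module _ {α β k : ℕ} {w : Vec (Fin n) k} (L : Listing u v p q α β k w) where
      open Listing L

      listing-inj : ∀ a b → lookup w a ≡ lookup w b → a ≡ b
      listing-inj a b e with slot a | slot b
      ... | slotᵃ i _ iu x s | slotᵃ j _ ju y t = FP.toℕ-injective (+-cancelʳ-≡ p _ _ (trans s (trans ij (sym t))))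
        where
        ij : i ≡ j
        ij = at-ℓ-≡ iu ju x y e
      ... | slotᵇ i _ iu x s | slotᵇ j _ ju y t = FP.toℕ-injective (+-cancelʳ-≡ j _ _ (trans (subst (λ m → toℕ a + m ≡ α + ℓ v) ij s) (sym t)))
        where
        ij : i ≡ j
        ij = at-ℓ-≡ iu ju x y e
      ... | slotᵃ i pi iu x s | slotᵇ j qj jv y t = ⊥-elim (noMeet pi (subst (q ≤_) (sym ij) qj) iu (subst (_≤ ℓ v) (sym ij) jv)
              (trans (sym x) (trans e (trans y (cong (at v) (sym ij))))))
        where
        ij : i ≡ j
        ij = at-ℓ-≡ iu jv x y e
      ... | slotᵇ j qj jv y t | slotᵃ i pi iu x s = ⊥-elim (noMeet pi (subst (q ≤_) (sym ij) qj) iu (subst (_≤ ℓ v) (sym ij) jv)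
              (trans (sym x) (trans (sym e) (trans y (cong (at v) (sym ij))))))
        where
        ij : i ≡ j
        ij = at-ℓ-≡ iu jv x y (sym e)

      listing-image : ∀ y → (y ∈ S → ∃ λ a → lookup w a ≡ y) × (∀ a → lookup w a ≡ y → y ∈ S)
      listing-image y = to , from
        where
        to : y ∈ S → ∃ λ a → lookup w a ≡ y
        to m with S⁻ m
        ... | onᵃ i pi iu e = let a , x = findᵃ pi iu in a , trans x (sym e)
        ... | onᵇ j qj jv e = let a , x = findᵇ qj jv in a , trans x (sym e)
        from : ∀ a → lookup w a ≡ y → y ∈ S
        from a e with slot a
        ... | slotᵃ i pi iu x _ = S⁺ (onᵃ i pi iu (trans (sym e) x))
        ... | slotᵇ i pi iu x _ = S⁺ (onᵇ i pi iu (trans (sym e) x))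

      size : ∣ S ∣ ≡ k
      size = card-enumerate k w S listing-inj (λ y m → proj₁ (listing-image y) m) (λ a → proj₂ (listing-image (lookup w a)) a refl)

      Consecutive : Fin k → Fin k → Set
      Consecutive a b = suc (toℕ a) ≡ toℕ b ⊎ suc (toℕ b) ≡ toℕ a

      Wraps : Fin k → Fin k → Set
      Wraps a b = suc (toℕ a) ≡ k × toℕ b ≡ 0

      same-path : ∀ {x i j} → i ≤ ℓ x → j ≤ ℓ x → Adj (at x i) (at x j) → suc i ≡ j ⊎ suc j ≡ i
      same-path {x} {i} {j} ix jx ad with <-cmp′ i j
        where
        <-cmp′ : ∀ i j → i < j ⊎ i ≡ j ⊎ j < i
        <-cmp′ i j with i ≟ j
        ... | yes e = inj₂ (inj₁ e)
        ... | no ne = [ (λ le → inj₁ (≤∧≢⇒< le ne)) , (λ ge → inj₂ (inj₂ (≤∧≢⇒< ge (ne ∘ sym)))) ]′ (≤-total i j)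
      ... | inj₁ lt = inj₁ (≤-antisym lt (subst₂ (λ a b → b ≤ suc a) (ℓ-at ix) (ℓ-at jx) (Adj-ℓ ad)))
      ... | inj₂ (inj₁ refl) = let y , t , h = ad in ⊥-elim (loopless y (trans h (sym t)))
      ... | inj₂ (inj₂ gt) = inj₂ (≤-antisym gt (subst₂ (λ a b → b ≤ suc a) (ℓ-at jx) (ℓ-at ix) (Adj-ℓ (Adj-sym ad))))

      -- In ranks, the edge between `u` and `v` is the step from the last entry of the first path to
      -- the first entry of the second, and the closing edge is the wrap-around.
      cross-edge : ∀ {a b : Fin k} {i j} → toℕ a + p ≡ i → toℕ b + j ≡ α + ℓ v →
        (i ≡ ℓ u × j ≡ ℓ v) ⊎ (i ≡ p × j ≡ q) → suc (toℕ a) ≡ toℕ b ⊎ (suc (toℕ b) ≡ k × toℕ a ≡ 0) × (i ≡ p × j ≡ q)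
      cross-edge {a} {b} s t (inj₁ (refl , refl)) = inj₁ (+-cancelʳ-≡ p _ _
        (trans (cong suc s) (trans (sym lengthᵃ) (cong (_+ p) (sym (+-cancelʳ-≡ (ℓ v) (toℕ b) α t))))))
      cross-edge {a} {b} s t (inj₂ (refl , refl)) = inj₂ ((+-cancelʳ-≡ q _ _
        (trans (cong suc t) (trans (sym (+-suc α (ℓ v))) (trans (cong (α +_) (sym lengthᵇ))
          (trans (sym (+-assoc α β q)) (cong (_+ q) (trans (+-comm α β) (sym length-w))))))) ,
          +-cancelʳ-≡ p (toℕ a) 0 s) , refl , refl)

      adjacent : ∀ a b → Adj (lookup w a) (lookup w b) →
        Consecutive a b ⊎ ((Wraps b a ⊎ Wraps a b) × Adj (at u p) (at v q))
      adjacent a b ad with slot a | slot b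
      ... | slotᵃ i _ iu x s | slotᵃ j _ ju y t with same-path iu ju (subst₂ Adj x y ad)
      ...   | inj₁ refl = inj₁ (inj₁ (+-cancelʳ-≡ p _ _ (trans (cong suc s) (sym t))))
      ...   | inj₂ refl = inj₁ (inj₂ (+-cancelʳ-≡ p _ _ (trans (cong suc t) (sym s))))
      adjacent a b ad | slotᵇ i _ iu x s | slotᵇ j _ ju y t with same-path iu ju (subst₂ Adj x y ad)
      ...   | inj₁ refl = inj₁ (inj₂ (+-cancelʳ-≡ i _ _ (trans (sym (+-suc (toℕ b) i)) (trans t (sym s)))))
      ...   | inj₂ refl = inj₁ (inj₁ (+-cancelʳ-≡ j _ _ (trans (sym (+-suc (toℕ a) j)) (trans s (sym t)))))
      adjacent a b ad | slotᵃ i pi iu x s | slotᵇ j qj jv y t with cross-edge {a} {b} s t (chord pi qj iu jv (subst₂ Adj x y ad))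
      ...   | inj₁ e = inj₁ (inj₁ e)
      ...   | inj₂ (e , refl , refl) = inj₂ (inj₁ e , subst₂ Adj x y ad)
      adjacent a b ad | slotᵇ j qj jv y t | slotᵃ i pi iu x s with cross-edge {b} {a} s t (chord pi qj iu jv (Adj-sym (subst₂ Adj y x ad)))
      ...   | inj₁ e = inj₁ (inj₂ e)
      ...   | inj₂ (e , refl , refl) = inj₂ (inj₂ e , Adj-sym (subst₂ Adj y x ad))

      path-step : ∀ {x i} → suc i ≤ ℓ x → Adj (at x i) (at x (suc i))
      path-step le = Adj-sym (_ , tail-pd _ , sym (at-par le))

      successor : ∀ a b → suc (toℕ a) ≡ toℕ b → Adj (lookup w a) (lookup w b)
      successor a b e with slot a | slot b
      ... | slotᵃ i _ iu x s | slotᵃ j _ ju y t = subst₂ Adj (sym x) (trans (cong (at u) ij) (sym y))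
            (path-step (subst (_≤ ℓ u) (sym ij) ju))
        where
        ij : suc i ≡ j
        ij = trans (cong suc (sym s)) (trans (cong (_+ p) e) t)
      ... | slotᵇ i _ iu x s | slotᵇ j _ ju y t = subst₂ Adj (trans (cong (at v) ij) (sym x)) (sym y)
            (Adj-sym (path-step (subst (_≤ ℓ v) (sym ij) iu)))
        where
        ij : suc j ≡ i
        ij = +-cancelˡ-≡ (toℕ a) _ _ (trans (+-suc (toℕ a) j) (trans (cong (_+ j) e) (trans t (sym s))))
      ... | slotᵇ i _ iu x s | slotᵃ j _ ju y t = ⊥-elim (<⇒≱ (rankᵃ< {c = toℕ b} {p} {α} lengthᵃ ju t)
            (≤-trans (rankᵇ≥ {toℕ a} iu s) (≤-trans (n≤1+n _) (≤-reflexive e))))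
      ... | slotᵃ i _ iu x s | slotᵇ j _ jv y t = subst₂ Adj (trans (sym (at-top u)) (trans (cong (at u) (sym iu≡)) (sym x)))
            (trans (sym (at-top v)) (trans (cong (at v) (sym jv≡)) (sym y))) uv
        where
        b≡α : toℕ b ≡ α
        b≡α = ≤-antisym (≤-trans (≤-reflexive (sym e)) (rankᵃ< {toℕ a} {p} {α} lengthᵃ iu s)) (rankᵇ≥ {toℕ b} jv t)
        jv≡ : j ≡ ℓ v
        jv≡ = +-cancelˡ-≡ α _ _ (trans (cong (_+ j) (sym b≡α)) t)
        iu≡ : i ≡ ℓ u
        iu≡ = suc-injective (trans (cong suc (sym s)) (trans (cong (_+ p) (trans e b≡α)) lengthᵃ))

      consecutive : ∀ a b → Consecutive a b → Adj (lookup w a) (lookup w b)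
      consecutive a b (inj₁ e) = successor a b e
      consecutive a b (inj₂ e) = Adj-sym (successor b a e)

      wraps : p ≤ ℓ u → q ≤ ℓ v → Adj (at u p) (at v q) → ∀ a b → Wraps b a → Adj (lookup w a) (lookup w b)
      wraps pu qv pq a b (eb , ea) with slot a | slot b
      ... | slotᵇ j _ jv y t | _ = ⊥-elim (n≮0 (≤-trans (≤-trans 1≤α (rankᵇ≥ {toℕ a} jv t)) (≤-reflexive ea)))
        where
        1≤α : 1 ≤ α
        1≤α = +-cancelʳ-≤ p 1 α (≤-trans (s≤s pu) (≤-reflexive (sym lengthᵃ)))
      ... | slotᵃ i _ iu x s | slotᵃ j _ ju y t = ⊥-elim (<⇒≱ (rankᵃ< {toℕ b} {p} {α} lengthᵃ ju t)
            (s≤s⁻¹ (≤-trans (+-monoˡ-≤ α 1≤β) (≤-reflexive (trans (sym length-w) (sym eb))))))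
        where
        1≤β : 1 ≤ β
        1≤β = +-cancelʳ-≤ q 1 β (≤-trans (s≤s qv) (≤-reflexive (sym lengthᵇ)))
      ... | slotᵃ i _ iu x s | slotᵇ j _ jv y t = subst₂ Adj (trans (cong (at u) (trans (cong (_+ p) (sym ea)) s)) (sym x))
            (trans (cong (at v) (sym jq)) (sym y)) pq
        where
        jq : j ≡ q
        jq = +-cancelˡ-≡ (toℕ b) _ _ (suc-injective (trans (cong suc t) (trans (sym (+-suc α (ℓ v))) (trans (cong (α +_) (sym lengthᵇ))
          (trans (sym (+-assoc α β q)) (cong (_+ q) (trans (+-comm α β) (trans (sym length-w) (sym eb)))))))))

      -- If the first and the last entry are adjacent, they are `u` and `v` themselves; the listing
      -- then has length 2 and the wrap-around is an ordinary step.
      induces-path : (Adj (at u p) (at v q) → p ≡ ℓ u × q ≡ ℓ v) → InducesPath G S k w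
      induces-path none = listing-inj , listing-image , λ a b →
        (λ ad → [ id , short a b ]′ (adjacent a b ad)) , consecutive a b
        where
        two : p ≡ ℓ u × q ≡ ℓ v → k ≡ 2
        two (eu , ev) = trans length-w (cong₂ _+_ (+-cancelʳ-≡ q β 1 (trans lengthᵇ (cong suc (sym ev))))
                                                  (+-cancelʳ-≡ p α 1 (trans lengthᵃ (cong suc (sym eu)))))
        wrap-two : ∀ {a b} → k ≡ 2 → Wraps b a → suc (toℕ a) ≡ toℕ b
        wrap-two e (eb , ea) = trans (cong suc ea) (sym (suc-injective (trans eb e)))
        short : ∀ a b → (Wraps b a ⊎ Wraps a b) × Adj (at u p) (at v q) → Consecutive a b
        short a b (inj₁ x , pq) = inj₁ (wrap-two {a} {b} (two (none pq)) x)
        short a b (inj₂ x , pq) = inj₂ (wrap-two {b} {a} (two (none pq)) x)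

      induces-cycle : p ≤ ℓ u → q ≤ ℓ v → ¬ (p ≡ ℓ u × q ≡ ℓ v) → Adj (at u p) (at v q) → InducesCycle G S k w
      induces-cycle pu qv proper pq = 3≤k , listing-inj , listing-image , λ a b →
          (λ ad → to a b (adjacent a b ad)) , from a b
        where
        3≤k : 3 ≤ k
        3≤k with m≤n⇒m<n∨m≡n pu | m≤n⇒m<n∨m≡n qv
        ... | inj₂ e | inj₂ e′ = ⊥-elim (proper (e , e′))
        ... | inj₁ lt | _ = ≤-trans (+-mono-≤ {1} {β} {2} {α}
              (+-cancelʳ-≤ q 1 β (≤-trans (s≤s qv) (≤-reflexive (sym lengthᵇ))))
              (+-cancelʳ-≤ p 2 α (≤-trans (s≤s lt) (≤-reflexive (sym lengthᵃ))))) (≤-reflexive (sym length-w))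
        ... | inj₂ _ | inj₁ lt = ≤-trans (+-mono-≤ {2} {β} {1} {α}
              (+-cancelʳ-≤ q 2 β (≤-trans (s≤s lt) (≤-reflexive (sym lengthᵇ))))
              (+-cancelʳ-≤ p 1 α (≤-trans (s≤s pu) (≤-reflexive (sym lengthᵃ))))) (≤-reflexive (sym length-w))
        to : ∀ a b → Consecutive a b ⊎ ((Wraps b a ⊎ Wraps a b) × Adj (at u p) (at v q)) → CycSucc G k a b ⊎ CycSucc G k b a
        to a b (inj₁ (inj₁ e)) = inj₁ (inj₁ e)
        to a b (inj₁ (inj₂ e)) = inj₂ (inj₁ e)
        to a b (inj₂ (inj₁ e , _)) = inj₂ (inj₂ e)
        to a b (inj₂ (inj₂ e , _)) = inj₁ (inj₂ e)
        from : ∀ a b → CycSucc G k a b ⊎ CycSucc G k b a → Adj (lookup w a) (lookup w b)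
        from a b (inj₁ (inj₁ e)) = consecutive a b (inj₁ e)
        from a b (inj₁ (inj₂ e)) = Adj-sym (wraps pu qv pq b a e)
        from a b (inj₂ (inj₁ e)) = consecutive a b (inj₂ e)
        from a b (inj₂ (inj₂ e)) = wraps pu qv pq a b e

    two-per-layer : ∀ a b c → a ∈ S → b ∈ S → c ∈ S → a ≢ b → b ≢ c → a ≢ c →
      ∀ l → Layer G l a → Layer G l b → Layer G l c → ⊥
    two-per-layer a b c ma mb mc ab bc ac l la lb lc with on ma la | on mb lb | on mc lc
      where
      on : ∀ {y} → y ∈ S → Layer G l y → y ≡ at u l ⊎ y ≡ at v l
      on m ly with S⁻ m
      ... | onᵃ i _ iu e = inj₁ (trans e (cong (at u) (trans (sym (ℓ-at iu)) (trans (cong ℓ (sym e)) (ℓ-unique ly)))))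
      ... | onᵇ i _ iu e = inj₂ (trans e (cong (at v) (trans (sym (ℓ-at iu)) (trans (cong ℓ (sym e)) (ℓ-unique ly)))))
    ... | inj₁ x | inj₁ y | _ = ab (trans x (sym y))
    ... | inj₂ x | inj₂ y | _ = ab (trans x (sym y))
    ... | inj₁ x | inj₂ y | inj₁ z = ac (trans x (sym z))
    ... | inj₁ x | inj₂ y | inj₂ z = bc (trans y (sym z))
    ... | inj₂ x | inj₁ y | inj₁ z = bc (trans y (sym z))
    ... | inj₂ x | inj₁ y | inj₂ z = ac (trans x (sym z))

  -- `cross` relates different pieces: the first path of one never meets the second path of another.
  -- Together with the layers this fixes the place of a vertex in every separator that contains it.
  module Sequence {t p q Lu Lv : ℕ} (piece : Fin t → Piece p q Lu Lv) (pu : p ≤ Lu) (qv : q ≤ Lv)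
      (nested : ∀ (i j : Fin t) → suc (toℕ i) ≡ toℕ j → ∀ x → Piece.U (piece j) x ≡ true → Piece.U (piece i) x ≡ true)
      (cross : ∀ i j {x} → p ≤ x → q ≤ x → x ≤ Lu → x ≤ Lv → at (Piece.u (piece i)) x ≢ at (Piece.v (piece j)) x)
      (distinct : ∀ (i j : Fin t) → suc (toℕ i) ≡ toℕ j →
         ¬ (Piece.u (piece i) ≡ Piece.u (piece j) × Piece.v (piece i) ≡ Piece.v (piece j))) where
    module P i = Piece (piece i)
    module S i = Single (piece i) (λ a b c d → cross i i a b (subst (_ ≤_) (P.ℓu i) c) (subst (_ ≤_) (P.ℓv i) d))

    top-u : ∀ i → OnPaths (P.u i) (P.v i) p q (P.u i)
    top-u i = ≼-OnPathsᵃ ≼-refl (subst (p ≤_) (sym (P.ℓu i)) pu)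

    top-v : ∀ i → OnPaths (P.u i) (P.v i) p q (P.v i)
    top-v i = ≼-OnPathsᵇ ≼-refl (subst (q ≤_) (sym (P.ℓv i)) qv)

    same-u : ∀ i j → OnPaths (P.u j) (P.v j) p q (P.u i) → P.u i ≡ P.u j
    same-u i j (onᵃ x _ xu e) = trans e (trans (cong (at (P.u j)) x≡) (at-top _))
      where
      x≡ : x ≡ ℓ (P.u j)
      x≡ = trans (sym (ℓ-at xu)) (trans (cong ℓ (sym e)) (trans (P.ℓu i) (sym (P.ℓu j))))
    same-u i j (onᵇ x qx xv e) = ⊥-elim (cross i j {x} (subst (p ≤_) (sym x≡) pu) qx (≤-reflexive x≡) (subst (x ≤_) (P.ℓv j) xv)
        (trans (trans (cong (at (P.u i)) (trans x≡ (sym (P.ℓu i)))) (at-top _)) e))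
      where
      x≡ : x ≡ Lu
      x≡ = trans (sym (ℓ-at xv)) (trans (cong ℓ (sym e)) (P.ℓu i))

    same-v : ∀ i j → OnPaths (P.u j) (P.v j) p q (P.v i) → P.v i ≡ P.v j
    same-v i j (onᵇ x _ xu e) = trans e (trans (cong (at (P.v j)) x≡) (at-top _))
      where
      x≡ : x ≡ ℓ (P.v j)
      x≡ = trans (sym (ℓ-at xu)) (trans (cong ℓ (sym e)) (trans (P.ℓv i) (sym (P.ℓv j))))
    same-v i j (onᵃ x px xu e) = ⊥-elim (cross j i {x} px (subst (q ≤_) (sym x≡) qv) (subst (x ≤_) (P.ℓu j) xu) (≤-reflexive x≡)
        (sym (trans (trans (cong (at (P.v i)) (trans x≡ (sym (P.ℓv i)))) (at-top _)) e)))
      where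
      x≡ : x ≡ Lv
      x≡ = trans (sym (ℓ-at xu)) (trans (cong ℓ (sym e)) (P.ℓv i))

    -- By `cross` and the layers, `u` or `v` of one piece can be in another separator only as its
    -- `u` or `v`. Different pairs therefore give a vertex of one separator outside the other, which
    -- makes both inclusions strict.
    new-top : ∀ i j → ¬ (P.u i ≡ P.u j × P.v i ≡ P.v j) → ∃ λ y → Both (P.U i) y × ¬ Both (P.U j) y
    new-top i j ne with Near? (P.U j) (P.u i) ×-dec Beyond? (P.U j) (P.u i) | Near? (P.U j) (P.v i) ×-dec Beyond? (P.U j) (P.v i)
    ... | no nb | _ = P.u i , P.onBoth i (top-u i) , nb
    ... | yes _ | no nb = P.v i , P.onBoth i (top-v i) , nb
    ... | yes b | yes b′ = ⊥-elim (ne (same-u i j (P.members j b) , same-v i j (P.members j b′)))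

    module _ (i j : Fin t) (ij : suc (toℕ i) ≡ toℕ j) where
      near-mono : ∀ {y} → Near (P.U i) y → Near (P.U j) y
      near-mono (x , tx , ix , f) = x , tx , ix , ¬t⇒f (λ t → t≢f (nested i j ij x t) f)

      beyond-anti : ∀ {y} → Beyond (P.U j) y → Beyond (P.U i) y
      beyond-anti (x , tx , ix , f) = x , tx , ix , nested i j ij x f

      A-strict : S.A i ⊂ S.A j
      A-strict with new-top j i (λ (a , b) → distinct i j ij (sym a , sym b))
      ... | y , (a , b) , nb = (λ m → ∈-subset⁺ (Near? (P.U j)) (near-mono (∈-subset⁻ (Near? (P.U i)) m))) ,
            y , ∈-subset⁺ (Near? (P.U j)) a , λ m → nb (∈-subset⁻ (Near? (P.U i)) m , beyond-anti b)

      B-strict : S.B j ⊂ S.B i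
      B-strict with new-top i j (distinct i j ij)
      ... | y , (a , b) , nb = (λ m → ∈-subset⁺ (Beyond? (P.U i)) (beyond-anti (∈-subset⁻ (Beyond? (P.U j)) m))) ,
            y , ∈-subset⁺ (Beyond? (P.U i)) b , λ m → nb (near-mono a , ∈-subset⁻ (Beyond? (P.U j)) m)

    module Labels {s α β k : ℕ} (ps : p ≤ s) (qs : q ≤ s) {lab : Fin t → Vec (Fin n) k}
        (L : ∀ i → Listing (P.u i) (P.v i) s s α β k (lab i)) where

      mixed : ∀ i j {x y} (a b : Fin k) → s ≤ x → x ≤ ℓ (P.u i) → y ≤ ℓ (P.v j) →
        lookup (lab i) a ≡ at (P.u i) x → lookup (lab j) b ≡ at (P.v j) y → lookup (lab i) a ≢ lookup (lab j) b
      mixed i j {x} {y} a b sx xu yv ea eb e = cross i j {x} (≤-trans ps sx) (≤-trans qs sx) (subst (x ≤_) (P.ℓu i) xu)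
          (subst (_≤ Lv) (sym xy) (subst (y ≤_) (P.ℓv j) yv))
          (trans (sym ea) (trans e (trans eb (cong (at (P.v j)) (sym xy)))))
        where
        xy : x ≡ y
        xy = at-ℓ-≡ xu yv ea eb e

      consistent : ∀ i j a b → lookup (lab i) a ≡ lookup (lab j) b → a ≡ b
      consistent i j a b e with Listing.slot (L i) a | Listing.slot (L j) b
      ... | slotᵃ x sx xu ea ra | slotᵃ y _ yu eb rb =
            FP.toℕ-injective (+-cancelʳ-≡ s _ _ (trans ra (trans xy (sym rb))))
        where
        xy : x ≡ y
        xy = at-ℓ-≡ xu yu ea eb e
      ... | slotᵇ x sx xu ea ra | slotᵇ y _ yu eb rb =
            FP.toℕ-injective (+-cancelʳ-≡ y _ _ (trans (cong (toℕ a +_) (sym xy)) (trans ra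
              (trans (cong (α +_) (trans (P.ℓv i) (sym (P.ℓv j)))) (sym rb)))))
        where
        xy : x ≡ y
        xy = at-ℓ-≡ xu yu ea eb e
      ... | slotᵃ x sx xu ea ra | slotᵇ y _ yv eb rb = ⊥-elim (mixed i j a b sx xu yv ea eb e)
      ... | slotᵇ y _ yv eb rb | slotᵃ x sx xu ea ra = ⊥-elim (mixed j i b a sx xu yv ea eb (sym e))

      same-layer : ∀ i j a → ∃ λ l → Layer G l (lookup (lab i) a) × Layer G l (lookup (lab j) a)
      same-layer i j a = ℓ (lookup (lab i) a) , Layer-ℓ _ , subst (λ l → Layer G l (lookup (lab j) a)) (sym eqℓ) (Layer-ℓ _)
        where
        eqℓ : ℓ (lookup (lab i) a) ≡ ℓ (lookup (lab j) a)
        eqℓ with Listing.slot (L i) a | Listing.slot (L j) a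
        ... | slotᵃ x sx xu ea ra | slotᵃ y _ yu eb rb =
              trans (cong ℓ ea) (trans (ℓ-at xu) (trans (trans (sym ra) rb) (trans (sym (ℓ-at yu)) (cong ℓ (sym eb)))))
        ... | slotᵇ x sx xu ea ra | slotᵇ y _ yu eb rb =
              trans (cong ℓ ea) (trans (ℓ-at xu) (trans (+-cancelˡ-≡ (toℕ a) _ _ (trans ra
                (trans (cong (α +_) (trans (P.ℓv i) (sym (P.ℓv j)))) (sym rb)))) (trans (sym (ℓ-at yu)) (cong ℓ (sym eb)))))
        ... | slotᵃ x sx xu ea ra | slotᵇ y _ yv eb rb =
              ⊥-elim (<⇒≱ (rankᵃ< {toℕ a} {s} {α} (Listing.lengthᵃ (L i)) xu ra) (rankᵇ≥ {toℕ a} yv rb))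
        ... | slotᵇ y _ yv eb rb | slotᵃ x sx xu ea ra =
              ⊥-elim (<⇒≱ (rankᵃ< {toℕ a} {s} {α} (Listing.lengthᵃ (L j)) xu ra) (rankᵇ≥ {toℕ a} yv rb))

    Cyclic : Set
    Cyclic = ∀ i → Adj (at (P.u i) p) (at (P.v i) q) × (∀ {y} → ℓ y ≡ 0 → Near (P.U i) y)

    min-layer : p ≤ q → ∀ i y m → y ∈ S.S i → Layer G m y → p ≤ m
    min-layer pq i y m my ly with S.S⁻ i my
    ... | onᵃ x px xu e = ≤-trans px (≤-reflexive (trans (sym (ℓ-at xu)) (trans (cong ℓ (sym e)) (ℓ-unique ly))))
    ... | onᵇ x qx xv e = ≤-trans pq (≤-trans qx (≤-reflexive (trans (sym (ℓ-at xv)) (trans (cong ℓ (sym e)) (ℓ-unique ly)))))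

    Layer-at : ∀ {x i} → i ≤ ℓ x → Layer G i (at x i)
    Layer-at {x} {i} le = subst (λ l → Layer G l (at x i)) (ℓ-at le) (Layer-ℓ _)

    Shape : (m k : ℕ) → (Fin t → Vec (Fin n) m) → Set
    Shape m k lab =
      (m ≡ k × 1 ≤ m × (∀ i → InducesPath G (S.S i) m (lab i)) ×
        (∀ i (a : Fin m) → toℕ a ≡ 0 ⊎ suc (toℕ a) ≡ m → Layer G 0 (lookup (lab i) a)))
      ⊎
      ((∀ i → toℕ i ≡ 0 → ∀ y → Layer G 0 y → y ∈ S.A i) × (m + 1 ≡ k ⊎ m + 2 ≡ k) ×
        (∀ i → ∃ λ vs → ∃ λ vd → (∃ λ l → Layer G l vs × Layer G l vd × (∀ y j → y ∈ S.S i → Layer G j y → l ≤ j)) ×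
          ((vs ≡ vd × InducesCycle G (S.S i) (suc m) (vs ∷ lab i)) ⊎
           (vs ≢ vd × InducesCycle G (S.S i) (suc (suc m)) ((vs ∷ lab i) ∷ʳ vd)))))

    module Build {s α β : ℕ} (ps : p ≤ s) (qs : q ≤ s) (ea : α + s ≡ suc Lu) (eb : β + s ≡ suc Lv) where
      list : ∀ i → Σ (Vec (Fin n) (β + α)) (Listing (P.u i) (P.v i) s s α β (β + α))
      list i = listing (P.u i) (P.v i) α β s s (trans ea (cong suc (sym (P.ℓu i)))) (trans eb (cong suc (sym (P.ℓv i))))

      lab : ∀ i → Vec (Fin n) (β + α)
      lab i = proj₁ (list i)

      open Labels ps qs {lab} (λ i → proj₂ (list i)) public

      sequence : ∀ {k} → (∀ i → ∣ S.S i ∣ ≡ k) → Shape (β + α) k lab → WellFormedSeparatorSequence G t k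
      sequence sizes shape = record
        { A = S.A ; B = S.B ; S = S.S
        ; cover = S.cover ; noEdge = S.noEdge ; sep = λ _ → refl ; size = sizes
        ; A-strict = A-strict ; B-strict = B-strict
        ; p' = β + α ; lab = lab ; shape = shape
        ; labels-consistent = consistent ; twoPerLayer = S.two-per-layer ; sameLayer = same-layer }

    path-sequence : p ≡ 0 → q ≡ 0 → (∀ i → Adj (at (P.u i) p) (at (P.v i) q) → p ≡ ℓ (P.u i) × q ≡ ℓ (P.v i)) →
      WellFormedSeparatorSequence G t (suc Lv + suc Lu)
    path-sequence refl refl none = sequence (λ i → S.size i (proj₂ (list i)))
        (inj₁ (refl , s≤s z≤n , (λ i → S.induces-path i (proj₂ (list i)) (none i)) , ends))
      where
      open Build {0} {suc Lu} {suc Lv} z≤n z≤n (+-identityʳ _) (+-identityʳ _)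
      ends : ∀ i (a : Fin (suc Lv + suc Lu)) → toℕ a ≡ 0 ⊎ suc (toℕ a) ≡ suc Lv + suc Lu → Layer G 0 (lookup (lab i) a)
      ends i a z with Listing.slot (proj₂ (list i)) a
      ... | slotᵃ x _ xu e s = subst (Layer G 0) (sym e) (subst (λ m → Layer G m (at (P.u i) x)) x0 (Layer-at xu))
        where
        x0 : x ≡ 0
        x0 = [ (λ a0 → trans (sym s) (trans (+-identityʳ _) a0)) ,
               (λ al → ⊥-elim (<⇒≱ (rankᵃ< {toℕ a} {0} {suc Lu} (Listing.lengthᵃ (proj₂ (list i))) xu s)
                         (s≤s⁻¹ (≤-trans (s≤s (m≤n+m (suc Lu) Lv)) (≤-reflexive (sym al)))))) ]′ z
      ... | slotᵇ x _ xv e s = subst (Layer G 0) (sym e) (subst (λ m → Layer G m (at (P.v i) x)) x0 (Layer-at xv))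
        where
        x0 : x ≡ 0
        x0 = [ (λ a0 → ⊥-elim (n≮0 (≤-trans (s≤s z≤n) (≤-trans (rankᵇ≥ {toℕ a} {x} {suc Lu} xv s) (≤-reflexive a0))))) ,
               (λ al → +-cancelˡ-≡ (toℕ a) _ _ (trans s (trans (cong (suc Lu +_) (P.ℓv i))
                   (trans (+-comm (suc Lu) Lv) (trans (suc-injective (sym al)) (sym (+-identityʳ _))))))) ]′ z

    -- For `p ≡ q` both ends of the closing edge are in the lowest layer and serve as the two
    -- special vertices. For `suc p ≡ q` only `at u p` is there, and the two coincide. In both cases
    -- the labels start at layer `suc p`.
    cycle-sequence : p ≡ q ⊎ suc p ≡ q → ¬ (p ≡ Lu × q ≡ Lv) → Cyclic →
      ∃ λ k → k ≤ suc Lv + suc Lu × WellFormedSeparatorSequence G t k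
    cycle-sequence pq proper cyc = by-case pq
      where
      na nb : ℕ
      na = Lu ∸ p
      nb = Lv ∸ p
      p≤Lv : p ≤ Lv
      p≤Lv = [ (λ { refl → qv }) , (λ { refl → ≤-trans (n≤1+n p) qv }) ]′ pq
      ea : na + suc p ≡ suc Lu
      ea = trans (+-suc na p) (cong suc (m∸n+n≡m pu))
      eb : nb + suc p ≡ suc Lv
      eb = trans (+-suc nb p) (cong suc (m∸n+n≡m p≤Lv))
      outerA : ∀ i → toℕ i ≡ 0 → ∀ y → Layer G 0 y → y ∈ S.A i
      outerA i _ y ly = ∈-subset⁺ (Near? (P.U i)) (proj₂ (cyc i) (ℓ-unique ly))
      pu′ : ∀ i → p ≤ ℓ (P.u i)
      pu′ i = subst (p ≤_) (sym (P.ℓu i)) pu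
      qv′ : ∀ i → q ≤ ℓ (P.v i)
      qv′ i = subst (q ≤_) (sym (P.ℓv i)) qv
      proper′ : ∀ i → ¬ (p ≡ ℓ (P.u i) × q ≡ ℓ (P.v i))
      proper′ i (a , b) = proper (trans a (P.ℓu i) , trans b (P.ℓv i))
      bound : ∀ {x y} → x ≤ suc Lv → y ≤ suc Lu → x + y ≤ suc Lv + suc Lu
      bound = +-mono-≤
      by-case : p ≡ q ⊎ suc p ≡ q → ∃ λ k → k ≤ suc Lv + suc Lu × WellFormedSeparatorSequence G t k
      by-case (inj₂ refl) = suc (nb + na) , ≤-trans (≤-reflexive (sym (+-suc nb na))) (bound (≤-trans (m∸n≤m Lv p) (n≤1+n Lv)) (s≤s (m∸n≤m Lu p))) ,
          sequence (λ i → S.size i (whole i)) (inj₂ (outerA , inj₁ (+-comm (nb + na) 1) , λ i → at (P.u i) p , at (P.u i) p ,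
            (p , Layer-at (pu′ i) , Layer-at (pu′ i) , min-layer (n≤1+n p) i) ,
            inj₁ (refl , S.induces-cycle i (whole i) (pu′ i) (qv′ i) (proper′ i) (proj₁ (cyc i)))))
        where
        open Build {suc p} {na} {nb} (n≤1+n p) ≤-refl ea eb
        whole : ∀ i → Listing (P.u i) (P.v i) p (suc p) (suc na) nb (suc (nb + na)) (at (P.u i) p ∷ lab i)
        whole i = listing-cons (proj₂ (list i))
      by-case (inj₁ refl) = suc (suc (nb + na)) , ≤-trans (≤-reflexive (cong suc (sym (+-suc nb na)))) (bound (s≤s (m∸n≤m Lv p)) (s≤s (m∸n≤m Lu p))) ,
          sequence (λ i → S.size i (whole i)) (inj₂ (outerA , inj₂ (+-comm (nb + na) 2) , λ i → at (P.u i) p , at (P.v i) p ,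
            (p , Layer-at (pu′ i) , Layer-at (qv′ i) , min-layer ≤-refl i) ,
            inj₂ (cross i i ≤-refl ≤-refl pu qv , S.induces-cycle i (whole i) (pu′ i) (qv′ i) (proper′ i) (proj₁ (cyc i)))))
        where
        open Build {suc p} {na} {nb} (n≤1+n p) (n≤1+n p) ea eb
        whole : ∀ i → Listing (P.u i) (P.v i) p p (suc na) (suc nb) (suc (suc (nb + na))) ((at (P.u i) p ∷ lab i) ∷ʳ at (P.v i) p)
        whole i = listing-snoc (listing-cons (proj₂ (list i)))

-- Types of chords and nesting along the path

lookup-< : ∀ {xs} → AllPairs _<_ xs → ∀ (i j : Fin (length xs)) → toℕ i < toℕ j → List.lookup xs i < List.lookup xs j
lookup-< {x ∷ xs} (lt ∷ _) F.zero (F.suc j) _ = All.lookup lt (∈-lookup j)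
lookup-< {x ∷ xs} (_ ∷ s) (F.suc i) (F.suc j) (s≤s ij) = lookup-< s i j ij

opposite-< : ∀ {n} (i j : Fin n) → toℕ i < toℕ j → toℕ (opposite j) < toℕ (opposite i)
opposite-< {n} i j lt = subst₂ _<_ (sym (FP.opposite-prop j)) (sym (FP.opposite-prop i)) (∸-monoʳ-< (s≤s lt) (FP.toℕ<n j))

xor-true-cases : ∀ {a b} → a xor b ≡ true → (a ≡ true × b ≡ false) ⊎ (a ≡ false × b ≡ true)
xor-true-cases {true}  {false} _ = inj₁ (refl , refl)
xor-true-cases {false} {true}  _ = inj₂ (refl , refl)

module Selection {n : ℕ} (G : PlaneGraph n) (T : TriangulatedDisk G) (r : ℕ) (lay : AtMostLayers G r) where
  open Assembly G T r lay public

  Sequences : ℕ → Set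
  Sequences t = ∃ λ p → p ≤ 2 * r × WellFormedSeparatorSequence G t p

  module OnPath {D : ℕ} (path : DualPath D) where
    open Tracking path

    -- Index 0 is left out since `X 0` is an edge of the outer cycle, whereas `Edge` needs an inner
    -- face on both sides.
    In : ℕ → Set
    In k = 1 ≤ k × k ≤ D

    In? : ∀ k → Dec (In k)
    In? k = (1 ≤? k) ×-dec (k ≤? D)

    abstract
      nt : ∀ {k} → In k → ¬ Tr (X k)
      nt i = far-nontree (proj₂ i)

      X-inner : ∀ {k} → In k → ¬ Outer (X k)
      X-inner i = far-inner (inside (proj₂ i))

    X₀-near : ∀ {k} → In k → far (X k) x₀ ≡ false
    X₀-near {k} (1≤k , le) = trans (cong (far (X k)) (sym start)) (outside 1≤k le)

    abstract
      αX-inner : ∀ {k} → In k → ¬ Outer (αf (X k))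
      αX-inner {k} i o = t≢f (inside (proj₂ i)) (trans (cong (far (X k)) x≡) (X₀-near i))
        where
        x≡ : X k ≡ x₀
        x≡ = trans (sym αα) (cong αf (Outer-nt o (¬Tr-α (nt i))))

    module At {k} (i : In k) = Edge (nt i) (X-inner i) (αX-inner i)

    X-inj : ∀ {k k′} → k < k′ → k′ ≤ D → X k ≢ X k′
    X-inj {k} {k′} lt le e = t≢f (inside le) (trans (cong (far (X k′)) (sym e)) (outside lt le))

    X-ends-inj : ∀ {k k′} → k < k′ → k′ ≤ D → ¬ (tail (X k) ≡ tail (X k′) × head (X k) ≡ head (X k′))
    X-ends-inj lt le (t , h) = X-inj lt le (simple _ _ t h)

    -- By `sides`, a common separator vertex on the tail path of one edge and the head path of the
    -- other is above both ends of the later edge. So tail and head paths of different edges can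
    -- meet only where the two paths of a single edge do (`cross′`).
    meet-somewhere : ∀ {k k′} → In k → In k′ → ∀ {y} → y ≼ tail (X k) → y ≼ head (X k′) →
      Both (far (X k)) y → Both (far (X k′)) y →
      (y ≼ tail (X k′) × y ≼ head (X k′)) ⊎ (y ≼ tail (X k) × y ≼ head (X k))
    meet-somewhere {k} {k′} (_ , le) (_ , le′) a b both both′ with ≤-total k k′
    ... | inj₁ kk = inj₁ (sides true kk le′ a b (proj₁ both) (proj₂ both′) , b)
    ... | inj₂ kk = inj₂ (a , sides false kk le b a (proj₁ both′) (proj₂ both))

    meets : ∀ {y a b} → y ≼ a × y ≼ b → at a (ℓ y) ≡ at b (ℓ y)
    meets (ya , yb) = trans (eq ya) (sym (eq yb))

    cross′ : ∀ {k k′ p q} (i : In k) (i′ : In k′) → At.NoMeet i p q → At.NoMeet i′ p q → q ≤ suc p → p ≤ suc q →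
      ∀ {x} → p ≤ x → q ≤ x → x ≤ ℓ (tail (X k)) → x ≤ ℓ (head (X k′)) → at (tail (X k)) x ≢ at (head (X k′)) x
    cross′ {k} {k′} {p} {q} i i′ nm nm′ qp pq {x} px qx xu xv e =
      [ (λ m → nm′ (≤-trans px (≤-reflexive (sym ly))) (≤-trans qx (≤-reflexive (sym ly))) (ℓ≤ (proj₁ m)) (ℓ≤ (proj₂ m)) (meets m))
      , (λ m → nm (≤-trans px (≤-reflexive (sym ly))) (≤-trans qx (≤-reflexive (sym ly))) (ℓ≤ (proj₁ m)) (ℓ≤ (proj₂ m)) (meets m)) ]′
      (meet-somewhere i i′ (at-≼ xu) (subst (_≼ head (X k′)) (sym e) (at-≼ xv))
        (At.OnSide.far-Both i nm qp pq (onᵃ x px xu refl)) (At.OnSide.far-Both i′ nm′ qp pq (onᵇ x qx xv e)))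
      where
      ly : ℓ (at (tail (X k)) x) ≡ x
      ly = ℓ-at xu

    NearDart : ∀ {k z} → In k → ¬ Tr z → far (X k) z ≡ false → Near (far (X k)) (tail z)
    NearDart {k} {z} i ntz f with Outer? z
    ... | no iz = z , refl , iz , f
    -- The only outer dart off the tree is `outer`. The triangle of `x₀` serves instead, being
    -- outside every region of index at least 1.
    ... | yes oz = φ x₀ , trans (tail-φ x₀) (trans (head-α outer) (cong tail (sym (Outer-nt oz ntz)))) ,
          inner-φ (Outer-α outer-Outer) , trans (far-inv (X k) x₀) (X₀-near i)

    data Kind : Set where
      tree left right : Kind

    -- A `left` chord has a region around that of `X k`, a `right` chord a region within it. For
    -- non-tree chords `laminar` and `not-disjoint` leave no third case.
    KindFact : Kind → ℕ → Fin d → Set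
    KindFact tree  k g = Tr g
    KindFact left  k g = ¬ Tr g × X k ⊆ᶠ g
    KindFact right k g = ¬ Tr g × g ⊆ᶠ X k

    record Chosen (κ : Kind) (p q k : ℕ) : Set where
      field
        range : In k
        c     : At.Closing range p q
        max   : At.Maximal range p q
      open At.Closed range c max public
      field
        fact  : KindFact κ k g

    data View (k : ℕ) : Set where
      isOpen   : (i : In k) → (∀ p q → ¬ At.Closing i p q) → View k
      isClosed : ∀ κ p q → Chosen κ p q k → View k

    view : ∀ {k} → In k → View k
    view {k} i with At.status i
    ... | At.open′ none = isOpen i none
    ... | At.closed p q c max with Tr? (At.Closing.g i c)
    ...   | yes t = isClosed tree p q (record { range = i ; c = c ; max = max ; fact = t })
    ...   | no ntg with laminar (nt i) ntg (At.Closing.g≢e i c)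
    ...     | disjoint dis _ = ⊥-elim (At.Closed.not-disjoint i c max ntg dis)
    ...     | below _ _ sub = isClosed left p q (record { range = i ; c = c ; max = max ; fact = ntg , sub })
    ...     | above _ _ sub = isClosed right p q (record { range = i ; c = c ; max = max ; fact = ntg , sub })

    kind# p# q# : ∀ {k} → View k → ℕ
    kind# (isOpen _ _) = 0
    kind# (isClosed tree _ _ _) = 1
    kind# (isClosed left _ _ _) = 2
    kind# (isClosed right _ _ _) = 3
    p# (isOpen _ _) = 0
    p# (isClosed _ p _ _) = p
    q# (isOpen _ _) = 0
    q# (isClosed _ _ q _) = q

    kind#<4 : ∀ {k} (w : View k) → kind# w < 4
    kind#<4 (isOpen _ _) = s≤s z≤n
    kind#<4 (isClosed tree _ _ _) = s≤s (s≤s z≤n)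
    kind#<4 (isClosed left _ _ _) = s≤s (s≤s (s≤s z≤n))
    kind#<4 (isClosed right _ _ _) = s≤s (s≤s (s≤s (s≤s z≤n)))

    p#<r : ∀ {k} (w : View k) → p# w < r
    p#<r {k} (isOpen _ _) = ≤-trans (s≤s z≤n) (ℓ<r (tail (X k)))
    p#<r (isClosed _ p _ c) = ≤-trans (s≤s (Chosen.p≤ c)) (ℓ<r _)

    q#<r : ∀ {k} (w : View k) → q# w < r
    q#<r {k} (isOpen _ _) = ≤-trans (s≤s z≤n) (ℓ<r (tail (X k)))
    q#<r (isClosed _ _ q c) = ≤-trans (s≤s (Chosen.q≤ c)) (ℓ<r _)

    h : ℕ → ℕ
    h k = ℓ (tail (X k)) + ℓ (head (X k))

    h-same : ∀ {i g} → SameEdge (X i) g → ℓ (tail g) + ℓ (head g) ≡ h i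
    h-same (inj₁ refl) = refl
    h-same {i} (inj₂ refl) = trans (cong (λ v → ℓ (head (X i)) + ℓ v) (head-α (X i))) (+-comm (ℓ (head (X i))) _)

    module InWindow {lo up low : ℕ} (up≤D : ∀ {i} → i < up → i ≤ D)
                    (minimal : ∀ {i} → lo ≤ i → i < up → low ≤ h i) where

      Member : ℕ → Set
      Member k = lo ≤ k × k < up × h k ≡ low

      module _ {κ p q k} (mk : Member k) (C : Chosen κ p q k) where
        open Chosen C

        p+q<h : p + q < h k
        p+q<h with m≤n⇒m<n∨m≡n p≤ | m≤n⇒m<n∨m≡n q≤
        ... | inj₁ lt | _ = +-mono-<-≤ lt q≤
        ... | inj₂ _ | inj₁ lt = +-mono-≤-< p≤ lt
        ... | inj₂ a | inj₂ b = ⊥-elim (proper (a , b))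

        -- The end layers of `g` sum to `p + q`, which is below `low`, while every edge crossed in
        -- the window has sum at least `low`.
        off-window : ∀ {i} → lo ≤ i → i < up → ¬ SameEdge (X i) g
        off-window {i} li iu s = <⇒≱ p+q<h (≤-trans (≤-reflexive (proj₂ (proj₂ mk))) (≤-trans (minimal li iu)
          (≤-reflexive (trans (sym (h-same s)) (cong₂ _+_ (trans (cong ℓ tail-g) (ℓ-at p≤)) (trans (cong ℓ head-g) (ℓ-at q≤)))))))

      module _ {κ κ′ p q k k′} (C : Chosen κ p q k) (C′ : Chosen κ′ p q k′) where
        private
          module C = Chosen C
          module C′ = Chosen C′

        chosen-cross : ∀ {x} → p ≤ x → q ≤ x → x ≤ ℓ (tail (X k)) → x ≤ ℓ (head (X k′)) → at (tail (X k)) x ≢ at (head (X k′)) x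
        chosen-cross = cross′ C.range C′.range (At.max-NoMeet C.range C.max) (At.max-NoMeet C′.range C′.max) C.q≤1+p C.p≤1+q

        -- The layers `p` and `q` single out one vertex on each path of `X k′`. An end of `C.g` on
        -- the wrong path would be a meeting of the kind `nontree-ends` excludes.
        same-closing : ¬ Tr C.g → ¬ Tr C′.g → Both (far (X k′)) (tail C.g) → Both (far (X k′)) (head C.g) → C.g ≡ C′.g
        same-closing ntg ntg′ bt bh = simple C.g C′.g
            (trans (sym (eq (tail≼ (Both-ends (nt C′.range) bt)))) (trans (cong (at (tail (X k′))) lt) (sym C′.tail-g)))
            (trans (sym (eq (head≼ (Both-ends (nt C′.range) bh)))) (trans (cong (at (head (X k′))) lh) (sym C′.head-g)))
          where
          lt : ℓ (tail C.g) ≡ p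
          lt = trans (cong ℓ C.tail-g) (ℓ-at C.p≤)
          lh : ℓ (head C.g) ≡ q
          lh = trans (cong ℓ C.head-g) (ℓ-at C.q≤)
          t≼ : tail C.g ≼ tail (X k)
          t≼ = subst (_≼ tail (X k)) (sym C.tail-g) (at-≼ C.p≤)
          h≼ : head C.g ≼ head (X k)
          h≼ = subst (_≼ head (X k)) (sym C.head-g) (at-≼ C.q≤)
          none : ∀ {y} → ℓ y ≡ p ⊎ ℓ y ≡ q → (y ≼ tail (X k′) × y ≼ head (X k′)) ⊎ (y ≼ tail (X k) × y ≼ head (X k)) → ⊥
          none l (inj₁ m) = C′.nontree-ends ntg′ l (ℓ≤ (proj₁ m)) (ℓ≤ (proj₂ m)) (meets m)
          none l (inj₂ m) = C.nontree-ends ntg l (ℓ≤ (proj₁ m)) (ℓ≤ (proj₂ m)) (meets m)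
          tail≼ : tail C.g ≼ tail (X k′) ⊎ tail C.g ≼ head (X k′) → tail C.g ≼ tail (X k′)
          tail≼ (inj₁ s) = s
          tail≼ (inj₂ s) = ⊥-elim (none (inj₁ lt) (meet-somewhere C.range C′.range t≼ s C.tail-Both bt))
          head≼ : head C.g ≼ tail (X k′) ⊎ head C.g ≼ head (X k′) → head C.g ≼ head (X k′)
          head≼ (inj₂ s) = s
          head≼ (inj₁ s) = ⊥-elim (none (inj₂ lh) (swap (meet-somewhere C′.range C.range s h≼ bh C.head-Both)))

      nested-tree : ∀ {p q k k′} (C : Chosen tree p q k) (C′ : Chosen tree p q k′) → k < k′ →
        ∀ x → Chosen.U C′ x ≡ true → Chosen.U C x ≡ true
      nested-tree {k = k} {k′} C C′ lt x t = cong₂ _xor_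
          (nested (<⇒≤ lt) (proj₂ C′.range) x ([ proj₁ , (λ (_ , f) → t≢f f (far-tree C′.fact x)) ]′ (xor-true-cases t)))
          (far-tree C.fact x)
        where
        module C = Chosen C
        module C′ = Chosen C′

      -- A face of the later region could be missing from the earlier one only inside `far C.g`.
      -- That region is disjoint from `far (X k′)`, or contains it, so that `C.g` is crossed within
      -- the window against `off-window`, or lies inside it, and then `C.g` is `C′.g`.
      nested-right : ∀ {p q k k′} (C : Chosen right p q k) (C′ : Chosen right p q k′) → Member k → Member k′ → k < k′ →
        ∀ x → Chosen.U C′ x ≡ true → Chosen.U C x ≡ true
      nested-right {p} {q} {k} {k′} C C′ m m′ lt x t with xor-true-cases t
        where module C′ = Chosen C′
      ... | inj₂ (a , b) = t≢f (proj₂ (Chosen.fact C′) x b) a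
      ... | inj₁ (a , b) = cong₂ _xor_ (nested (<⇒≤ lt) le′ x a) (¬t⇒f λ gx → contra gx (laminar (nt C′.range) ntg ns))
        where
        module C = Chosen C
        module C′ = Chosen C′
        le′ = proj₂ C′.range
        ntg = proj₁ C.fact
        ns : ¬ SameEdge (X k′) C.g
        ns = off-window m C (proj₁ m′) (proj₁ (proj₂ m′))
        contra : far C.g x ≡ true → Laminar (X k′) C.g → ⊥
        contra gx (disjoint dis _) = dis x a gx
        contra gx (below _ _ sub) =
          let i , ki , ik , s = on-path (<⇒≤ lt) le′ ntg (proj₂ C.fact) sub
          in off-window m C (≤-trans (proj₁ m) ki) (≤-trans (s≤s ik) (proj₁ (proj₂ m′))) s
        contra gx (above in′ _ _) = t≢f (subst (λ g → far g x ≡ true) (same-closing C C′ ntg (proj₁ C′.fact)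
            (Near-mono (<⇒≤ lt) le′ (proj₁ C.tail-Both) , C.g , refl , far-inner in′ , in′)
            (Near-mono (<⇒≤ lt) le′ (proj₁ C.head-Both) , αf C.g , refl , far-inner inα , inα)) gx) b
          where
          inα : far (X k′) (αf C.g) ≡ true
          inα = trans (sym (far-local′ (X k′) ntg ns)) in′

      -- The chord `C′.g` cannot lie inside `far (X k)`, as it would be crossed within the window.
      -- So its region contains `far (X k)`, its ends are in the separator of `X k`, and it equals
      -- `C.g`; only the subtracted region shrinks.
      nested-left : ∀ {p q k k′} (C : Chosen left p q k) (C′ : Chosen left p q k′) → Member k → Member k′ → k < k′ →
        ∀ x → Chosen.U C x ≡ true → Chosen.U C′ x ≡ true
      nested-left {p} {q} {k} {k′} C C′ m m′ lt x t with xor-true-cases t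
        where module C = Chosen C
      ... | inj₁ (a , b) = t≢f (proj₂ (Chosen.fact C) x a) b
      ... | inj₂ (a , b) = cong₂ _xor_ (¬t⇒f (λ f → t≢f (nested (<⇒≤ lt) le′ x f) a)) (inside-g′ (laminar (nt C.range) ntg′ ns))
        where
        module C = Chosen C
        module C′ = Chosen C′
        le′ = proj₂ C′.range
        ntg′ = proj₁ C′.fact
        ns : ¬ SameEdge (X k) C′.g
        ns = off-window m′ C′ (proj₁ m) (proj₁ (proj₂ m))
        inside-g′ : Laminar (X k) C′.g → far C′.g x ≡ true
        inside-g′ (disjoint dis _) = ⊥-elim (dis (X k′) (nested (<⇒≤ lt) le′ _ (inside le′)) (proj₂ C′.fact _ (inside le′)))
        inside-g′ (above _ _ sub) =
          let i , ki , ik , s = on-path (<⇒≤ lt) le′ ntg′ sub (proj₂ C′.fact)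
          in ⊥-elim (off-window m′ C′ (≤-trans (proj₁ m) ki) (≤-trans (s≤s ik) (proj₁ (proj₂ m′))) s)
        inside-g′ (below _ out′ _) = subst (λ g → far g x ≡ true) (sym (same-closing C′ C ntg′ (proj₁ C.fact)
            (NearDart C.range ntg′ out′ , Beyond-anti (<⇒≤ lt) le′ (proj₂ C′.tail-Both))
            (NearDart C.range (¬Tr-α ntg′) (trans (sym (far-local′ (X k) ntg′ ns)) out′) , Beyond-anti (<⇒≤ lt) le′ (proj₂ C′.head-Both)))) b

      module Build {Lu Lv : ℕ} {t : ℕ} (K : Fin (suc t) → ℕ)
          (tails : ∀ i → ℓ (tail (X (K i))) ≡ Lu) (heads : ∀ i → ℓ (head (X (K i))) ≡ Lv)
          (differ : ∀ i j → suc (toℕ i) ≡ toℕ j → ¬ (tail (X (K i)) ≡ tail (X (K j)) × head (X (K i)) ≡ head (X (K j)))) where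

        width : ∀ {k} → k ≤ suc Lv + suc Lu → k ≤ 2 * r
        width le = ≤-trans le (+-mono-≤ (subst (_< r) (heads F.zero) (ℓ<r _))
          (≤-trans (subst (_< r) (tails F.zero) (ℓ<r _)) (≤-reflexive (sym (+-identityʳ r)))))

        open-sequence : (∀ i → Σ (In (K i)) λ iₖ → ∀ p q → ¬ At.Closing iₖ p q) →
          (∀ i j → suc (toℕ i) ≡ toℕ j → K i < K j) → Sequences (suc t)
        open-sequence opens mono = suc Lv + suc Lu , width ≤-refl , path-sequence refl refl (λ i → chord i z≤n z≤n)
          where
          range : ∀ i → In (K i)
          range i = proj₁ (opens i)
          chord : ∀ i {a b} → a ≤ ℓ (tail (X (K i))) → b ≤ ℓ (head (X (K i))) → Adj (at (tail (X (K i))) a) (at (head (X (K i))) b) →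
            a ≡ ℓ (tail (X (K i))) × b ≡ ℓ (head (X (K i)))
          chord i {a} {b} au bv ad with (a ≟ ℓ (tail (X (K i)))) ×-dec (b ≟ ℓ (head (X (K i))))
          ... | yes y = y
          ... | no ny = ⊥-elim (proj₂ (opens i) a b (At.closing {i = proj₁ (opens i)} au bv ny ad))
          piece : Fin (suc t) → Piece 0 0 Lu Lv
          piece i = record { u = tail (X (K i)) ; v = head (X (K i)) ; ℓu = tails i ; ℓv = heads i
            ; uv = X (K i) , refl , refl ; U = far (X (K i)) ; inv = far-inv _
            ; members = At.open-members (range i)
            ; onBoth = At.OnSide.far-Both (range i) (At.open-NoMeet (range i) (proj₂ (opens i))) z≤n z≤n
            ; chord = λ {a} {b} _ _ au bv ad → inj₁ (chord i au bv ad) }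
          open Sequence piece z≤n z≤n
            (λ i j ij → nested (<⇒≤ (mono i j ij)) (proj₂ (range j)))
            (λ i j px qx xu xv → cross′ (range i) (range j) (At.open-NoMeet (range i) (proj₂ (opens i)))
              (At.open-NoMeet (range j) (proj₂ (opens j))) z≤n z≤n px qx
              (≤-trans xu (≤-reflexive (sym (tails i)))) (≤-trans xv (≤-reflexive (sym (heads j)))))
            differ

        closed-sequence : ∀ {κ p q} (C : ∀ i → Chosen κ p q (K i)) →
          (∀ i j → suc (toℕ i) ≡ toℕ j → ∀ x → Chosen.U (C j) x ≡ true → Chosen.U (C i) x ≡ true) → Sequences (suc t)
        closed-sequence {κ} {p} {q} C mono = by-case order
          where
          module C i = Chosen (C i)
          pu : p ≤ Lu
          pu = subst (p ≤_) (tails F.zero) (C.p≤ F.zero)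
          qv : q ≤ Lv
          qv = subst (q ≤_) (heads F.zero) (C.q≤ F.zero)
          proper : ¬ (p ≡ Lu × q ≡ Lv)
          proper (a , b) = C.proper F.zero (trans a (sym (tails F.zero)) , trans b (sym (heads F.zero)))
          order : (p ≡ q ⊎ suc p ≡ q) ⊎ suc q ≡ p
          order with m≤n⇒m<n∨m≡n (C.q≤1+p F.zero) | m≤n⇒m<n∨m≡n (C.p≤1+q F.zero)
          ... | inj₂ e | _ = inj₁ (inj₂ (sym e))
          ... | inj₁ _ | inj₂ e = inj₂ (sym e)
          ... | inj₁ a | inj₁ b = inj₁ (inj₁ (≤-antisym (s≤s⁻¹ b) (s≤s⁻¹ a)))
          piece : Fin (suc t) → Piece p q Lu Lv
          piece i = record { u = tail (X (K i)) ; v = head (X (K i)) ; ℓu = tails i ; ℓv = heads i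
            ; uv = X (K i) , refl , refl ; U = C.U i ; inv = C.U-inv i
            ; members = C.members i ; onBoth = C.U-Both i ; chord = C.no-chord i }
          cross : ∀ i j {x} → p ≤ x → q ≤ x → x ≤ Lu → x ≤ Lv → at (tail (X (K i))) x ≢ at (head (X (K j))) x
          cross i j px qx xu xv = chosen-cross (C i) (C j) px qx
            (≤-trans xu (≤-reflexive (sym (tails i)))) (≤-trans xv (≤-reflexive (sym (heads j))))
          by-case : (p ≡ q ⊎ suc p ≡ q) ⊎ suc q ≡ p → Sequences (suc t)
          by-case (inj₁ o) =
            let k , le , s = Sequence.cycle-sequence piece pu qv mono cross differ o proper (λ i → C.adj i , C.boundary-Near i)
            in k , width le , s
          by-case (inj₂ o) =
            let k , le , s = Sequence.cycle-sequence (λ i → piece-swap (piece i)) qv pu mono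
                  (λ i j qx px xv xu e → cross j i px qx xu xv (sym e))
                  (λ i j ij (a , b) → differ i j ij (b , a)) (inj₂ o) (λ (a , b) → proper (b , a))
                  (λ i → Adj-sym (C.adj i) , C.boundary-Near i)
            in k , width (≤-trans le (≤-reflexive (+-comm (suc Lu) (suc Lv)))) , s

-- Pigeonholing and the final bound

module Conclusion {n : ℕ} (G : PlaneGraph n) (T : TriangulatedDisk G) (r′ : ℕ) (lay : AtMostLayers G (suc r′)) where
  open Selection G T (suc r′) lay public

  module _ {D : ℕ} (path : DualPath D) where
    open Tracking path
    open OnPath path

    -- The value 0 outside the range is a default; `pick` works within the range only.
    colour : (∀ {k} → View k → ℕ) → ℕ → ℕ
    colour f k with In? k
    ... | yes i = f (view i)
    ... | no _  = 0

    colour-< : ∀ (f : ∀ {k} → View k → ℕ) {b} → (∀ {k} (w : View k) → f w < suc b) → ∀ k → colour f k < suc b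
    colour-< f bound k with In? k
    ... | yes i = bound (view i)
    ... | no _  = s≤s z≤n

    data Picked (p q : ℕ) : ℕ → ℕ → Set where
      pickOpen  : ∀ {k} (i : In k) → (∀ p q → ¬ At.Closing i p q) → Picked p q 0 k
      pickTree  : ∀ {k} → Chosen tree p q k → Picked p q 1 k
      pickLeft  : ∀ {k} → Chosen left p q k → Picked p q 2 k
      pickRight : ∀ {k} → Chosen right p q k → Picked p q 3 k

    pick : ∀ {k p q κ} → In k → colour p# k ≡ p → colour q# k ≡ q → colour kind# k ≡ κ → Picked p q κ k
    pick {k} i ep eq eκ with In? k
    ... | no ni = ⊥-elim (ni i)
    ... | yes i′ with view i′
    pick i refl refl refl | yes _ | isOpen i″ none = pickOpen i″ none
    pick i refl refl refl | yes _ | isClosed tree p q c = pickTree c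
    pick i refl refl refl | yes _ | isClosed left p q c = pickLeft c
    pick i refl refl refl | yes _ | isClosed right p q c = pickRight c

    module _ {lo up low : ℕ} (up≤D : ∀ {i} → i < up → i ≤ D) (minimal : ∀ {i} → lo ≤ i → i < up → low ≤ h i) where
      open InWindow up≤D minimal

      record Entry (Lu p q κ k : ℕ) : Set where
        field
          member : Member k
          tail-ℓ : ℓ (tail (X k)) ≡ Lu
          picked : Picked p q κ k

        range : k ≤ D
        range = up≤D (proj₁ (proj₂ member))

        head-ℓ : ℓ (head (X k)) ≡ low ∸ Lu
        head-ℓ = trans (sym (m+n∸m≡n Lu _)) (cong (_∸ Lu) (trans (cong (_+ ℓ (head (X k))) (sym tail-ℓ)) (proj₂ (proj₂ member))))

      module _ {t Lu p q κ : ℕ} (K : Fin (suc t) → ℕ) (entry : ∀ i → Entry Lu p q κ (K i)) where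
        module E i = Entry (entry i)

        increasing : (∀ i j → suc (toℕ i) ≡ toℕ j → K i < K j) → κ ≢ 2 → Sequences (suc t)
        increasing mono κ≢2 = by-kind (λ i → E.picked i)
          where
          open Build K E.tail-ℓ E.head-ℓ (λ i j ij → X-ends-inj (mono i j ij) (E.range j))
          by-kind : (∀ i → Picked p q κ (K i)) → Sequences (suc t)
          by-kind pk with pk F.zero
          ... | pickOpen _ _ = open-sequence (λ i → opens (pk i)) mono
            where
            opens : ∀ {k} → Picked p q 0 k → Σ (In k) λ i → ∀ p q → ¬ At.Closing i p q
            opens (pickOpen i none) = i , none
          ... | pickTree _ = closed-sequence C (λ i j ij → nested-tree (C i) (C j) (mono i j ij))
            where
            get : ∀ {k} → Picked p q 1 k → Chosen tree p q k
            get (pickTree c) = c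
            C : ∀ i → Chosen tree p q (K i)
            C i = get (pk i)
          ... | pickLeft _ = ⊥-elim (κ≢2 refl)
          ... | pickRight _ = closed-sequence C (λ i j ij → nested-right (C i) (C j) (E.member i) (E.member j) (mono i j ij))
            where
            get : ∀ {k} → Picked p q 3 k → Chosen right p q k
            get (pickRight c) = c
            C : ∀ i → Chosen right p q (K i)
            C i = get (pk i)

        -- Left chords cut off the near side of the separators, so the regions grow along the path.
        decreasing : (∀ i j → suc (toℕ i) ≡ toℕ j → K j < K i) → κ ≡ 2 → Sequences (suc t)
        decreasing anti refl = closed-sequence C (λ i j ij → nested-left (C j) (C i) (E.member j) (E.member i) (anti i j ij))
          where
          open Build K E.tail-ℓ E.head-ℓ
            (λ i j ij (a , b) → X-ends-inj (anti i j ij) (E.range i) (sym a , sym b))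
          get : ∀ {k} → Picked p q 2 k → Chosen left p q k
          get (pickLeft c) = c
          C : ∀ i → Chosen left p q (K i)
          C i = get (E.picked i)

      -- Kind 2 is `left`, for which the list is read backwards.
      from-list : ∀ {Lu p q κ} xs → 1 ≤ length xs → AllPairs _<_ xs → All (Entry Lu p q κ) xs → Sequences (length xs)
      from-list {Lu} {p} {q} {κ} (x ∷ xs) _ srt all = by-κ (κ ≟ 2)
        where
        entry : ∀ i → Entry Lu p q κ (List.lookup (x ∷ xs) i)
        entry i = All.lookup all (∈-lookup i)
        by-κ : Dec (κ ≡ 2) → Sequences (suc (length xs))
        by-κ (no ne) = increasing (List.lookup (x ∷ xs)) entry
          (λ i j ij → lookup-< srt i j (≤-reflexive ij)) ne
        by-κ (yes e) = decreasing (λ i → List.lookup (x ∷ xs) (opposite i)) (λ i → entry (opposite i))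
          (λ i j ij → lookup-< srt (opposite j) (opposite i) (opposite-< i j (≤-reflexive ij))) e

    both : ∀ {P Q : ℕ → Set} {xs} → All P xs → All Q xs → All (λ x → P x × Q x) xs
    both ps qs = All.zipWith id (ps , qs)

    bounded : ∀ {P : ℕ → Set} {f : ℕ → ℕ} {b xs} → (∀ k → f k < b) → All P xs → All (λ x → f x < b) xs
    bounded lt ps = All.map (λ {k} _ → lt k) ps

    -- The four rounds divide the `m` indices by r, r, r and 4. The layer of the head needs no
    -- round, being `low` minus that of the tail.
    extract-window : ∀ m t {hi} → 1 ≤ t → suc r′ * (suc r′ * (suc r′ * (4 * t))) ≤ m → hi ≤ suc D →
      Window.MinWindow h m 1 hi → ∃ λ t′ → t ≤ t′ × Sequences t′
    extract-window m t 1≤t enough hi≤ W = pigeon₁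
      (pigeonhole-list (λ k → ℓ (tail (X k))) r′ (suc r′ * (suc r′ * (4 * t))) xs sorted good
        (bounded (λ k → ℓ<r (tail (X k))) good) (≤-trans enough (≤-reflexive (sym length-xs))))
      where
      open Window.MinWindow W
      up≤D : ∀ {i} → i < up → i ≤ D
      up≤D lt = s≤s⁻¹ (≤-trans lt (≤-trans up≤hi hi≤))
      Member : ℕ → Set
      Member k = lo ≤ k × k < up × h k ≡ low
      Goal : Set
      Goal = ∃ λ t′ → t ≤ t′ × Sequences t′
      Class : (ℕ → Set) → (ℕ → ℕ) → ℕ → Set
      Class Q f t = ∃ λ c → Σ (List ℕ) λ ys → t ≤ length ys × AllPairs _<_ ys × All Q ys × All (λ x → f x ≡ c) ys
      entry : ∀ {Lu p q κ k} → ((Member k × ℓ (tail (X k)) ≡ Lu) × colour p# k ≡ p) × colour q# k ≡ q → colour kind# k ≡ κ →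
        Entry up≤D minimal Lu p q κ k
      entry (((mem , eu) , ep) , eq) eκ = record { member = mem ; tail-ℓ = eu
        ; picked = pick (≤-trans l≤lo (proj₁ mem) , up≤D (proj₁ (proj₂ mem))) ep eq eκ }
      pigeon₄ : ∀ {Lu p q} → Class (λ k → ((Member k × ℓ (tail (X k)) ≡ Lu) × colour p# k ≡ p) × colour q# k ≡ q) (colour kind#) t → Goal
      pigeon₄ (κ , ys , l , s , g , c) = length ys , l , from-list up≤D minimal ys (≤-trans 1≤t l) s
        (All.zipWith (λ (a , b) → entry a b) (g , c))
      pigeon₃ : ∀ {Lu p} → Class (λ k → (Member k × ℓ (tail (X k)) ≡ Lu) × colour p# k ≡ p) (colour q#) (4 * t) → Goal
      pigeon₃ (_ , ys , l , s , g , c) = pigeon₄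
        (pigeonhole-list (colour kind#) 3 t ys s (both g c) (bounded (colour-< kind# kind#<4) g) l)
      pigeon₂ : ∀ {Lu} → Class (λ k → Member k × ℓ (tail (X k)) ≡ Lu) (colour p#) (suc r′ * (4 * t)) → Goal
      pigeon₂ (_ , ys , l , s , g , c) = pigeon₃
        (pigeonhole-list (colour q#) r′ (4 * t) ys s (both g c) (bounded (colour-< q# q#<r) g) l)
      pigeon₁ : Class Member (λ k → ℓ (tail (X k))) (suc r′ * (suc r′ * (4 * t))) → Goal
      pigeon₁ (_ , ys , l , s , g , c) = pigeon₂
        (pigeonhole-list (colour p#) r′ (suc r′ * (4 * t)) ys s (both g c) (bounded (colour-< p# p#<r) g) l)

    extract : ∀ m t → 1 ≤ t → suc r′ * (suc r′ * (suc r′ * (4 * t))) ≤ m → D ≡ m ^ (r′ + (suc r′ + 0)) →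
      ∃ λ t′ → t ≤ t′ × Sequences t′
    extract m t 1≤t enough D≡ = extract-window m t 1≤t enough (≤-reflexive (trans (+-comm _ 1) (cong suc (sym D≡))))
        -- The window search starts at index 1, as `In` requires, with 0 as lower bound for the
        -- layer sums.
        (Window.window h m (r′ + (suc r′ + 0)) 0 1 (λ {i} _ _ → z≤n , h< i))
      where
      h< : ∀ i → h i < 0 + (r′ + (suc r′ + 0))
      h< i = ≤-trans (s≤s (+-mono-≤ (s≤s⁻¹ (ℓ<r (tail (X i)))) (s≤s⁻¹ (ℓ<r (head (X i))))))
        (≤-reflexive (trans (sym (+-suc r′ r′)) (cong (λ z → r′ + suc z) (sym (+-identityʳ r′)))))

  -- `6 ≤ m` and `1 ≤ D` give `3 + D ≤ m * D`, which absorbs the constants of the halving argument.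
  long-path : ∀ m D → 6 ≤ m → 1 ≤ D → 2 ^ (m * D) ≤ n → DualPath D
  long-path m D 6≤m 1≤D le = dualPath D (begin
    3 * 2 ^ suc D     ≤⟨ *-monoˡ-≤ (2 ^ suc D) (n≤1+n 3) ⟩
    4 * 2 ^ suc D     ≡⟨ *-assoc 2 2 (2 ^ suc D) ⟩
    2 ^ (3 + D)       ≤⟨ ^-monoʳ-≤ 2 exponent ⟩
    2 ^ (m * D)       ≤⟨ le ⟩
    n                 ≤⟨ m≤m+n n 3 ⟩
    n + 3             ∎)
    where
    open ≤-Reasoning
    exponent : 3 + D ≤ m * D
    exponent = ≤-trans (≤-trans (+-monoˡ-≤ D (≤-trans (s≤s (s≤s (s≤s z≤n))) (*-monoʳ-≤ 5 1≤D))) (≤-reflexive (+-comm (5 * D) D)))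
      (*-monoˡ-≤ D 6≤m)

  separators : ∀ t → 1 ≤ t → 2 ^ ((6 ^ suc r′ * t) ^ (2 * suc r′)) ≤ n → ∃ λ t′ → t ≤ t′ × Sequences t′
  separators t 1≤t le = extract (long-path m D 6≤m 1≤D le) m t 1≤t enough refl
    where
    m = 6 ^ suc r′ * t
    -- The exponent is `2 * suc r′` less one in unfolded form, so that `m * D` is `m ^ (2 * suc r′)`
    -- by definition.
    D = m ^ (r′ + (suc r′ + 0))
    6≤m : 6 ≤ m
    6≤m = *-mono-≤ (*-monoʳ-≤ 6 (m^n>0 6 r′)) 1≤t
    1≤D : 1 ≤ D
    1≤D = m^n>0 m {{>-nonZero (≤-trans (s≤s z≤n) 6≤m)}} (r′ + (suc r′ + 0))
    s = suc r′
    enough : s * (s * (s * (4 * t))) ≤ m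
    enough = ≤-trans (≤-reflexive (trans (cong (s *_) (trans (cong (s *_) (sym (*-assoc s 4 t))) (sym (*-assoc s (s * 4) t))))
      (sym (*-assoc s (s * (s * 4)) t)))) (*-monoˡ-≤ t (cubic≤6^ r′))

-- The bound on `t` is free of roots and logarithms: for positive `n` it says that `6 ^ r * t` is at
-- most the `2 * r`-th root of the logarithm of `n`.
theorem1 : ∀ (r n : ℕ) → 1 ≤ r → (G : PlaneGraph n) → TriangulatedDisk G →
    AtMostLayers G r →
    ∀ (t : ℕ) → 2 ^ ((6 ^ r * t) ^ (2 * r)) ≤ n →
    ∃ λ t' → t ≤ t' × ∃ λ p → p ≤ 2 * r × WellFormedSeparatorSequence G t' p
-- The empty sequence; its width is set to 1 because the path shape asks for at least one label.
theorem1 (suc r) n _ G T lay zero _ = 0 , z≤n , 1 , s≤s z≤n , record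
  { A = λ () ; B = λ () ; S = λ () ; cover = λ () ; noEdge = λ () ; sep = λ () ; size = λ ()
  ; A-strict = λ () ; B-strict = λ () ; p' = 1 ; lab = λ ()
  ; shape = inj₁ (refl , s≤s z≤n , (λ ()) , λ ())
  ; labels-consistent = λ () ; twoPerLayer = λ () ; sameLayer = λ () }
theorem1 (suc r) n _ G T lay (suc t) le = Conclusion.separators G T r lay (suc t) (s≤s z≤n) le
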